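{- Let $q\equiv 3\pmod 4$ be a prime power, let $a\in\mathbb{F}_q^*$ be a square in $\mathbb{F}_q$, let $b\in\mathbb{F}_q$ satisfy $b^2=a$, and let $n$ be an even positive integer such that $\operatorname{rad}(n)$ divides $q-1$. Then for every irreducible factor $f(x)$ of $D_n(x,a)$ in $\mathbb{F}_q[x]$ there exist $\alpha\in\mathbb{F}_{q^2}^*$ and a positive divisor $t$ of $\frac{4n}{\gcd(4n,q^2-1)}$ satisfying (i) $\alpha^{2n/t}=-1$, (ii) $\operatorname{rad}(t)$ divides $\operatorname{ord}_{q^2}(\alpha)$, (iii) $\gcd\left(t,\frac{q^2-1}{\operatorname{ord}_{q^2}(\alpha)}\right)=1$, such that $f(x)$ is of the following type: (a) $f(x)=D_t(x,a)-b^t(\alpha+\alpha^{ -1})$ in the case that $\alpha\in\mathbb{F}_q^*$ or $\alpha^{q+1}=1$; (b) $f(x)=\left(D_t(x,a)-b^t(\alpha+\alpha^{ -1})\right)\left(D_t(x,a)-b^t(\alpha^q+\alpha^{ -q})\right)$ otherwise.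
   Context: For $n\ge 1$ and $a\in\mathbb{F}_q$, the $n$-th Dickson polynomial of the first kind with parameter $a$ is $D_n(x,a)=\sum_{i=0}^{\lfloor n/2\rfloor}\frac{n}{n-i}\binom{n-i}{i}(-a)^i x^{n-2i}\in\mathbb{F}_q[x]$ (the numbers $\frac{n}{n-i}\binom{n-i}{i}$ are integers, viewed in $\mathbb{F}_q$). $\operatorname{rad}(n)$ is the product of the distinct primes dividing $n$, with $\operatorname{rad}(1)=1$. $\operatorname{ord}_{q^2}(\alpha)$ is the multiplicative order of $\alpha$ in the cyclic group $\mathbb{F}_{q^2}^*$. Irreducible factors are normalized to be monic. -}

module Defs where

open import Algebra.Bundles using (CommutativeRing; RawRing)
import Algebra.Definitions.RawSemiring as RawSemiringDefs
open import Data.Fin.Base using (Fin; toℕ)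
open import Data.List.Base using (List; []; _∷_; map; filter; upTo)
open import Data.Nat.Base as ℕ using (ℕ; zero; suc; _∸_; _≤_; _<_; ⌊_/2⌋)
open import Data.Nat.Combinatorics using (_C_)
open import Data.Nat.Divisibility using (_∣?_)
open import Data.Nat.ListAction using (product)
open import Data.Nat.Primality using (Prime; prime?)
open import Data.Product using (∃-syntax; _×_)
open import Function.Bundles using (Inverse)
open import Level using (_⊔_) renaming (suc to lsuc)
open import Relation.Binary.PropositionalEquality using (_≡_)
import Relation.Binary.PropositionalEquality as ≡
open import Relation.Nullary using (¬_)
open import Relation.Nullary.Decidable using (_×-dec_)

------------------------------------------------------------------------
-- Natural numbers

-- Division without a NonZero argument; m ÷ 0 is a junk value.
infixl 7 _÷_
_÷_ : ℕ → ℕ → ℕ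
m ÷ zero  = 0
m ÷ suc d = m ℕ./ suc d

IsPrimePower : ℕ → Set
IsPrimePower q = ∃[ p ] ∃[ k ] (Prime p × 0 < k × q ≡ p ℕ.^ k)

-- Meaningful for n > 0, when every divisor of n is at most n.
rad : ℕ → ℕ
rad n = product (filter (λ p → prime? p ×-dec (p ∣? n)) (upTo (suc n)))

-- The integer n/(n-i) · binom(n-i, i).  For 1 ≤ n and i ≤ ⌊n/2⌋ the
-- divisor is positive and the division is exact.
dicksonCoeff : ℕ → ℕ → ℕ
dicksonCoeff n i = (n ℕ.* ((n ∸ i) C i)) ÷ (n ∸ i)

------------------------------------------------------------------------
-- Finite fields

record FiniteField c ℓ (q : ℕ) : Set (lsuc (c ⊔ ℓ)) where
  field
    commutativeRing : CommutativeRing c ℓ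

  open CommutativeRing commutativeRing public

  infix 8 _⁻¹
  field
    1≉0         : ¬ (1# ≈ 0#)
    -- Total for convenience; nothing is assumed about 0# ⁻¹.
    _⁻¹         : Carrier → Carrier
    *-inverseʳ  : ∀ {x} → ¬ (x ≈ 0#) → x * x ⁻¹ ≈ 1#
    enumeration : Inverse setoid (≡.setoid (Fin q))

  open RawSemiringDefs (RawRing.rawSemiring rawRing) public using (_^_)

  HasOrder : Carrier → ℕ → Set ℓ
  HasOrder α o = 0 < o × α ^ o ≈ 1# × (∀ k → 0 < k → α ^ k ≈ 1# → o ≤ k)

------------------------------------------------------------------------
-- Univariate polynomials

module Polynomial {c ℓ} (R : RawRing c ℓ) where

  private
    module R where
      open RawRing R public
      open RawSemiringDefs rawSemiring public using (_^_) renaming (_×_ to _·_)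
  open R using (Carrier)

  -- Coefficients, constant term first.  Trailing zeros are allowed, so
  -- polynomials are compared by _≈_ below and not by _≡_.
  Poly : Set c
  Poly = List Carrier

  coeff : Poly → ℕ → Carrier
  coeff []      k       = R.0#
  coeff (x ∷ p) zero    = x
  coeff (x ∷ p) (suc k) = coeff p k

  infix  4 _≈_
  infixl 6 _+_ _-_
  infixl 7 _*_
  infix  8 -_

  _≈_ : Poly → Poly → Set ℓ
  p ≈ q = ∀ k → coeff p k R.≈ coeff q k

  const : Carrier → Poly
  const x = x ∷ []

  X : Poly
  X = R.0# ∷ R.1# ∷ []

  _+_ : Poly → Poly → Poly
  []      + q       = q
  (x ∷ p) + []      = x ∷ p
  (x ∷ p) + (y ∷ q) = (x R.+ y) ∷ (p + q)

  -_ : Poly → Poly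
  -_ = map R.-_

  _-_ : Poly → Poly → Poly
  p - q = p + (- q)

  _*_ : Poly → Poly → Poly
  []      * q = []
  (x ∷ p) * q = map (x R.*_) q + (R.0# ∷ p * q)

  rawRing : RawRing c ℓ
  rawRing = record
    { Carrier = Poly
    ; _≈_     = _≈_
    ; _+_     = _+_
    ; _*_     = _*_
    ; -_      = -_
    ; 0#      = []
    ; 1#      = const R.1#
    }

  open RawSemiringDefs (RawRing.rawSemiring rawRing) public
    using (_∣_; _^_; sum; Irreducible)

  Monic : Poly → Set ℓ
  Monic p = ∃[ d ] (coeff p d R.≈ R.1# × (∀ k → d < k → coeff p k R.≈ R.0#))

  -- The Dickson polynomial Dₙ(x, a) of the first kind, for n ≥ 1.
  dickson : ℕ → Carrier → Poly
  dickson n a = sum {suc ⌊ n /2⌋} λ i →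
    const (dicksonCoeff n (toℕ i) R.· (R.- a) R.^ toℕ i) * X ^ (n ∸ 2 ℕ.* toℕ i)

{-# OPTIONS --safe #-}

-- Write a root of f as x = b (y + y⁻¹) in a field L containing K = 𝔽q².  Such an L is K[z]/(g), where g is a monic
-- factor of minimal positive degree of z^(deg f) f(b (z + z⁻¹)).  As Dₙ(x, a) = bⁿ (yⁿ + y⁻ⁿ), f ∣ Dₙ means
-- y^2n = -1.  Let t > 0 be least with y^t ∈ K and put α = y^t.  A prime r ∣ t divides n, hence q - 1; if r ord(α)
-- divided q² - 1, then y^(t/r) would be fixed by the q²-Frobenius and lie in K.  This gives the conditions on rad t
-- and the gcd, and α^(q+1) = 1 forces t = 1; α ∈ 𝔽q is impossible, as q - 1 is twice an odd number.
-- If α^(q+1) ≠ 1, the conjugates x^(q^i), i < 2t, are distinct: y^(q^k) = y is excluded by lifting the exponent, and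
-- y^(q^k) = y⁻¹ would give y^(q+1) = 1, since (q^k + 1)/(q + 1) ≡ 1 modulo q - 1 for odd k.
-- A monic g ∈ 𝔽q[x] with g(x) = 0 and no larger degree than the number of conjugates of x divides f, hence equals f.
-- Take for g the polynomial D_t - b^t (α + α⁻¹), respectively its product with its Frobenius conjugate.

module Submission where

open import Algebra.Bundles using (AbelianGroup; CommutativeMonoid; CommutativeRing)
import Algebra.Morphism.Construct.Composition as Composition
import Algebra.Morphism.Construct.Identity as Identity
open import Algebra.Morphism.Structures using (module RingMorphisms)
import Algebra.Properties.CommutativeMonoid.Sum
import Algebra.Properties.CommutativeSemigroup
import Algebra.Properties.CommutativeSemiring.Binomial
import Algebra.Properties.CommutativeSemiring.Exp
import Algebra.Properties.Ring
import Algebra.Properties.Semiring.Mult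
import Algebra.Properties.Semiring.Mult.TCOptimised
import Algebra.Solver.Ring
open import Algebra.Solver.Ring.AlmostCommutativeRing
  using (fromCommutativeRing; _-Raw-AlmostCommutative⟶_)
open import Data.Fin.Base as Fin using (Fin; zero; suc; toℕ; fromℕ; inject₁; punchIn)
import Data.Fin.Permutation as Perm
import Data.Fin.Properties as Fin
open import Data.Integer.Base as ℤ using (ℤ; -[1+_]; _⊖_; _◃_)
import Data.Integer.Properties as ℤ
open import Data.List.Base as List using (List; []; _∷_; _++_; map; length; take; upTo)
open import Data.List.Membership.Propositional using (_∈_)
import Data.List.Membership.Propositional.Properties as ∈
import Data.List.Properties as List
open import Data.List.Relation.Unary.All as All using (All; []; _∷_)
import Data.List.Relation.Unary.All.Properties as All
open import Data.List.Relation.Unary.AllPairs using ([]; _∷_)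
open import Data.List.Relation.Unary.Any using (here; there)
open import Data.List.Relation.Unary.Unique.Propositional using (Unique)
import Data.List.Relation.Unary.Unique.Propositional.Properties as Unique
open import Data.Maybe.Base as Maybe using (Maybe)
open import Data.Nat.Base as ℕ using (ℕ; zero; suc; s≤s; z≤n; ⌊_/2⌋)
open import Data.Nat.Combinatorics as C using (_C_; nCn≡1)
open import Data.Nat.Coprimality as Coprime using (Coprime)
import Data.Nat.DivMod as ℕ
open import Data.Nat.Divisibility as ∣ using (divides; _∣?_)
open import Data.Nat.GCD using (gcd; gcd[m,n]∣m; gcd[m,n]∣n; gcd[m,n]≡0⇒m≡0)
import Data.Nat.Induction as ℕ
open import Data.Nat.ListAction using (product)
open import Data.Nat.ListAction.Properties using (∈⇒∣product)
open import Data.Nat.Primality using (Prime; prime?; prime[2]; euclidsLemma; ¬prime[0]; ¬prime[1];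
  prime⇒nonZero; prime⇒nonTrivial; prime⇒irreducible)
open import Data.Nat.Primality.Factorisation using (factorise)
import Data.Nat.Properties as ℕ
open import Data.Nat.Tactic.RingSolver using (solve-∀)
open import Data.Product.Base using (∃; ∃-syntax; _×_; _,_; proj₁; proj₂)
open import Data.Sign.Base as Sign using (Sign)
open import Data.Sum.Base using (_⊎_; inj₁; inj₂; [_,_]′)
open import Function.Base using (id; _∘_)
open import Function.Bundles using (Inverse)
open import Induction.WellFounded using (Acc; acc)
open import Level using (_⊔_) renaming (suc to lsuc)
open import Relation.Binary.Definitions using (tri<; tri≈; tri>)
open import Relation.Binary.PropositionalEquality as ≡ using (_≡_; _≢_)
import Relation.Binary.Reasoning.Setoid
open import Relation.Nullary using (¬_; Dec; yes; no; contradiction)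
open import Relation.Nullary.Decidable using (dec⇒maybe; map′; _×-dec_)
open import Relation.Unary using (Pred; Decidable)
open import Defs

-- The residue 3 modulo 4 enters through one parity obstruction: y^2n = -1 excludes y^m = 1 for
-- every m that is twice an odd number, and q^k - 1 for odd k as well as q^k + 1 for even k are of
-- this kind. It also gives 4 ∣ q² - 1, which yields y^((q² - 1) n) = 1, hence t ∣ n, and which
-- saves lifting the exponent at the prime 2. Both x and y must lie in one field containing K;
-- substituting z + 1/z into f before adjoining a root produces them together. The factor b makes
-- the two summands of x = b y + b / y have product a, so that D_k(x, a) = b^k (y^k + y^-k) for
-- every k; at k = t this makes x a root of D_t - b^t (α + α⁻¹). No theory of factorization is used:
-- as K is finite, the least degree of a monic factor can be searched for, and minimality suffices
-- to invert every nonzero residue. Two conjugates of x agree only if some y^(q^k) with 0 < k < 2t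
-- has the same sum with its inverse as y has, that is, equals y or y⁻¹. This is why exactly these
-- two equations have to be excluded.

-- Integer coefficients for the ring solver

module IntegerCoefficients {c ℓ} (R : CommutativeRing c ℓ) where
  open CommutativeRing R
  open Algebra.Properties.Ring ring
  open Algebra.Properties.Semiring.Mult.TCOptimised semiring renaming (_×_ to _·_)
  open Relation.Binary.Reasoning.Setoid setoid

  -- With this version of multiples `1 · 1#` reduces to `1#`, so numerals in solver goals are the
  -- constants of the ring itself. Coefficients are compared in ℤ, whose equality is decidable even
  -- when that of the ring is not.
  ⟦_⟧ : ℤ → Carrier
  ⟦ ℤ.+ n ⟧      = n · 1#
  ⟦ -[1+ n ] ⟧ = - (suc n · 1#)

  private
    telescope : ∀ z x y → (z + x) - (z + y) ≈ x - y
    telescope z x y = begin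
      (z + x) - (z + y)       ≈⟨ +-congˡ (-‿+-comm z y) ⟨
      (z + x) + (- z + - y)   ≈⟨ +-congʳ (+-comm z x) ⟩
      (x + z) + (- z + - y)   ≈⟨ +-assoc x z _ ⟩
      x + (z + (- z + - y))   ≈⟨ +-congˡ (+-assoc z (- z) (- y)) ⟨
      x + ((z + - z) + - y)   ≈⟨ +-congˡ (+-congʳ (-‿inverseʳ z)) ⟩
      x + (0# + - y)          ≈⟨ +-congˡ (+-identityˡ _) ⟩
      x - y                   ∎

  ⟦⊖⟧ : ∀ m n → ⟦ m ⊖ n ⟧ ≈ m · 1# - n · 1#
  ⟦⊖⟧ zero    zero    = sym (-‿inverseʳ 0#)
  ⟦⊖⟧ zero    (suc n) = sym (+-identityˡ _)
  ⟦⊖⟧ (suc m) zero    = sym (trans (+-congˡ -0#≈0#) (+-identityʳ _))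
  ⟦⊖⟧ (suc m) (suc n) = begin
    ⟦ suc m ⊖ suc n ⟧                ≡⟨ ≡.cong ⟦_⟧ (ℤ.[1+m]⊖[1+n]≡m⊖n m n) ⟩
    ⟦ m ⊖ n ⟧                        ≈⟨ ⟦⊖⟧ m n ⟩
    m · 1# - n · 1#                  ≈⟨ telescope 1# _ _ ⟨
    (1# + m · 1#) - (1# + n · 1#)    ≈⟨ +-cong (1+× m 1#) (-‿cong (1+× n 1#)) ⟨
    suc m · 1# - suc n · 1#          ∎

  ⟦+⟧ : ∀ i j → ⟦ i ℤ.+ j ⟧ ≈ ⟦ i ⟧ + ⟦ j ⟧
  ⟦+⟧ (ℤ.+ m)      (ℤ.+ n)      = ×-homo-+ 1# m n
  ⟦+⟧ (ℤ.+ m)      -[1+ n ]   = ⟦⊖⟧ m (suc n)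
  ⟦+⟧ -[1+ m ]   (ℤ.+ n)      = trans (⟦⊖⟧ n (suc m)) (+-comm _ _)
  ⟦+⟧ -[1+ m ]   -[1+ n ]   = begin
    - (suc (suc (m ℕ.+ n)) · 1#)     ≡⟨ ≡.cong (λ k → - (suc k · 1#)) (ℕ.+-suc m n) ⟨
    - ((suc m ℕ.+ suc n) · 1#)       ≈⟨ -‿cong (×-homo-+ 1# (suc m) (suc n)) ⟩
    - (suc m · 1# + suc n · 1#)      ≈⟨ -‿+-comm _ _ ⟨
    - (suc m · 1#) + - (suc n · 1#)  ∎

  ⟦-⟧ : ∀ i → ⟦ ℤ.- i ⟧ ≈ - ⟦ i ⟧
  ⟦-⟧ (ℤ.+ zero)  = sym -0#≈0#
  ⟦-⟧ (ℤ.+ suc n) = refl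
  ⟦-⟧ -[1+ n ]  = sym (-‿involutive _)

  private
    -[x]*-[y]≈x*y : ∀ x y → - x * - y ≈ x * y
    -[x]*-[y]≈x*y x y = begin
      - x * - y    ≈⟨ -‿distribˡ-* x (- y) ⟨
      - (x * - y)  ≈⟨ -‿cong (-‿distribʳ-* x y) ⟨
      - - (x * y)  ≈⟨ -‿involutive _ ⟩
      x * y        ∎

    ⟦+◃⟧ : ∀ n → ⟦ Sign.+ ◃ n ⟧ ≈ n · 1#
    ⟦+◃⟧ zero    = refl
    ⟦+◃⟧ (suc n) = refl

    ⟦-◃⟧ : ∀ n → ⟦ Sign.- ◃ n ⟧ ≈ - (n · 1#)
    ⟦-◃⟧ zero    = sym -0#≈0#
    ⟦-◃⟧ (suc n) = refl

  ⟦*⟧ : ∀ i j → ⟦ i ℤ.* j ⟧ ≈ ⟦ i ⟧ * ⟦ j ⟧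
  ⟦*⟧ (ℤ.+ m)    (ℤ.+ n)    = trans (⟦+◃⟧ (m ℕ.* n)) (×1-homo-* m n)
  ⟦*⟧ (ℤ.+ m)    -[1+ n ] = trans (⟦-◃⟧ (m ℕ.* suc n))
    (trans (-‿cong (×1-homo-* m (suc n))) (-‿distribʳ-* _ _))
  ⟦*⟧ -[1+ m ] (ℤ.+ n)    = trans (⟦-◃⟧ (suc m ℕ.* n))
    (trans (-‿cong (×1-homo-* (suc m) n)) (-‿distribˡ-* _ _))
  ⟦*⟧ -[1+ m ] -[1+ n ] = begin
    ⟦ Sign.+ ◃ (suc m ℕ.* suc n) ⟧     ≈⟨ ×1-homo-* (suc m) (suc n) ⟩
    suc m · 1# * suc n · 1#            ≈⟨ -[x]*-[y]≈x*y _ _ ⟨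
    - (suc m · 1#) * - (suc n · 1#)    ∎

  homomorphism : ℤ.+-*-rawRing -Raw-AlmostCommutative⟶ fromCommutativeRing R
  homomorphism = record
    { ⟦_⟧    = ⟦_⟧
    ; +-homo = ⟦+⟧
    ; *-homo = ⟦*⟧
    ; -‿homo = ⟦-⟧
    ; 0-homo = refl
    ; 1-homo = refl
    }

  _coeff≟_ : ∀ i j → Maybe (⟦ i ⟧ ≈ ⟦ j ⟧)
  i coeff≟ j = Maybe.map (λ i≡j → reflexive (≡.cong ⟦_⟧ i≡j)) (dec⇒maybe (i ℤ.≟ j))

module RingSolver {c ℓ} (R : CommutativeRing c ℓ) where
  open Algebra.Solver.Ring ℤ.+-*-rawRing (fromCommutativeRing R)
    (IntegerCoefficients.homomorphism R) (IntegerCoefficients._coeff≟_ R) public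
    using (solve; _:+_; _:*_; _:-_; :-_; _:^_; _:=_; con)

module CommutativeRingTheory {c ℓ} (R : CommutativeRing c ℓ) where
  open CommutativeRing R public hiding (zero)
  open Algebra.Properties.Ring ring public
  open Algebra.Properties.CommutativeSemiring.Exp commutativeSemiring public
  open Algebra.Properties.Semiring.Mult semiring public renaming (_×_ to _·_)

-- Least numbers, primes and radicals

module Arithmetic where
  open import Data.Nat.Base using (_+_; _*_; _∸_; _^_; _≤_; _<_; _%_; ⌊_/2⌋)
  open import Data.Nat.Divisibility using (_∣_; _∤_)
  open ≡ using (refl; sym; trans; cong; cong₂; subst)

  -- For the predicate `x ^ k ≈ 1#` this unfolds to `HasOrder`, so that `least-positive` produces
  -- orders of elements directly.
  IsLeastPositive : ∀ {ℓ} → Pred ℕ ℓ → ℕ → Set ℓ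
  IsLeastPositive P m = 0 < m × P m × (∀ k → 0 < k → P k → m ≤ k)

  least-positive : ∀ {ℓ} {P : Pred ℕ ℓ} → Decidable P → ∀ {n} → 0 < n → P n → ∃ (IsLeastPositive P)
  least-positive {P = P} P? {n} 0<n Pn = search n (ℕ.<-wellFounded n) 0<n Pn
    where
    below? : ∀ n → (∃[ k ] (k < n × 0 < k × P k)) ⊎ (∀ k → 0 < k → P k → n ≤ k)
    below? n with ℕ.anyUpTo? (λ k → (0 ℕ.<? k) ×-dec P? k) n
    ... | yes below = inj₁ below
    ... | no ¬below = inj₂ λ k 0<k Pk → ℕ.≮⇒≥ λ k<n → ¬below (k , k<n , 0<k , Pk)

    search : ∀ n → Acc _<_ n → 0 < n → P n → ∃ (IsLeastPositive P)
    search n (acc rec) 0<n Pn with below? n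
    ... | inj₁ (k , k<n , 0<k , Pk) = search k (rec k<n) 0<k Pk
    ... | inj₂ least = n , 0<n , Pn , least

  prime-divisor : ∀ n → n ≢ 1 → ∃[ p ] (Prime p × p ∣ n)
  prime-divisor zero    _   = 2 , prime[2] , divides 0 refl
  prime-divisor n@(suc _) n≢1 with factorise n
  ... | record { factors = []; isFactorisation = eq } = contradiction eq n≢1
  ... | record { factors = p ∷ ps; isFactorisation = eq; factorsPrime = pp ∷ _ } =
    p , pp , subst (p ∣_) (sym eq) (∣.m∣m*n (product ps))

  primes⇒coprime : ∀ {m n} → (∀ {p} → Prime p → p ∣ m → p ∤ n) → Coprime m n
  primes⇒coprime avoid {d} (d∣m , d∣n) with d ℕ.≟ 1
  ... | yes d≡1 = d≡1
  ... | no d≢1 with prime-divisor d d≢1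
  ... | p , pp , p∣d = contradiction (∣.∣-trans p∣d d∣n) (avoid pp (∣.∣-trans p∣d d∣m))

  prime∣prime : ∀ {p r} → Prime p → Prime r → r ∣ p → r ≡ p
  prime∣prime {p} {r} pp pr r∣p with prime⇒irreducible pp r∣p
  ... | inj₁ refl = contradiction pr ¬prime[1]
  ... | inj₂ r≡p  = r≡p

  coprime-*∣ : ∀ {m n o} → Coprime m n → m ∣ o → n ∣ o → m * n ∣ o
  coprime-*∣ {m} {n} co m∣o (divides k refl) =
    subst (m * n ∣_) (ℕ.*-comm n k)
      (subst (_∣ n * k) (ℕ.*-comm n m)
        (∣.*-monoʳ-∣ n (Coprime.coprime-divisor co (subst (m ∣_) (ℕ.*-comm k n) m∣o))))

  prime∤⇒coprime : ∀ {p n} → Prime p → p ∤ n → Coprime p n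
  prime∤⇒coprime pp p∤n = primes⇒coprime λ pr r∣p r∣n →
    p∤n (subst (_∣ _) (prime∣prime pp pr r∣p) r∣n)

  prime∣product : ∀ {p} → Prime p → ∀ ns → p ∣ product ns → ∃[ n ] (n ∈ ns × p ∣ n)
  prime∣product pp []       p∣1 = contradiction (subst Prime (∣.∣1⇒≡1 p∣1) pp) ¬prime[1]
  prime∣product pp (n ∷ ns) p∣ with euclidsLemma n (product ns) pp p∣
  ... | inj₁ p∣n = n , here refl , p∣n
  ... | inj₂ p∣ns with prime∣product pp ns p∣ns
  ... | m , m∈ns , p∣m = m , there m∈ns , p∣m

  distinct-primes∣ : ∀ {o} ps → Unique ps → All Prime ps → All (_∣ o) ps → product ps ∣ o
  distinct-primes∣ []       _             _          _          = ∣.1∣ _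
  distinct-primes∣ (p ∷ ps) (p∉ps ∷ uniq) (pp ∷ pps) (p∣o ∷ ps∣o) =
    coprime-*∣ (prime∤⇒coprime pp p∤ps) p∣o (distinct-primes∣ ps uniq pps ps∣o)
    where
    p∤ps : p ∤ product ps
    p∤ps p∣ps with prime∣product pp ps p∣ps
    ... | r , r∈ps , p∣r = All.lookup p∉ps r∈ps (prime∣prime (All.lookup pps r∈ps) pp p∣r)

  prime∣⇒∣rad : ∀ {p n} → 0 < n → Prime p → p ∣ n → p ∣ rad n
  prime∣⇒∣rad {p} {n} 0<n pp p∣n = ∈⇒∣product
    (∈.∈-filter⁺ (λ p → prime? p ×-dec (p ∣? n)) (∈.∈-upTo⁺ (s≤s (∣.∣⇒≤ {{ℕ.>-nonZero 0<n}} p∣n))) (pp , p∣n))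

  rad∣ : ∀ {t o} → (∀ {r} → Prime r → r ∣ t → r ∣ o) → rad t ∣ o
  rad∣ {t} r∣t⇒r∣o = distinct-primes∣ _ (Unique.filter⁺ P? (Unique.upTo⁺ (suc t)))
    (All.map proj₁ all) (All.map (λ { (pr , r∣t) → r∣t⇒r∣o pr r∣t }) all)
    where
    P? = λ p → prime? p ×-dec (p ∣? t)
    all = All.all-filter P? (upTo (suc t))

  ÷-* : ∀ m {n} → 0 < n → (m * n) ÷ n ≡ m
  ÷-* m {suc n} _ = ℕ.m*n/n≡m m (suc n)

  -- Lifting the exponent

  -- geometric e m = 1 + Q + ⋯ + Q^(m-1) with Q = e + 1.
  geometric : ℕ → ℕ → ℕ
  geometric e zero    = 0
  geometric e (suc m) = 1 + suc e * geometric e m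

  geometric-^ : ∀ e m → suc e ^ m ≡ suc (e * geometric e m)
  geometric-^ e zero    = cong suc (sym (ℕ.*-zeroʳ e))
  geometric-^ e (suc m) = trans (cong (suc e *_) (geometric-^ e m)) (lemma e (geometric e m))
    where
    lemma : ∀ e s → suc e * suc (e * s) ≡ suc (e * (1 + suc e * s))
    lemma = solve-∀

  geometric-+ : ∀ e m n → geometric e (m + n) ≡ geometric e m + suc e ^ m * geometric e n
  geometric-+ e zero    n = sym (ℕ.+-identityʳ _)
  geometric-+ e (suc m) n = trans (cong (λ s → 1 + suc e * s) (geometric-+ e m n))
    (lemma (suc e) (geometric e m) (suc e ^ m) (geometric e n))
    where
    lemma : ∀ q s w u → 1 + q * (s + w * u) ≡ (1 + q * s) + (q * w) * u
    lemma = solve-∀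

  -- With Q = e + 1 this is the factorization (Q^mp - 1)/(Q - 1) = (Q^m - 1)/(Q - 1) · ((Q^m)^p -
  -- 1)/(Q^m - 1); the parameter of the last factor is Q^m - 1, in the form `e * geometric e m`.
  geometric-* : ∀ e m p → geometric e (m * p) ≡ geometric e m * geometric (e * geometric e m) p
  geometric-* e m zero    rewrite ℕ.*-zeroʳ m = sym (ℕ.*-zeroʳ (geometric e m))
  geometric-* e m (suc p) = begin
    geometric e (m * suc p)                              ≡⟨ cong (geometric e) (ℕ.*-suc m p) ⟩
    geometric e (m + m * p)                              ≡⟨ geometric-+ e m (m * p) ⟩
    s + suc e ^ m * geometric e (m * p)                  ≡⟨ cong₂ (λ u v → s + u * v) (geometric-^ e m) (geometric-* e m p) ⟩
    s + suc (e * s) * (s * geometric (e * s) p)          ≡⟨ lemma s (suc (e * s)) (geometric (e * s) p) ⟩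
    s * (1 + suc (e * s) * geometric (e * s) p)          ∎
    where
    open ≡.≡-Reasoning
    s = geometric e m
    lemma : ∀ s r u → s + r * (s * u) ≡ s * (1 + r * u)
    lemma = solve-∀

  -- The sum of `geometric e i` over i < m.
  rest : ℕ → ℕ → ℕ
  rest e zero    = 0
  rest e (suc m) = m + suc e * rest e m

  geometric-rest : ∀ e m → geometric e m ≡ m + e * rest e m
  geometric-rest e zero    = sym (ℕ.*-zeroʳ e)
  geometric-rest e (suc m) = trans (cong (λ s → 1 + suc e * s) (geometric-rest e m)) (lemma e m (rest e m))
    where
    lemma : ∀ e m r → 1 + suc e * (m + e * r) ≡ suc m + e * (m + suc e * r)
    lemma = solve-∀

  -- Every `geometric e i` is congruent to i modulo e, so the sum `rest e (suc m)` is congruent to 0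
  -- + 1 + ... + m; both sides are doubled to avoid halving.
  rest-mod : ∀ e m → ∃[ u ] (2 * rest e (suc m) ≡ suc m * m + e * u)
  rest-mod e zero    = 0 , lemma e
    where
    lemma : ∀ e → 2 * (0 + suc e * 0) ≡ 1 * 0 + e * 0
    lemma = solve-∀
  rest-mod e (suc m) with rest-mod e m
  ... | u , eq = 2 * rest e (suc m) + u , trans (lemma₁ e m (rest e (suc m)))
      (trans (cong (λ x → 2 * suc m + x + e * (2 * rest e (suc m))) eq) (lemma₂ e m u (rest e (suc m))))
    where
    lemma₁ : ∀ e m r → 2 * (suc m + suc e * r) ≡ 2 * suc m + 2 * r + e * (2 * r)
    lemma₁ = solve-∀
    lemma₂ : ∀ e m u r → 2 * suc m + (suc m * m + e * u) + e * (2 * r) ≡ suc (suc m) * suc m + e * (2 * r + u)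
    lemma₂ = solve-∀

  -- `geometric e p = p + e * rest e p` equals p u for u = 1 + (e / p) `rest e p`, and each prime r
  -- of e divides u - 1. If r ≠ p, it divides e / p. If r = p is odd, it divides `rest e p` by
  -- `rest-mod`. If r = p = 2, the hypothesis 4 ∣ e leaves a factor 2 in e / p.
  p∣e⇒geometric≡p*u : ∀ {e p} → Prime p → p ∣ e → 4 ∣ e →
    ∃[ u ] (geometric e p ≡ p * u × (∀ {r} → Prime r → r ∣ e → r ∤ u))
  p∣e⇒geometric≡p*u {p = zero}  pp _ _ = contradiction pp ¬prime[0]
  p∣e⇒geometric≡p*u {e} {p@(suc p′)} pp (divides c e≡cp) 4∣e = 1 + c * rest e p , geometric≡ , r∤u
    where
    open ≡.≡-Reasoning
    geometric≡ : geometric e p ≡ p * (1 + c * rest e p)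
    geometric≡ = begin
      geometric e p              ≡⟨ geometric-rest e p ⟩
      p + e * rest e p           ≡⟨ cong (λ x → p + x * rest e p) e≡cp ⟩
      p + c * p * rest e p       ≡⟨ lemma p c (rest e p) ⟩
      p * (1 + c * rest e p)     ∎
      where
      lemma : ∀ p c r → p + c * p * r ≡ p * (1 + c * r)
      lemma = solve-∀

    p∣2*rest : p ∣ 2 * rest e p
    p∣2*rest with rest-mod e p′
    ... | w , eq = subst (p ∣_) (sym eq) (∣.∣m∣n⇒∣m+n (∣.m∣m*n p′) (∣.∣m⇒∣m*n w (divides c e≡cp)))

    p∣c*rest : p ∣ c * rest e p
    p∣c*rest with euclidsLemma 2 (rest e p) pp p∣2*rest
    ... | inj₂ p∣rest = ∣.∣n⇒∣m*n c p∣rest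
    ... | inj₁ p∣2 with prime∣prime prime[2] pp p∣2
    ...   | p≡2 = ∣.∣m⇒∣m*n (rest e p) (subst (_∣ c) (sym p≡2)
                    (∣.*-cancelʳ-∣ 2 (subst (4 ∣_) (trans e≡cp (cong (c *_) p≡2)) 4∣e)))

    r∣c*rest : ∀ {r} → Prime r → r ∣ e → r ∣ c * rest e p
    r∣c*rest pr r∣e with euclidsLemma c p pr (subst (_ ∣_) e≡cp r∣e)
    ... | inj₁ r∣c = ∣.∣m⇒∣m*n (rest e p) r∣c
    ... | inj₂ r∣p = subst (_∣ c * rest e p) (sym (prime∣prime pp pr r∣p)) p∣c*rest

    r∤u : ∀ {r} → Prime r → r ∣ e → r ∤ 1 + c * rest e p
    r∤u {r} pr r∣e r∣u = ¬prime[1] (subst Prime (∣.∣1⇒≡1 r∣1) pr)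
      where
      r∣1 : r ∣ 1
      r∣1 = ∣.∣m+n∣m⇒∣n (subst (r ∣_) (ℕ.+-comm 1 (c * rest e p)) r∣u) (r∣c*rest pr r∣e)

  -- Induction on t. For a prime p ∣ t, the congruence of `geometric e m` and m modulo p gives m =
  -- m′ p, and `geometric e m` is p times `geometric e m′` times a number prime to e. So a factor p
  -- can be removed from t and m at once.
  ∣geometric⇒∣ : ∀ {e t} → 4 ∣ e → 0 < t → (∀ {r} → Prime r → r ∣ t → r ∣ e) →
    ∀ {m} → t ∣ geometric e m → t ∣ m
  ∣geometric⇒∣ {e} 4∣e = go _ (ℕ.<-wellFounded _)
    where
    go : ∀ t → Acc _<_ t → 0 < t → (∀ {r} → Prime r → r ∣ t → r ∣ e) → ∀ {m} → t ∣ geometric e m → t ∣ m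
    go t (acc rec) 0<t r∣t⇒r∣e {m} t∣G with t ℕ.≟ 1
    ... | yes refl = ∣.1∣ m
    ... | no t≢1 with prime-divisor t t≢1
    ... | p , pp , p∣t@(divides t′ refl) = result p∣m
      where
      p∣e = r∣t⇒r∣e pp p∣t

      p∣m : p ∣ m
      p∣m = ∣.∣m+n∣m⇒∣n {m = e * rest e m}
        (subst (p ∣_) (trans (geometric-rest e m) (ℕ.+-comm m _)) (∣.∣-trans p∣t t∣G))
        (∣.∣m⇒∣m*n (rest e m) p∣e)

      instance
        _ = prime⇒nonZero pp

      0<t′ : 0 < t′
      0<t′ = ℕ.n≢0⇒n>0 λ { refl → ℕ.<-irrefl refl 0<t }

      t′<t : t′ < t
      t′<t = ℕ.m<m*n t′ p {{ℕ.>-nonZero 0<t′}} (prime⇒2≤ pp)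
        where
        prime⇒2≤ : ∀ {p} → Prime p → 2 ≤ p
        prime⇒2≤ {zero}        pp = contradiction pp ¬prime[0]
        prime⇒2≤ {suc zero}    pp = contradiction pp ¬prime[1]
        prime⇒2≤ {suc (suc _)} pp = s≤s (s≤s z≤n)

      result : p ∣ m → t ∣ m
      -- The case of one prime is applied to Q^m′ in place of Q, where Q^m′ - 1 is
      -- `e * geometric e m′`.
      result (divides m′ refl) with p∣e⇒geometric≡p*u pp (∣.∣m⇒∣m*n (geometric e m′) p∣e) (∣.∣m⇒∣m*n (geometric e m′) 4∣e)
      ... | u , eq , r∤u = ∣.*-monoˡ-∣ p (go t′ (rec t′<t) 0<t′ r∣t′⇒r∣e {m′} t′∣G′)
        where
        r∣t′⇒r∣e : ∀ {r} → Prime r → r ∣ t′ → r ∣ e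
        r∣t′⇒r∣e pr r∣t′ = r∣t⇒r∣e pr (∣.∣m⇒∣m*n p r∣t′)

        G≡ : geometric e (m′ * p) ≡ u * geometric e m′ * p
        G≡ = trans (geometric-* e m′ p) (trans (cong (geometric e m′ *_) eq) (lemma (geometric e m′) p u))
          where
          lemma : ∀ g p u → g * (p * u) ≡ u * g * p
          lemma = solve-∀

        t′∣G′ : t′ ∣ geometric e m′
        t′∣G′ = Coprime.coprime-divisor
          (primes⇒coprime λ pr r∣t′ → r∤u pr (∣.∣m⇒∣m*n (geometric e m′) (r∣t′⇒r∣e pr r∣t′)))
          (∣.*-cancelʳ-∣ p (subst (t ∣_) G≡ t∣G))

  -- Powers of q modulo q - 1 and modulo 4

  -- For Q = d + 1, Q^(k + 2) + 1 = Q² (Q^k + 1) - (Q² - 1). Division by Q + 1 takes the quotient 1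
  -- + d b to Q² (1 + d b) - d = 1 + d (Q + Q² b), which is the witness. To avoid the subtraction,
  -- Q² - 1 = d (d + 2) is added to both sides.
  odd-power+1 : ∀ d k → ∃[ b ] (suc d ^ suc (k * 2) + 1 ≡ (suc d + 1) * (1 + d * b))
  odd-power+1 d zero    = 0 , lemma d
    where
    lemma : ∀ d → suc d * 1 + 1 ≡ (suc d + 1) * (1 + d * 0)
    lemma = solve-∀
  odd-power+1 d (suc k) with odd-power+1 d k
  ... | b , eq = suc d + suc d * suc d * b , ℕ.+-cancelʳ-≡ (d * (d + 2)) _ _ (begin
      suc d * (suc d * x) + 1 + d * (d + 2)                                  ≡⟨ lemma₁ d x ⟩
      suc d * suc d * (x + 1)                                                ≡⟨ cong (suc d * suc d *_) eq ⟩
      suc d * suc d * ((suc d + 1) * (1 + d * b))                            ≡⟨ lemma₂ d b ⟩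
      (suc d + 1) * (1 + d * (suc d + suc d * suc d * b)) + d * (d + 2)      ∎)
    where
    open ≡.≡-Reasoning
    x = suc d ^ suc (k * 2)
    lemma₁ : ∀ d x → suc d * (suc d * x) + 1 + d * (d + 2) ≡ suc d * suc d * (x + 1)
    lemma₁ = solve-∀
    lemma₂ : ∀ d b → suc d * suc d * ((suc d + 1) * (1 + d * b)) ≡
                     (suc d + 1) * (1 + d * (suc d + suc d * suc d * b)) + d * (d + 2)
    lemma₂ = solve-∀

  %4≡3⇒ : ∀ {q} → q % 4 ≡ 3 → ∃[ s ] (q ≡ 3 + s * 4)
  %4≡3⇒ {q} eq = q ℕ./ 4 , trans (ℕ.m≡m%n+[m/n]*n q 4) (cong (_+ q ℕ./ 4 * 4) eq)

  ^-even : ∀ s k → ∃[ j ] ((3 + s * 4) ^ (k * 2) ≡ 1 + j * 4)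
  ^-even s zero    = 0 , refl
  ^-even s (suc k) with ^-even s k
  ... | j , eq = (2 + s * 6 + s * s * 4) + j * (3 + s * 4) * (3 + s * 4) , trans (cong (λ x → (3 + s * 4) * ((3 + s * 4) * x)) eq) (lemma s j)
    where
    lemma : ∀ s j → (3 + s * 4) * ((3 + s * 4) * (1 + j * 4)) ≡ 1 + ((2 + s * 6 + s * s * 4) + j * (3 + s * 4) * (3 + s * 4)) * 4
    lemma = solve-∀

  ^-odd : ∀ s k → ∃[ j ] ((3 + s * 4) ^ suc (k * 2) ≡ 3 + j * 4)
  ^-odd s k with ^-even s k
  ... | j , eq = s + (3 + s * 4) * j , trans (cong ((3 + s * 4) *_) eq) (lemma s j)
    where
    lemma : ∀ s j → (3 + s * 4) * (1 + j * 4) ≡ 3 + (s + (3 + s * 4) * j) * 4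
    lemma = solve-∀

  -- Binomial coefficients and the coefficients of Dickson polynomials

  nC0≡1 : ∀ n → n C 0 ≡ 1
  nC0≡1 n = trans (C.nCk≡nC[n∸k] {0} {n} z≤n) (C.nCn≡1 n)

  -- Makes the division in `dicksonCoeff` exact, and provides the factor p in `prime∣binomial`.
  absorption : ∀ n k → suc k * (suc n C suc k) ≡ suc n * (n C k)
  absorption n       zero    = trans (ℕ.+-identityʳ (suc n C 1)) (trans (C.nC1≡n (suc n))
    (sym (trans (cong (suc n *_) (nC0≡1 n)) (ℕ.*-identityʳ (suc n)))))
  absorption zero    (suc k) = trans (cong (suc (suc k) *_) (C.k>n⇒nCk≡0 {1} {suc (suc k)} (s≤s (s≤s z≤n))))
    (trans (ℕ.*-zeroʳ (suc (suc k))) (sym (trans (ℕ.+-identityʳ (0 C suc k)) (C.k>n⇒nCk≡0 {0} {suc k} (s≤s z≤n)))))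
  absorption (suc n) (suc k) = begin
    suc (suc k) * (suc (suc n) C suc (suc k))             ≡⟨ cong (suc (suc k) *_) (C.nCk+nC[k+1]≡[n+1]C[k+1] (suc n) (suc k)) ⟨
    suc (suc k) * (c + c′)                                ≡⟨ lemma₁ (suc k) c c′ ⟩
    c + (suc k * c + suc (suc k) * c′)                    ≡⟨ cong (c +_) (cong₂ _+_ (absorption n k) (absorption n (suc k))) ⟩
    c + (suc n * (n C k) + suc n * (n C suc k))           ≡⟨ cong (c +_) (ℕ.*-distribˡ-+ (suc n) (n C k) (n C suc k)) ⟨
    c + suc n * (n C k + n C suc k)                       ≡⟨ cong (λ x → c + suc n * x) (C.nCk+nC[k+1]≡[n+1]C[k+1] n k) ⟩
    suc (suc n) * (suc n C suc k)                         ∎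
    where
    open ≡.≡-Reasoning
    c = suc n C suc k
    c′ = suc n C suc (suc k)
    lemma₁ : ∀ k c d → suc k * (c + d) ≡ c + (k * c + suc k * d)
    lemma₁ = solve-∀

  -- p divides k · binom(p, k) = p · binom(p - 1, k - 1), but not k.
  prime∣binomial : ∀ {p k} → Prime p → 0 < k → k < p → p ∣ p C k
  prime∣binomial {suc n} {suc k} pp _ k<p with euclidsLemma (suc k) (suc n C suc k) pp
    (subst (suc n ∣_) (sym (absorption n k)) (∣.m∣m*n (n C k)))
  ... | inj₁ p∣k = contradiction (∣.∣⇒≤ p∣k) (ℕ.<⇒≱ k<p)
  ... | inj₂ p∣C = p∣C

  -- The coefficients of the Dickson polynomials as given by
  -- D₀ = 2, D₁ = x, Dₙ₊₂ = x Dₙ₊₁ - a Dₙ.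
  coefficient : ℕ → ℕ → ℕ
  coefficient zero          zero    = 2
  coefficient zero          (suc i) = 0
  coefficient (suc zero)    zero    = 1
  coefficient (suc zero)    (suc i) = 0
  coefficient (suc (suc n)) zero    = 1
  coefficient (suc (suc n)) (suc i) = coefficient (suc n) (suc i) + coefficient n i

  coefficient-zero : ∀ n → coefficient (suc n) 0 ≡ 1
  coefficient-zero zero    = refl
  coefficient-zero (suc n) = refl

  coefficient-vanishes : ∀ n i → n < 2 * i → coefficient n i ≡ 0
  coefficient-vanishes zero          (suc i) _ = refl
  coefficient-vanishes (suc zero)    (suc i) _ = refl
  coefficient-vanishes (suc (suc n)) (suc i) n<2i = cong₂ _+_
    (coefficient-vanishes (suc n) (suc i) (ℕ.<-trans (ℕ.n<1+n _) n<2i))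
    (coefficient-vanishes n i (ℕ.+-cancelˡ-< 2 n (2 * i) (subst (2 + n <_) (ℕ.*-suc 2 i) n<2i)))

  -- As n = (n - i) + i, the number n / (n - i) · binom(n - i, i) splits as binom(n - i, i) +
  -- binom(n - i - 1, i - 1), and in this form the recurrence is Pascal's rule in each summand. The
  -- index is `suc i`, and `suc k` is its difference from n.
  coefficient-binomial : ∀ i k → coefficient (suc i + suc k) (suc i) ≡ (suc k C suc i) + (k C i)
  coefficient-binomial zero    zero    = refl
  coefficient-binomial (suc i) zero    = begin
    coefficient (suc i + 1) (suc (suc i)) + coefficient (i + 1) (suc i)
      ≡⟨ cong₂ _+_ (coefficient-vanishes (suc i + 1) (suc (suc i)) (bound (suc i)))
                   (coefficient-vanishes (i + 1) (suc i) (bound i)) ⟩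
    0
      ≡⟨ cong₂ _+_ (C.k>n⇒nCk≡0 {1} {suc (suc i)} (s≤s (s≤s z≤n))) (C.k>n⇒nCk≡0 {0} {suc i} (s≤s z≤n)) ⟨
    (1 C suc (suc i)) + (0 C suc i)  ∎
    where
    open ≡.≡-Reasoning
    bound : ∀ i → i + 1 < 2 * suc i
    bound i = subst (i + 1 <_) (sym (lemma i)) (ℕ.m≤n⇒m≤o+n i ℕ.≤-refl)
      where
      lemma : ∀ i → 2 * suc i ≡ i + suc (i + 1)
      lemma = solve-∀
  coefficient-binomial i       (suc k) = begin
    coefficient (suc (i + suc (suc k))) (suc i)
      ≡⟨ cong (λ n → coefficient (suc n) (suc i)) (ℕ.+-suc i (suc k)) ⟩
    coefficient (suc i + suc k) (suc i) + coefficient (i + suc k) i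
      ≡⟨ cong₂ _+_ (coefficient-binomial i k) (previous i) ⟩
    ((suc k C suc i) + (k C i)) + x i
      ≡⟨ pascal i ⟩
    (suc (suc k) C suc i) + (suc k C i)  ∎
    where
    open ≡.≡-Reasoning
    -- The recurrence leads to the index `i`, which may be 0, where the closed form has no second
    -- summand; `x` covers both cases.
    x : ℕ → ℕ
    x zero    = 1
    x (suc i) = (suc k C suc i) + (k C i)
    previous : ∀ i → coefficient (i + suc k) i ≡ x i
    previous zero    = coefficient-zero k
    previous (suc i) = coefficient-binomial i k
    pascal : ∀ i → ((suc k C suc i) + (k C i)) + x i ≡ (suc (suc k) C suc i) + (suc k C i)
    pascal zero    = begin
      (suc k C 1) + (k C 0) + 1          ≡⟨ cong₂ (λ u v → (suc k C 1) + u + v) (nC0≡1 k) (sym (nC0≡1 (suc k))) ⟩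
      (suc k C 1) + 1 + (suc k C 0)      ≡⟨ cong (_+ (suc k C 0)) (trans (ℕ.+-comm (suc k C 1) 1) (cong (_+ (suc k C 1)) (sym (nC0≡1 (suc k))))) ⟩
      (suc k C 0) + (suc k C 1) + (suc k C 0)  ≡⟨ cong (_+ (suc k C 0)) (C.nCk+nC[k+1]≡[n+1]C[k+1] (suc k) 0) ⟩
      (suc (suc k) C 1) + (suc k C 0)    ∎
    pascal (suc i) = begin
      ((suc k C suc (suc i)) + (k C suc i)) + ((suc k C suc i) + (k C i))
        ≡⟨ lemma (suc k C suc (suc i)) (k C suc i) (suc k C suc i) (k C i) ⟩
      ((suc k C suc i) + (suc k C suc (suc i))) + ((k C i) + (k C suc i))
        ≡⟨ cong₂ _+_ (C.nCk+nC[k+1]≡[n+1]C[k+1] (suc k) (suc i)) (C.nCk+nC[k+1]≡[n+1]C[k+1] k i) ⟩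
      (suc (suc k) C suc (suc i)) + (suc k C suc i)  ∎
      where
      lemma : ∀ a b c d → a + b + (c + d) ≡ c + a + (d + b)
      lemma = solve-∀

  -- By `absorption` the dividend is n - i times an integer, so the truncating `÷` loses nothing.
  dicksonCoeff≡coefficient : ∀ n i → 0 < n → 2 * i ≤ n → dicksonCoeff n i ≡ coefficient n i
  dicksonCoeff≡coefficient (suc n) zero    _ _ = begin
    (suc n * (suc n C 0)) ÷ suc n  ≡⟨ cong (_÷ suc n) (ℕ.*-comm (suc n) (suc n C 0)) ⟩
    ((suc n C 0) * suc n) ÷ suc n  ≡⟨ ÷-* (suc n C 0) {suc n} (s≤s z≤n) ⟩
    suc n C 0                      ≡⟨ nC0≡1 (suc n) ⟩
    1                              ≡⟨ coefficient-zero n ⟨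
    coefficient (suc n) 0          ∎
    where open ≡.≡-Reasoning
  dicksonCoeff≡coefficient n (suc i) _ 2i≤n with ℕ.m≤n⇒∃[o]m+o≡n 2i≤n
  ... | o , refl = subst (λ n → dicksonCoeff n (suc i) ≡ coefficient n (suc i)) (lemma i o) (begin
    ((suc i + suc k) * (m C suc i)) ÷ m                        ≡⟨ cong (_÷ m) exact ⟩
    (((suc k C suc i) + (k C i)) * suc k) ÷ m                  ≡⟨ cong ((((suc k C suc i) + (k C i)) * suc k) ÷_) m≡ ⟩
    (((suc k C suc i) + (k C i)) * suc k) ÷ suc k              ≡⟨ ÷-* ((suc k C suc i) + (k C i)) {suc k} (s≤s z≤n) ⟩
    (suc k C suc i) + (k C i)                                  ≡⟨ coefficient-binomial i k ⟨
    coefficient (suc i + suc k) (suc i)                        ∎)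
    where
    lemma : ∀ i o → suc i + suc (i + o) ≡ 2 * suc i + o
    lemma = solve-∀
    open ≡.≡-Reasoning
    k = i + o
    m = i + suc k ∸ i
    m≡ : m ≡ suc k
    m≡ = ℕ.m+n∸m≡n i (suc k)
    exact : (suc i + suc k) * (m C suc i) ≡ ((suc k C suc i) + (k C i)) * suc k
    exact = begin
      (suc i + suc k) * (m C suc i)                          ≡⟨ cong (λ m → (suc i + suc k) * (m C suc i)) m≡ ⟩
      (suc i + suc k) * (suc k C suc i)                      ≡⟨ ℕ.*-distribʳ-+ (suc k C suc i) (suc i) (suc k) ⟩
      suc i * (suc k C suc i) + suc k * (suc k C suc i)      ≡⟨ cong (_+ suc k * (suc k C suc i)) (absorption k i) ⟩
      suc k * (k C i) + suc k * (suc k C suc i)              ≡⟨ lemma′ (suc k) (k C i) (suc k C suc i) ⟩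
      ((suc k C suc i) + (k C i)) * suc k                    ∎
      where
      lemma′ : ∀ k c d → k * c + k * d ≡ (d + c) * k
      lemma′ = solve-∀

-- The ring of polynomials

module PolynomialRing {c ℓ} (R : CommutativeRing c ℓ) where
  private module R where
    open CommutativeRing R public
    open Algebra.Properties.Ring ring public
    open Algebra.Properties.CommutativeSemigroup +-commutativeSemigroup public using (interchange)
  open R using (0#; 1#)
  module P = Polynomial R.rawRing
  open P using (Poly; coeff; const; X; _+_; _*_; -_) public

  infix 4 _≋_
  -- A record, so that the polynomials can be inferred from an equality.
  record _≋_ (p q : Poly) : Set ℓ where
    constructor coeffs
    field coeff-≈ : ∀ k → coeff p k R.≈ coeff q k
  open _≋_ public

  scale : R.Carrier → Poly → Poly
  scale x = map (x R.*_)

  coeff-+ : ∀ p q k → coeff (p + q) k R.≈ coeff p k R.+ coeff q k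
  coeff-+ []      q       k       = R.sym (R.+-identityˡ _)
  coeff-+ (x ∷ p) []      k       = R.sym (R.+-identityʳ _)
  coeff-+ (x ∷ p) (y ∷ q) zero    = R.refl
  coeff-+ (x ∷ p) (y ∷ q) (suc k) = coeff-+ p q k

  coeff-scale : ∀ x p k → coeff (scale x p) k R.≈ x R.* coeff p k
  coeff-scale x []      k       = R.sym (R.zeroʳ x)
  coeff-scale x (y ∷ p) zero    = R.refl
  coeff-scale x (y ∷ p) (suc k) = coeff-scale x p k

  coeff-neg : ∀ p k → coeff (- p) k R.≈ R.- coeff p k
  coeff-neg []      k       = R.sym R.-0#≈0#
  coeff-neg (y ∷ p) zero    = R.refl
  coeff-neg (y ∷ p) (suc k) = coeff-neg p k

  ≋-refl : ∀ {p} → p ≋ p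
  ≋-refl = coeffs λ k → R.refl

  ≋-sym : ∀ {p q} → p ≋ q → q ≋ p
  ≋-sym (coeffs eq) = coeffs λ k → R.sym (eq k)

  ≋-trans : ∀ {p q r} → p ≋ q → q ≋ r → p ≋ r
  ≋-trans (coeffs eq) (coeffs eq′) = coeffs λ k → R.trans (eq k) (eq′ k)

  +-cong : ∀ {p p′ q q′} → p ≋ p′ → q ≋ q′ → p + q ≋ p′ + q′
  +-cong {p} {p′} {q} {q′} (coeffs eq) (coeffs eq′) = coeffs λ k →
    R.trans (coeff-+ p q k) (R.trans (R.+-cong (eq k) (eq′ k)) (R.sym (coeff-+ p′ q′ k)))

  neg-cong : ∀ {p q} → p ≋ q → - p ≋ - q
  neg-cong {p} {q} (coeffs eq) = coeffs λ k →
    R.trans (coeff-neg p k) (R.trans (R.-‿cong (eq k)) (R.sym (coeff-neg q k)))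

  scale-cong : ∀ {x y p q} → x R.≈ y → p ≋ q → scale x p ≋ scale y q
  scale-cong {x} {y} {p} {q} x≈y (coeffs eq) = coeffs λ k →
    R.trans (coeff-scale x p k) (R.trans (R.*-cong x≈y (eq k)) (R.sym (coeff-scale y q k)))

  ∷-cong : ∀ {x y p q} → x R.≈ y → p ≋ q → (x ∷ p) ≋ (y ∷ q)
  ∷-cong x≈y (coeffs eq) = coeffs λ { zero → x≈y ; (suc k) → eq k }

  ∷-injectiveˡ : ∀ {x y p q} → (x ∷ p) ≋ (y ∷ q) → x R.≈ y
  ∷-injectiveˡ (coeffs eq) = eq 0

  ∷-injectiveʳ : ∀ {x y p q} → (x ∷ p) ≋ (y ∷ q) → p ≋ q
  ∷-injectiveʳ (coeffs eq) = coeffs λ k → eq (suc k)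

  ∷≋[]⇒head : ∀ {x p} → (x ∷ p) ≋ [] → x R.≈ 0#
  ∷≋[]⇒head (coeffs eq) = eq 0

  ∷≋[]⇒tail : ∀ {x p} → (x ∷ p) ≋ [] → p ≋ []
  ∷≋[]⇒tail (coeffs eq) = coeffs λ k → eq (suc k)

  ∷≋[] : ∀ {x p} → x R.≈ 0# → p ≋ [] → (x ∷ p) ≋ []
  ∷≋[] x≈0 (coeffs eq) = coeffs λ { zero → x≈0 ; (suc k) → eq k }

  +-abelianGroup : AbelianGroup c ℓ
  +-abelianGroup = record
    { Carrier = Poly ; _≈_ = _≋_ ; _∙_ = _+_ ; ε = [] ; _⁻¹ = -_
    ; isAbelianGroup = record
      { isGroup = record
        { isMonoid = record
          { isSemigroup = record
            { isMagma = record
              { isEquivalence = record { refl = ≋-refl ; sym = ≋-sym ; trans = ≋-trans }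
              ; ∙-cong = +-cong }
            ; assoc = λ p q r → coeffs λ k → begin
                coeff (p + q + r) k                          ≈⟨ coeff-+ (p + q) r k ⟩
                coeff (p + q) k R.+ coeff r k                ≈⟨ R.+-congʳ (coeff-+ p q k) ⟩
                coeff p k R.+ coeff q k R.+ coeff r k        ≈⟨ R.+-assoc _ _ _ ⟩
                coeff p k R.+ (coeff q k R.+ coeff r k)      ≈⟨ R.+-congˡ (coeff-+ q r k) ⟨
                coeff p k R.+ coeff (q + r) k                ≈⟨ coeff-+ p (q + r) k ⟨
                coeff (p + (q + r)) k                        ∎ }
          ; identity = (λ p → ≋-refl) , (λ p → coeffs λ k → R.trans (coeff-+ p [] k) (R.+-identityʳ _)) }
        ; inverse = (λ p → coeffs λ k → R.trans (coeff-+ (- p) p k) (R.trans (R.+-congʳ (coeff-neg p k)) (R.-‿inverseˡ _)))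
                  , (λ p → coeffs λ k → R.trans (coeff-+ p (- p) k) (R.trans (R.+-congˡ (coeff-neg p k)) (R.-‿inverseʳ _)))
        ; ⁻¹-cong = neg-cong }
      ; comm = λ p q → coeffs λ k → R.trans (coeff-+ p q k) (R.trans (R.+-comm _ _) (R.sym (coeff-+ q p k))) } }
    where open Relation.Binary.Reasoning.Setoid R.setoid

  private module + where
    open AbelianGroup +-abelianGroup public
    open Algebra.Properties.CommutativeSemigroup commutativeSemigroup public using (interchange)
  open Relation.Binary.Reasoning.Setoid +.setoid

  scale-+ : ∀ x p q → scale x (p + q) ≋ scale x p + scale x q
  scale-+ x p q = coeffs λ k → R.trans (coeff-scale x (p + q) k) (R.trans (R.*-congˡ (coeff-+ p q k))
    (R.trans (R.distribˡ x _ _) (R.sym (R.trans (coeff-+ (scale x p) (scale x q) k)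
      (R.+-cong (coeff-scale x p k) (coeff-scale x q k))))))

  scale-+ˡ : ∀ x y p → scale (x R.+ y) p ≋ scale x p + scale y p
  scale-+ˡ x y p = coeffs λ k → R.trans (coeff-scale (x R.+ y) p k) (R.trans (R.distribʳ _ x y)
    (R.sym (R.trans (coeff-+ (scale x p) (scale y p) k) (R.+-cong (coeff-scale x p k) (coeff-scale y p k)))))

  scale-scale : ∀ x y p → scale x (scale y p) ≋ scale (x R.* y) p
  scale-scale x y p = coeffs λ k → R.trans (coeff-scale x (scale y p) k) (R.trans (R.*-congˡ (coeff-scale y p k))
    (R.trans (R.sym (R.*-assoc x y _)) (R.sym (coeff-scale (x R.* y) p k))))

  scale-1 : ∀ p → scale 1# p ≋ p
  scale-1 p = coeffs λ k → R.trans (coeff-scale 1# p k) (R.*-identityˡ _)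

  scale-0 : ∀ p → scale 0# p ≋ []
  scale-0 p = coeffs λ k → R.trans (coeff-scale 0# p k) (R.zeroˡ _)

  shift-+ : ∀ p q → (0# ∷ (p + q)) ≋ (0# ∷ p) + (0# ∷ q)
  shift-+ p q = ∷-cong (R.sym (R.+-identityˡ 0#)) ≋-refl

  scale-shift : ∀ x p → scale x (0# ∷ p) ≋ (0# ∷ scale x p)
  scale-shift x p = ∷-cong (R.zeroʳ x) ≋-refl

  []≋0∷ : ∀ {p} → p ≋ [] → (0# ∷ p) ≋ []
  []≋0∷ = ∷≋[] R.refl

  *-zeroˡ : ∀ {p} q → p ≋ [] → p * q ≋ []
  *-zeroˡ {[]}    q p≋[] = ≋-refl
  *-zeroˡ {x ∷ p} q p≋[] = begin
    scale x q + (0# ∷ p * q)  ≈⟨ +.∙-cong (≋-trans (scale-cong (∷≋[]⇒head p≋[]) ≋-refl) (scale-0 q))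
                                          ([]≋0∷ (*-zeroˡ q (∷≋[]⇒tail p≋[]))) ⟩
    []                        ∎

  *-zeroʳ : ∀ p → p * [] ≋ []
  *-zeroʳ []      = ≋-refl
  *-zeroʳ (x ∷ p) = []≋0∷ (*-zeroʳ p)

  *-congˡ : ∀ p {q q′} → q ≋ q′ → p * q ≋ p * q′
  *-congˡ []      eq = ≋-refl
  *-congˡ (x ∷ p) eq = +-cong (scale-cong R.refl eq) (∷-cong R.refl (*-congˡ p eq))

  *-congʳ : ∀ {p p′} q → p ≋ p′ → p * q ≋ p′ * q
  *-congʳ {[]}    {p′}     q eq = ≋-sym (*-zeroˡ q (≋-sym eq))
  *-congʳ {x ∷ p} {[]}     q eq = *-zeroˡ q eq
  *-congʳ {x ∷ p} {y ∷ p′} q eq =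
    +-cong (scale-cong (∷-injectiveˡ eq) ≋-refl) (∷-cong R.refl (*-congʳ q (∷-injectiveʳ eq)))

  distribʳ : ∀ r p q → (p + q) * r ≋ p * r + q * r
  distribʳ r []      q       = ≋-refl
  distribʳ r (x ∷ p) []      = +.sym (+.identityʳ _)
  distribʳ r (x ∷ p) (y ∷ q) = begin
    scale (x R.+ y) r + (0# ∷ (p + q) * r)
      ≈⟨ +-cong (scale-+ˡ x y r) (≋-trans (∷-cong R.refl (distribʳ r p q)) (shift-+ (p * r) (q * r))) ⟩
    (scale x r + scale y r) + ((0# ∷ p * r) + (0# ∷ q * r))
      ≈⟨ +.interchange (scale x r) (scale y r) (0# ∷ p * r) (0# ∷ q * r) ⟩
    (scale x r + (0# ∷ p * r)) + (scale y r + (0# ∷ q * r))  ∎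

  distribˡ : ∀ p q r → p * (q + r) ≋ p * q + p * r
  distribˡ []      q r = ≋-refl
  distribˡ (x ∷ p) q r = begin
    scale x (q + r) + (0# ∷ p * (q + r))
      ≈⟨ +-cong (scale-+ x q r) (≋-trans (∷-cong R.refl (distribˡ p q r)) (shift-+ (p * q) (p * r))) ⟩
    (scale x q + scale x r) + ((0# ∷ p * q) + (0# ∷ p * r))
      ≈⟨ +.interchange (scale x q) (scale x r) (0# ∷ p * q) (0# ∷ p * r) ⟩
    (scale x q + (0# ∷ p * q)) + (scale x r + (0# ∷ p * r))  ∎

  scale-* : ∀ x p q → scale x p * q ≋ scale x (p * q)
  scale-* x []      q = ≋-refl
  scale-* x (y ∷ p) q = begin
    scale (x R.* y) q + (0# ∷ scale x p * q)
      ≈⟨ +-cong (≋-sym (scale-scale x y q)) (≋-trans (∷-cong R.refl (scale-* x p q)) (≋-sym (scale-shift x (p * q)))) ⟩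
    scale x (scale y q) + scale x (0# ∷ p * q)
      ≈⟨ scale-+ x (scale y q) (0# ∷ p * q) ⟨
    scale x (scale y q + (0# ∷ p * q))  ∎

  shift-* : ∀ p q → (0# ∷ p) * q ≋ (0# ∷ p * q)
  shift-* p q = +-cong (scale-0 q) ≋-refl

  *-assoc : ∀ p q r → (p * q) * r ≋ p * (q * r)
  *-assoc []      q r = ≋-refl
  *-assoc (x ∷ p) q r = begin
    (scale x q + (0# ∷ p * q)) * r           ≈⟨ distribʳ r (scale x q) (0# ∷ p * q) ⟩
    scale x q * r + (0# ∷ p * q) * r         ≈⟨ +-cong (scale-* x q r) (shift-* (p * q) r) ⟩
    scale x (q * r) + (0# ∷ (p * q) * r)     ≈⟨ +-cong ≋-refl (∷-cong R.refl (*-assoc p q r)) ⟩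
    scale x (q * r) + (0# ∷ p * (q * r))     ∎

  *-∷ : ∀ p y q → p * (y ∷ q) ≋ scale y p + (0# ∷ p * q)
  *-∷ []      y q = ≋-sym ([]≋0∷ ≋-refl)
  *-∷ (x ∷ p) y q = ∷-cong (R.+-congʳ (R.*-comm x y)) (begin
    scale x q + p * (y ∷ q)                   ≈⟨ +-cong ≋-refl (*-∷ p y q) ⟩
    scale x q + (scale y p + (0# ∷ p * q))    ≈⟨ +.assoc (scale x q) (scale y p) _ ⟨
    scale x q + scale y p + (0# ∷ p * q)      ≈⟨ +-cong (+.comm (scale x q) (scale y p)) ≋-refl ⟩
    scale y p + scale x q + (0# ∷ p * q)      ≈⟨ +.assoc (scale y p) (scale x q) _ ⟩
    scale y p + (scale x q + (0# ∷ p * q))    ∎)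

  *-comm : ∀ p q → p * q ≋ q * p
  *-comm []      q = ≋-sym (*-zeroʳ q)
  *-comm (x ∷ p) q = begin
    scale x q + (0# ∷ p * q)  ≈⟨ +-cong ≋-refl (∷-cong R.refl (*-comm p q)) ⟩
    scale x q + (0# ∷ q * p)  ≈⟨ *-∷ q x p ⟨
    q * (x ∷ p)               ∎

  const-* : ∀ x p → const x * p ≋ scale x p
  const-* x p = ≋-trans (+-cong ≋-refl ([]≋0∷ ≋-refl)) (+.identityʳ (scale x p))

  X-* : ∀ p → X * p ≋ (0# ∷ p)
  X-* p = ≋-trans (shift-* (const 1#) p) (∷-cong R.refl (≋-trans (const-* 1# p) (scale-1 p)))

  *-identityˡ : ∀ p → const 1# * p ≋ p
  *-identityˡ p = ≋-trans (const-* 1# p) (scale-1 p)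

  commutativeRing : CommutativeRing c ℓ
  commutativeRing = record
    { Carrier = Poly ; _≈_ = _≋_ ; _+_ = _+_ ; _*_ = _*_ ; -_ = -_ ; 0# = [] ; 1# = const 1#
    ; isCommutativeRing = record
      { isRing = record
        { +-isAbelianGroup = +.isAbelianGroup
        ; *-cong = λ {p} {p′} {q} {q′} p≋p′ q≋q′ → ≋-trans (*-congʳ q p≋p′) (*-congˡ p′ q≋q′)
        ; *-assoc = *-assoc
        ; *-identity = *-identityˡ , λ p → ≋-trans (*-comm p (const 1#)) (*-identityˡ p)
        ; distrib = distribˡ , distribʳ }
      ; *-comm = *-comm } }

-- Degree and division with remainder

module Degree {c ℓ} (R : CommutativeRing c ℓ) where
  private module R = CommutativeRingTheory R
  open R using (0#; 1#)
  open PolynomialRing R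
  private module Poly = CommutativeRingTheory commutativeRing

  infix 4 _deg<_
  record _deg<_ (p : Poly) (m : ℕ) : Set ℓ where
    constructor bounded
    field coeff-≈0 : ∀ k → m ℕ.≤ k → coeff p k R.≈ 0#
  open _deg<_ public

  -- `x` is allowed to vanish. Hence top coefficients multiply in any commutative ring, and `x` is
  -- required to be nonzero only where a degree is read off.
  record Top (p : Poly) (m : ℕ) (x : R.Carrier) : Set ℓ where
    constructor top
    field
      coeff-top : coeff p m R.≈ x
      above     : p deg< suc m
  open Top public

  deg<-cong : ∀ {p q m} → p ≋ q → p deg< m → q deg< m
  deg<-cong p≋q (bounded d) = bounded λ k m≤k → R.trans (R.sym (coeff-≈ p≋q k)) (d k m≤k)

  deg<-mono : ∀ {p m n} → m ℕ.≤ n → p deg< m → p deg< n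
  deg<-mono m≤n (bounded d) = bounded λ k n≤k → d k (ℕ.≤-trans m≤n n≤k)

  deg<-+ : ∀ {p q m} → p deg< m → q deg< m → p + q deg< m
  deg<-+ {p} {q} (bounded d) (bounded d′) = bounded λ k m≤k → R.trans (coeff-+ p q k) (R.trans (R.+-cong (d k m≤k) (d′ k m≤k)) (R.+-identityˡ 0#))

  deg<-neg : ∀ {p m} → p deg< m → - p deg< m
  deg<-neg {p} (bounded d) = bounded λ k m≤k → R.trans (coeff-neg p k) (R.trans (R.-‿cong (d k m≤k)) R.-0#≈0#)

  deg<-scale : ∀ x {p m} → p deg< m → scale x p deg< m
  deg<-scale x {p} (bounded d) = bounded λ k m≤k → R.trans (coeff-scale x p k) (R.trans (R.*-congˡ (d k m≤k)) (R.zeroʳ x))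

  deg<0⇒≋[] : ∀ {p} → p deg< 0 → p ≋ []
  deg<0⇒≋[] (bounded d) = coeffs λ k → d k z≤n

  Top-cong : ∀ {p q m x y} → p ≋ q → x R.≈ y → Top p m x → Top q m y
  Top-cong {m = m} p≋q x≈y (top c d) = top (R.trans (R.sym (coeff-≈ p≋q m)) (R.trans c x≈y)) (deg<-cong p≋q d)

  Top-+ : ∀ {p q m x} → Top p m x → q deg< m → Top (p + q) m x
  Top-+ {p} {q} {m} (top c d) d′ = top
    (R.trans (coeff-+ p q m) (R.trans (R.+-cong c (coeff-≈0 d′ m ℕ.≤-refl)) (R.+-identityʳ _)))
    (deg<-+ d (deg<-mono (ℕ.n≤1+n m) d′))

  Top-scale : ∀ x {p m y} → Top p m y → Top (scale x p) m (x R.* y)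
  Top-scale x {p} {m} (top c d) = top (R.trans (coeff-scale x p m) (R.*-congˡ c)) (deg<-scale x d)

  Top-∷ : ∀ x {p m y} → Top p m y → Top (x ∷ p) (suc m) y
  Top-∷ x (top c (bounded d)) = top c (bounded λ { (suc k) (s≤s m<k) → d k m<k })

  Top-const : ∀ x → Top (const x) 0 x
  Top-const x = top R.refl (bounded λ { (suc k) _ → R.refl })

  Top-* : ∀ {p q m n x y} → Top p m x → Top q n y → Top (p * q) (m ℕ.+ n) (x R.* y)
  Top-* {[]} {x = x} {y} (top c d) (top c′ d′) =
    top (R.sym (R.trans (R.*-congʳ (R.sym c)) (R.zeroˡ y))) (bounded λ _ _ → R.refl)
  Top-* {u ∷ p} {q} {zero} {n} (top c (bounded d)) t =
    Top-cong (≋-sym (begin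
      scale u q + (0# ∷ p * q)  ≈⟨ +-cong ≋-refl ([]≋0∷ {p * q} (*-zeroˡ {p} q (coeffs λ k → d (suc k) (s≤s z≤n)))) ⟩
      scale u q + []            ≈⟨ Poly.+-identityʳ (scale u q) ⟩
      scale u q                 ∎)) (R.*-congʳ c) (Top-scale u t)
    where open Relation.Binary.Reasoning.Setoid Poly.setoid
  Top-* {u ∷ p} {q} {suc m} {n} {x} {y} (top c (bounded d)) t@(top _ d′) = Top-cong
    (Poly.+-comm (0# ∷ p * q) (scale u q)) R.refl
    (Top-+ (Top-∷ 0# (Top-* {p} {q} (top c (bounded λ k m<k → d (suc k) (s≤s m<k))) t))
      (deg<-scale u (deg<-mono (s≤s (ℕ.m≤n+m n m)) d′)))

  Top-X^ : ∀ n → Top (X Poly.^ n) n 1#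
  Top-X^ zero    = Top-const 1#
  Top-X^ (suc n) = Top-cong (≋-sym (X-* (X Poly.^ n))) R.refl (Top-∷ 0# (Top-X^ n))

  -- Recursion on the dividend: p = s g + r gives x ∷ p = (0 ∷ s) g + (x ∷ r). Subtracting `l` times
  -- the monic g, where `l` is the coefficient of x ∷ r in degree m, brings the remainder below
  -- degree m again.
  division : ∀ {g m} → Top g m 1# → ∀ p → ∃[ s ] ∃[ r ] (p ≋ s * g + r × r deg< m)
  division _ [] = [] , [] , ≋-refl , bounded λ _ _ → R.refl
  division {g} {m} t@(top c d) (x ∷ p) with division t p
  ... | s , r , p≋ , bounded r<m = l ∷ s , w + - scale l g , eq , bounded deg
    where
    w = x ∷ r
    l = coeff w m
    open Relation.Binary.Reasoning.Setoid Poly.setoid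
    open RingSolver commutativeRing
    eq : (x ∷ p) ≋ (l ∷ s) * g + (w + - scale l g)
    eq = begin
      x ∷ p                                             ≈⟨ ∷-cong (R.sym (R.+-identityˡ x)) p≋ ⟩
      (0# ∷ s * g) + w                                  ≈⟨ solve 3 (λ u v w → v :+ w := u :+ v :+ (w :- u)) ≋-refl (scale l g) (0# ∷ s * g) w ⟩
      scale l g + (0# ∷ s * g) + (w + - scale l g)      ∎
    deg : ∀ k → m ℕ.≤ k → coeff (w + - scale l g) k R.≈ 0#
    deg k m≤k with ℕ.m≤n⇒m<n∨m≡n m≤k
    ... | inj₂ ≡.refl = R.trans (coeff-+ w (- scale l g) m)
      (R.trans (R.+-congˡ (R.trans (coeff-neg (scale l g) m)
        (R.-‿cong (R.trans (coeff-scale l g m) (R.trans (R.*-congˡ c) (R.*-identityʳ l))))))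
      (R.-‿inverseʳ l))
    ... | inj₁ (s≤s m≤k′) = R.trans (coeff-+ w (- scale l g) k)
      (R.trans (R.+-cong (r<m _ m≤k′)
        (R.trans (coeff-neg (scale l g) k) (R.trans (R.-‿cong (coeff-≈0 (deg<-scale l {g} d) k (s≤s m≤k′))) R.-0#≈0#)))
      (R.+-identityˡ 0#))

  -- Applied to a difference of quotients this is the uniqueness of remainders. Above degree m the
  -- coefficients of (x ∷ s) g are those of s g shifted by one, so s vanishes by induction; then the
  -- coefficient in degree m is x.
  multiple-deg< : ∀ {g m} → Top g m 1# → ∀ s → s * g deg< m → s ≋ []
  multiple-deg< t [] _ = ≋-refl
  multiple-deg< {g} {m} t@(top c d) (x ∷ s) (bounded sg<m) = ∷≋[] x≈0 s≋[]
    where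
    open Relation.Binary.Reasoning.Setoid R.setoid
    s≋[] : s ≋ []
    s≋[] = multiple-deg< t s (bounded λ k m≤k → begin
      coeff (s * g) k                                   ≈⟨ R.+-identityˡ _ ⟨
      0# R.+ coeff (s * g) k                            ≈⟨ R.+-congʳ (coeff-≈0 (deg<-scale x {g} d) (suc k) (s≤s m≤k)) ⟨
      coeff (scale x g) (suc k) R.+ coeff (s * g) k     ≈⟨ coeff-+ (scale x g) (0# ∷ s * g) (suc k) ⟨
      coeff ((x ∷ s) * g) (suc k)                       ≈⟨ sg<m (suc k) (ℕ.m≤n⇒m≤1+n m≤k) ⟩
      0#                                                ∎)
    x≈0 : x R.≈ 0#
    x≈0 = begin
      x                                              ≈⟨ R.*-identityʳ x ⟨
      x R.* 1#                                       ≈⟨ R.*-congˡ c ⟨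
      x R.* coeff g m                                ≈⟨ coeff-scale x g m ⟨
      coeff (scale x g) m                            ≈⟨ R.+-identityʳ _ ⟨
      coeff (scale x g) m R.+ 0#                     ≈⟨ R.+-congˡ (coeff-≈ ([]≋0∷ (*-zeroˡ g s≋[])) m) ⟨
      coeff (scale x g) m R.+ coeff (0# ∷ s * g) m   ≈⟨ coeff-+ (scale x g) (0# ∷ s * g) m ⟨
      coeff ((x ∷ s) * g) m                          ≈⟨ sg<m m ℕ.≤-refl ⟩
      0#                                             ∎

  -- Lists may end in zeros; truncation turns a bound on the degree into one on the length, as the
  -- count of roots needs.
  take-≋ : ∀ {p m} → p deg< m → take m p ≋ p
  take-≋ {p}     {zero}  d = ≋-sym (deg<0⇒≋[] d)
  take-≋ {[]}    {suc m} d = ≋-refl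
  take-≋ {x ∷ p} {suc m} (bounded d) = ∷-cong R.refl (take-≋ (bounded λ k m≤k → d (suc k) (s≤s m≤k)))

-- Ring homomorphisms and evaluation of polynomials

module RingHomomorphism {a ℓ₁ b ℓ₂} (A : CommutativeRing a ℓ₁) (B : CommutativeRing b ℓ₂) where
  private
    module A = CommutativeRingTheory A
    module B = CommutativeRingTheory B
  open RingMorphisms A.rawRing B.rawRing public using (IsRingHomomorphism)

  -- Preservation of zero and of negatives follows from additivity, by cancellation in the additive
  -- group of `B`.
  ringHomomorphism : (φ : A.Carrier → B.Carrier) →
    (∀ {x y} → x A.≈ y → φ x B.≈ φ y) →
    (∀ x y → φ (x A.+ y) B.≈ φ x B.+ φ y) →
    (∀ x y → φ (x A.* y) B.≈ φ x B.* φ y) →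
    φ A.1# B.≈ B.1# → IsRingHomomorphism φ
  ringHomomorphism φ cong +-homo *-homo 1-homo = record
    { isSemiringHomomorphism = record
      { isNearSemiringHomomorphism = record
        { +-isMonoidHomomorphism = record
          { isMagmaHomomorphism = record { isRelHomomorphism = record { cong = cong } ; homo = +-homo }
          ; ε-homo = 0-homo }
        ; *-homo = *-homo }
      ; 1#-homo = 1-homo }
    ; -‿homo = λ x → B.+-inverseʳ-unique (φ x) (φ (A.- x))
        (B.trans (B.sym (+-homo x (A.- x))) (B.trans (cong (A.-‿inverseʳ x)) 0-homo)) }
    where
    0-homo : φ A.0# B.≈ B.0#
    0-homo = B.x+x≈x⇒x≈0 _ (B.trans (B.sym (+-homo A.0# A.0#)) (cong (A.+-identityˡ A.0#)))

  module Properties {φ : A.Carrier → B.Carrier} (hom : IsRingHomomorphism φ) where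
    open RingMorphisms.IsRingHomomorphism hom public
      using (+-homo; *-homo; 0#-homo; 1#-homo; -‿homo; ⟦⟧-cong)

    ^-homo : ∀ x n → φ (x A.^ n) B.≈ φ x B.^ n
    ^-homo x zero    = 1#-homo
    ^-homo x (suc n) = B.trans (*-homo x (x A.^ n)) (B.*-congˡ (^-homo x n))

    ×-homo : ∀ n x → φ (n A.· x) B.≈ n B.· φ x
    ×-homo zero    x = 0#-homo
    ×-homo (suc n) x = B.trans (+-homo x (n A.· x)) (B.+-congˡ (×-homo n x))

module Evaluation {a ℓ₁ b ℓ₂} (A : CommutativeRing a ℓ₁) (B : CommutativeRing b ℓ₂)
  {φ : CommutativeRing.Carrier A → CommutativeRing.Carrier B}
  (hom : RingHomomorphism.IsRingHomomorphism A B φ) where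
  private
    module A = CommutativeRing A
    module B = CommutativeRing B
    module φ = RingHomomorphism.Properties A B hom
  open PolynomialRing A
  open RingSolver B
  open Relation.Binary.Reasoning.Setoid B.setoid

  eval : B.Carrier → Poly → B.Carrier
  eval s []      = B.0#
  eval s (x ∷ p) = φ x B.+ s B.* eval s p

  eval-[] : ∀ s {p} → p ≋ [] → eval s p B.≈ B.0#
  eval-[] s {[]}    eq = B.refl
  eval-[] s {x ∷ p} eq = B.trans
    (B.+-cong (B.trans (φ.⟦⟧-cong (∷≋[]⇒head eq)) φ.0#-homo) (B.trans (B.*-congˡ (eval-[] s (∷≋[]⇒tail eq))) (B.zeroʳ s)))
    (B.+-identityˡ B.0#)

  eval-cong : ∀ {s s′ p q} → s B.≈ s′ → p ≋ q → eval s p B.≈ eval s′ q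
  eval-cong {p = []}    {q}     s≈ eq = B.sym (eval-[] _ (≋-sym eq))
  eval-cong {p = x ∷ p} {[]}    s≈ eq = eval-[] _ eq
  eval-cong {p = x ∷ p} {y ∷ q} s≈ eq =
    B.+-cong (φ.⟦⟧-cong (∷-injectiveˡ eq)) (B.*-cong s≈ (eval-cong s≈ (∷-injectiveʳ eq)))

  eval-+ : ∀ s p q → eval s (p + q) B.≈ eval s p B.+ eval s q
  eval-+ s []      q       = B.sym (B.+-identityˡ _)
  eval-+ s (x ∷ p) []      = B.sym (B.+-identityʳ _)
  eval-+ s (x ∷ p) (y ∷ q) = B.trans (B.+-cong (φ.+-homo x y) (B.*-congˡ (eval-+ s p q)))
    (solve 5 (λ s x y p q → (x :+ y) :+ s :* (p :+ q) := (x :+ s :* p) :+ (y :+ s :* q)) B.refl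
      s (φ x) (φ y) (eval s p) (eval s q))

  eval-scale : ∀ s x p → eval s (scale x p) B.≈ φ x B.* eval s p
  eval-scale s x []      = B.sym (B.zeroʳ _)
  eval-scale s x (y ∷ p) = B.trans (B.+-cong (φ.*-homo x y) (B.*-congˡ (eval-scale s x p)))
    (solve 4 (λ s x y p → x :* y :+ s :* (x :* p) := x :* (y :+ s :* p)) B.refl s (φ x) (φ y) (eval s p))

  eval-* : ∀ s p q → eval s (p * q) B.≈ eval s p B.* eval s q
  eval-* s []      q = B.sym (B.zeroˡ _)
  eval-* s (x ∷ p) q = begin
    eval s (scale x q + (A.0# ∷ p * q))
      ≈⟨ eval-+ s (scale x q) (A.0# ∷ p * q) ⟩
    eval s (scale x q) B.+ (φ A.0# B.+ s B.* eval s (p * q))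
      ≈⟨ B.+-cong (eval-scale s x q) (B.+-cong φ.0#-homo (B.*-congˡ (eval-* s p q))) ⟩
    φ x B.* eval s q B.+ (B.0# B.+ s B.* (eval s p B.* eval s q))
      ≈⟨ B.+-congˡ (B.+-identityˡ _) ⟩
    φ x B.* eval s q B.+ s B.* (eval s p B.* eval s q)
      ≈⟨ solve 4 (λ x s p q → x :* q :+ s :* (p :* q) := (x :+ s :* p) :* q) B.refl (φ x) s (eval s p) (eval s q) ⟩
    (φ x B.+ s B.* eval s p) B.* eval s q  ∎

  eval-const : ∀ s x → eval s (const x) B.≈ φ x
  eval-const s x = B.trans (B.+-congˡ (B.zeroʳ s)) (B.+-identityʳ _)

  eval-X : ∀ s → eval s X B.≈ s
  eval-X s = begin
    φ A.0# B.+ s B.* eval s (const A.1#)  ≈⟨ B.+-cong φ.0#-homo (B.*-congˡ (B.trans (eval-const s A.1#) φ.1#-homo)) ⟩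
    B.0# B.+ s B.* B.1#                   ≈⟨ B.trans (B.+-identityˡ _) (B.*-identityʳ s) ⟩
    s                                     ∎

  eval-homomorphism : ∀ s → RingHomomorphism.IsRingHomomorphism commutativeRing B (eval s)
  eval-homomorphism s = RingHomomorphism.ringHomomorphism commutativeRing B (eval s)
    (eval-cong B.refl) (eval-+ s) (eval-* s) (B.trans (eval-const s A.1#) φ.1#-homo)

module ChangeOfCoefficients {a ℓ₁ b ℓ₂} (A : CommutativeRing a ℓ₁) (B : CommutativeRing b ℓ₂)
  {φ : CommutativeRing.Carrier A → CommutativeRing.Carrier B}
  (hom : RingHomomorphism.IsRingHomomorphism A B φ) where
  private
    module A = CommutativeRing A
    module B = CommutativeRing B
    module φ = RingHomomorphism.Properties A B hom
    module A[X] = PolynomialRing A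
    module B[X] = PolynomialRing B
    module const = RingHomomorphism A B[X].commutativeRing
  open B[X] using (_≋_; const; X; ≋-sym; ≋-trans; ≋-refl)

  coeff-map : ∀ p k → B[X].coeff (map φ p) k B.≈ φ (A[X].coeff p k)
  coeff-map []      k       = B.sym φ.0#-homo
  coeff-map (x ∷ p) zero    = B.refl
  coeff-map (x ∷ p) (suc k) = coeff-map p k

  private
    const-homomorphism : const.IsRingHomomorphism (λ x → const (φ x))
    const-homomorphism = const.ringHomomorphism _
      (λ x≈y → B[X].∷-cong (φ.⟦⟧-cong x≈y) ≋-refl)
      (λ x y → B[X].∷-cong (φ.+-homo x y) ≋-refl)
      (λ x y → B[X].∷-cong (B.trans (φ.*-homo x y) (B.sym (B.+-identityʳ _))) ≋-refl)
      (B[X].∷-cong φ.1#-homo ≋-refl)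

    module E = Evaluation A B[X].commutativeRing const-homomorphism

    map≋eval : ∀ p → map φ p ≋ E.eval X p
    map≋eval []      = ≋-refl
    map≋eval (x ∷ p) = B[X].coeffs λ k → B.sym (B.trans
      (B[X].coeff-≈ (B[X].+-cong {p = const (φ x)} ≋-refl (≋-trans (B[X].X-* (E.eval X p)) (B[X].∷-cong B.refl (≋-sym (map≋eval p))))) k)
      (lemma k))
      where
      lemma : ∀ k → B[X].coeff (const (φ x) B[X].+ (B.0# ∷ map φ p)) k B.≈ B[X].coeff (φ x ∷ map φ p) k
      lemma zero    = B.+-identityʳ _
      lemma (suc k) = B.refl

  -- `map φ` agrees with evaluation at X along x ↦ const (φ x), and evaluation is already known to
  -- respect the operations.
  map-homomorphism : RingHomomorphism.IsRingHomomorphism A[X].commutativeRing B[X].commutativeRing (map φ)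
  map-homomorphism = RingHomomorphism.ringHomomorphism A[X].commutativeRing B[X].commutativeRing (map φ)
    (λ {p} {q} p≋q → via p q (E.eval-cong ≋-refl p≋q))
    (λ p q → ≋-trans (map≋eval (p A[X].+ q)) (≋-trans (E.eval-+ X p q) (≋-sym (B[X].+-cong (map≋eval p) (map≋eval q)))))
    (λ p q → ≋-trans (map≋eval (p A[X].* q)) (≋-trans (E.eval-* X p q)
      (≋-sym (≋-trans (B[X].*-congʳ (map φ q) (map≋eval p)) (B[X].*-congˡ (E.eval X p) (map≋eval q))))))
    (B[X].∷-cong φ.1#-homo ≋-refl)
    where
    via : ∀ p q → E.eval X p ≋ E.eval X q → map φ p ≋ map φ q
    via p q eq = ≋-trans (map≋eval p) (≋-trans eq (≋-sym (map≋eval q)))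

-- Domains and the number of roots

IsDomain : ∀ {c ℓ} → CommutativeRing c ℓ → Set (c ⊔ ℓ)
IsDomain D = ∀ x y → x * y ≈ 0# → x ≈ 0# ⊎ y ≈ 0#
  where open CommutativeRing D

module Domain {c ℓ} (D : CommutativeRing c ℓ) (isDomain : IsDomain D) where
  open CommutativeRingTheory D
  open RingSolver D

  ^-≈0 : ∀ n {x} → x ^ suc n ≈ 0# → x ≈ 0#
  ^-≈0 zero    {x} eq = trans (sym (*-identityʳ x)) eq
  ^-≈0 (suc n) {x} eq = [ id , ^-≈0 n ]′ (isDomain x (x ^ suc n) eq)

  *-cancelˡ : ∀ {x y z} → ¬ (x ≈ 0#) → x * y ≈ x * z → y ≈ z
  *-cancelˡ {x} {y} {z} x≉0 eq = x∙y⁻¹≈ε⇒x≈y y z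
    ([ (λ x≈0 → contradiction x≈0 x≉0) , id ]′ (isDomain x (y - z)
      (trans (solve 3 (λ x y z → x :* (y :- z) := x :* y :- x :* z) refl x y z) (x≈y⇒x∙y⁻¹≈ε eq))))

module Roots {c ℓ} (D : CommutativeRing c ℓ) (isDomain : IsDomain D) where
  open CommutativeRingTheory D
  open PolynomialRing D using (Poly; _≋_; ∷≋[]; ∷≋[]⇒head; ∷≋[]⇒tail; ≋-refl; ≋-sym; ≋-trans)
  open Degree D
  open RingSolver D
  open Evaluation D D (Identity.isRingHomomorphism rawRing refl) public
  open Relation.Binary.Reasoning.Setoid setoid

  -- Horner's scheme: horner r p lists the values at r of the tails of p, and
  -- horner r p is the quotient of x ∷ p by X - r.
  private
    horner : Carrier → Poly → Poly
    horner r []      = []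
    horner r (x ∷ p) = eval r (x ∷ p) ∷ horner r p

    length-horner : ∀ r p → length (horner r p) ≡ length p
    length-horner r []      = ≡.refl
    length-horner r (x ∷ p) = ≡.cong suc (length-horner r p)

    horner-quotient : ∀ r s x p → eval s (x ∷ p) - eval r (x ∷ p) ≈ (s - r) * eval s (horner r p)
    horner-quotient r s x []      =
      solve 3 (λ x s r → (x :+ s :* con (ℤ.+ 0)) :- (x :+ r :* con (ℤ.+ 0)) := (s :- r) :* con (ℤ.+ 0)) refl x s r
    horner-quotient r s x (y ∷ p) = begin
      (x + s * ps) - (x + r * pr)
        ≈⟨ solve 5 (λ x s r ps pr → (x :+ s :* ps) :- (x :+ r :* pr) := (s :- r) :* pr :+ s :* (ps :- pr)) refl x s r ps pr ⟩
      (s - r) * pr + s * (ps - pr)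
        ≈⟨ +-congˡ (*-congˡ (horner-quotient r s y p)) ⟩
      (s - r) * pr + s * ((s - r) * h)
        ≈⟨ solve 4 (λ s r pr h → (s :- r) :* pr :+ s :* ((s :- r) :* h) := (s :- r) :* (pr :+ s :* h)) refl s r pr h ⟩
      (s - r) * (pr + s * h)  ∎
      where
      ps = eval s (y ∷ p)
      pr = eval r (y ∷ p)
      h  = eval s (horner r p)

    horner≋[]⇒≋[] : ∀ r p → horner r p ≋ [] → p ≋ []
    horner≋[]⇒≋[] r []      _  = ≋-refl
    horner≋[]⇒≋[] r (x ∷ p) eq = ∷≋[] x≈0 p≋[]
      where
      p≋[] : p ≋ []
      p≋[] = horner≋[]⇒≋[] r p (∷≋[]⇒tail eq)
      x≈0 : x ≈ 0#
      x≈0 = begin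
        x                 ≈⟨ +-identityʳ x ⟨
        x + 0#            ≈⟨ +-congˡ (zeroʳ r) ⟨
        x + r * 0#        ≈⟨ +-congˡ (*-congˡ (eval-[] r p≋[])) ⟨
        eval r (x ∷ p)    ≈⟨ ∷≋[]⇒head eq ⟩
        0#                ∎

  -- Induction on m: the quotient by X - ρ 0 has the remaining ρ i as roots, since ρ i - ρ 0 is
  -- nonzero and the ring is a domain. Length replaces degree, as the quotient `horner r p` is one
  -- entry shorter than `x ∷ p`.
  length≤roots⇒≋[] : ∀ m p → length p ℕ.≤ m → (ρ : Fin m → Carrier) →
    (∀ {i j} → ρ i ≈ ρ j → i ≡ j) → (∀ i → eval (ρ i) p ≈ 0#) → p ≋ []
  length≤roots⇒≋[] m       []      _         ρ inj root = ≋-refl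
  length≤roots⇒≋[] (suc m) (x ∷ p) (s≤s len) ρ inj root =
    -- `horner r (x ∷ p)` has the value at r as head and the quotient by X - r as tail; both vanish.
    horner≋[]⇒≋[] r (x ∷ p) (∷≋[] (root zero) horner≋[])
    where
    r = ρ zero
    horner≋[] : horner r p ≋ []
    horner≋[] = length≤roots⇒≋[] m (horner r p) (≡.subst (ℕ._≤ m) (≡.sym (length-horner r p)) len)
      (λ i → ρ (suc i)) (λ eq → Fin.suc-injective (inj eq)) λ i →
      [ (λ eq → contradiction (inj {suc i} {zero} (x∙y⁻¹≈ε⇒x≈y _ _ eq)) λ ()) , id ]′
        (isDomain (ρ (suc i) - r) _ (trans (sym (horner-quotient r (ρ (suc i)) x p)) (x≈y⇒x∙y⁻¹≈ε
          (trans (root (suc i)) (sym (root zero))))))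

  deg<roots⇒≋[] : ∀ {m p} → p deg< m → (ρ : Fin m → Carrier) →
    (∀ {i j} → ρ i ≈ ρ j → i ≡ j) → (∀ i → eval (ρ i) p ≈ 0#) → p ≋ []
  deg<roots⇒≋[] {m} {p} d ρ inj root = ≋-trans (≋-sym (take-≋ d))
    (length≤roots⇒≋[] m (take m p) (≡.subst (ℕ._≤ m) (≡.sym (List.length-take m p)) (ℕ.m⊓n≤m m (length p)))
      ρ inj λ i → trans (eval-cong refl (take-≋ d)) (root i))

-- Residue fields of polynomial rings

module Quotient {c ℓ} (A : CommutativeRing c ℓ) (g : CommutativeRing.Carrier A) where
  private module A = CommutativeRingTheory A
  open A using (Carrier; _+_; _*_; _-_; -_; 0#; 1#)
  open RingSolver A

  infix 4 _≈_
  -- The carrier stays that of `A` and only the equality changes, so every element is its own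
  -- representative and no canonical remainder has to be chosen.
  record _≈_ (x y : Carrier) : Set (c ⊔ ℓ) where
    constructor congruent
    field
      quotient : Carrier
      multiple : quotient * g A.≈ x - y

  ≈⇒≈ : ∀ {x y} → x A.≈ y → x ≈ y
  ≈⇒≈ x≈y = congruent 0# (A.trans (A.zeroˡ g) (A.sym (A.x≈y⇒x∙y⁻¹≈ε x≈y)))

  ≈-sym : ∀ {x y} → x ≈ y → y ≈ x
  ≈-sym {x} {y} (congruent s eq) = congruent (- s) (A.trans
    (solve 2 (λ s g → :- s :* g := :- (s :* g)) A.refl s g)
    (A.trans (A.-‿cong eq) (solve 2 (λ x y → :- (x :- y) := y :- x) A.refl x y)))

  ≈-trans : ∀ {x y z} → x ≈ y → y ≈ z → x ≈ z
  ≈-trans {x} {y} {z} (congruent s eq) (congruent s′ eq′) = congruent (s + s′) (A.trans (A.distribʳ g s s′)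
    (A.trans (A.+-cong eq eq′) (solve 3 (λ x y z → (x :- y) :+ (y :- z) := x :- z) A.refl x y z)))

  commutativeRing : CommutativeRing c (c ⊔ ℓ)
  commutativeRing = record
    { Carrier = Carrier ; _≈_ = _≈_ ; _+_ = _+_ ; _*_ = _*_ ; -_ = -_ ; 0# = 0# ; 1# = 1#
    ; isCommutativeRing = record
      { isRing = record
        { +-isAbelianGroup = record
          { isGroup = record
            { isMonoid = record
              { isSemigroup = record
                { isMagma = record
                  { isEquivalence = record { refl = ≈⇒≈ A.refl ; sym = ≈-sym ; trans = ≈-trans }
                  ; ∙-cong = λ {x} {y} {u} {v} (congruent s eq) (congruent s′ eq′) → congruent (s + s′)
                      (A.trans (A.distribʳ g s s′) (A.trans (A.+-cong eq eq′)
                        (solve 4 (λ x y u v → (x :- y) :+ (u :- v) := (x :+ u) :- (y :+ v)) A.refl x y u v))) }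
                ; assoc = λ x y z → ≈⇒≈ (A.+-assoc x y z) }
              ; identity = (λ x → ≈⇒≈ (A.+-identityˡ x)) , (λ x → ≈⇒≈ (A.+-identityʳ x)) }
            ; inverse = (λ x → ≈⇒≈ (A.-‿inverseˡ x)) , (λ x → ≈⇒≈ (A.-‿inverseʳ x))
            ; ⁻¹-cong = λ {x} {y} (congruent s eq) → congruent (- s) (A.trans
                (solve 2 (λ s g → :- s :* g := :- (s :* g)) A.refl s g)
                (A.trans (A.-‿cong eq) (solve 2 (λ x y → :- (x :- y) := :- x :- :- y) A.refl x y))) }
          ; comm = λ x y → ≈⇒≈ (A.+-comm x y) }
        ; *-cong = λ {x} {y} {u} {v} (congruent s eq) (congruent s′ eq′) → congruent (s * u + y * s′) (A.trans
            (solve 5 (λ s u y t g → (s :* u :+ y :* t) :* g := (s :* g) :* u :+ y :* (t :* g)) A.refl s u y s′ g)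
            (A.trans (A.+-cong (A.*-congʳ eq) (A.*-congˡ eq′))
              (solve 4 (λ x y u v → (x :- y) :* u :+ y :* (u :- v) := x :* u :- y :* v) A.refl x y u v)))
        ; *-assoc = λ x y z → ≈⇒≈ (A.*-assoc x y z)
        ; *-identity = (λ x → ≈⇒≈ (A.*-identityˡ x)) , (λ x → ≈⇒≈ (A.*-identityʳ x))
        ; distrib = (λ x y z → ≈⇒≈ (A.distribˡ x y z)) , (λ x y z → ≈⇒≈ (A.distribʳ x y z)) }
      ; *-comm = λ x y → ≈⇒≈ (A.*-comm x y) } }

-- The alternative makes equality with 0 decidable.
IsField : ∀ {c ℓ} → CommutativeRing c ℓ → Set (c ⊔ ℓ)
IsField K = ∀ x → x ≈ 0# ⊎ ∃[ y ] (x * y ≈ 1#)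
  where open CommutativeRing K

module Field {c ℓ} (K : CommutativeRing c ℓ) (isField : IsField K)
  (1≉0 : ¬ (CommutativeRing._≈_ K (CommutativeRing.1# K) (CommutativeRing.0# K))) where
  open CommutativeRingTheory K

  unit≉0 : ∀ {x y} → x * y ≈ 1# → ¬ (x ≈ 0#)
  unit≉0 {x} {y} xy≈1 x≈0 = 1≉0 (trans (sym xy≈1) (trans (*-congʳ x≈0) (zeroˡ y)))

  ≈0? : ∀ x → Dec (x ≈ 0#)
  ≈0? x with isField x
  ... | inj₁ x≈0       = yes x≈0
  ... | inj₂ (y , xy≈1) = no (unit≉0 xy≈1)

  infix 4 _≈?_
  _≈?_ : ∀ x y → Dec (x ≈ y)
  x ≈? y = map′ (x∙y⁻¹≈ε⇒x≈y x y) x≈y⇒x∙y⁻¹≈ε (≈0? (x - y))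

  isDomain : IsDomain K
  isDomain x y xy≈0 with isField x
  ... | inj₁ x≈0        = inj₁ x≈0
  ... | inj₂ (x′ , xx′≈1) = inj₂ (begin
    y             ≈⟨ *-identityˡ y ⟨
    1# * y        ≈⟨ *-congʳ (trans (sym xx′≈1) (*-comm x x′)) ⟩
    x′ * x * y    ≈⟨ *-assoc x′ x y ⟩
    x′ * (x * y)  ≈⟨ *-congˡ xy≈0 ⟩
    x′ * 0#       ≈⟨ zeroʳ x′ ⟩
    0#            ∎)
    where open Relation.Binary.Reasoning.Setoid setoid

module FieldExtension {c ℓ} (K : CommutativeRing c ℓ) (isField : IsField K)
  (1≉0 : ¬ (CommutativeRing._≈_ K (CommutativeRing.1# K) (CommutativeRing.0# K))) where
  private
    module K where
      open CommutativeRingTheory K public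
      open Field K isField 1≉0 public
  open PolynomialRing K
  open Degree K
  private module Poly = CommutativeRingTheory commutativeRing
  open RingSolver commutativeRing

  infix 4 _∥_
  _∥_ : Poly → Poly → Set (c ⊔ ℓ)
  p ∥ q = ∃[ s ] (s * p ≋ q)

  ∥-trans : ∀ {p q r} → p ∥ q → q ∥ r → p ∥ r
  ∥-trans {p} (s , sp≋q) (s′ , s′q≋r) =
    s′ * s , ≋-trans (*-assoc s′ s p) (≋-trans (*-congˡ s′ sp≋q) s′q≋r)

  ≋[]? : ∀ p → Dec (p ≋ [])
  ≋[]? []      = yes ≋-refl
  ≋[]? (x ∷ p) with K.≈0? x | ≋[]? p
  ... | yes x≈0 | yes p≋[] = yes (∷≋[] x≈0 p≋[])
  ... | no x≉0  | _        = no λ eq → x≉0 (∷≋[]⇒head eq)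
  ... | _       | no p≉[]  = no λ eq → p≉[] (∷≋[]⇒tail eq)

  -- Remainders by a monic polynomial are unique by `multiple-deg<`, so g divides h only if the
  -- remainder found by `division` vanishes.
  ∥? : ∀ {g m} → Top g m K.1# → ∀ h → Dec (g ∥ h)
  ∥? {g} {m} t h with division t h
  ... | s , r , h≋ , r<m with ≋[]? r
  ... | yes r≋[] = yes (s , ≋-sym (≋-trans h≋ (≋-trans (+-cong ≋-refl r≋[]) (Poly.+-identityʳ (s * g)))))
  ... | no r≉[]  = no λ (s′ , s′g≋h) → r≉[] (begin
      r                    ≈⟨ remainder s′ s′g≋h ⟨
      (s′ + - s) * g       ≈⟨ *-zeroˡ g (multiple-deg< t (s′ + - s) (deg<-cong (≋-sym (remainder s′ s′g≋h)) r<m)) ⟩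
      []                   ∎)
      where
      open Relation.Binary.Reasoning.Setoid Poly.setoid
      remainder : ∀ s′ → s′ * g ≋ h → (s′ + - s) * g ≋ r
      remainder s′ s′g≋h = begin
        (s′ + - s) * g             ≈⟨ solve 3 (λ a b g → (a :- b) :* g := a :* g :- b :* g) ≋-refl s′ s g ⟩
        s′ * g + - (s * g)         ≈⟨ +-cong (≋-trans s′g≋h h≋) ≋-refl ⟩
        s * g + r + - (s * g)      ≈⟨ solve 2 (λ u r → u :+ r :- u := r) ≋-refl (s * g) r ⟩
        r                          ∎

  degree : ∀ k {p} → p deg< k → p ≋ [] ⊎ ∃[ d ] ∃[ x ] ∃[ y ] (d ℕ.< k × Top p d x × x K.* y K.≈ K.1#)
  degree zero    p<0 = inj₁ (deg<0⇒≋[] p<0)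
  degree (suc k) {p} p<1+k with isField (coeff p k)
  ... | inj₂ (y , xy≈1) = inj₂ (k , coeff p k , y , ℕ.≤-refl , top K.refl p<1+k , xy≈1)
  ... | inj₁ x≈0 with degree k (bounded below)
    where
    below : ∀ j → k ℕ.≤ j → coeff p j K.≈ K.0#
    below j k≤j with ℕ.m≤n⇒m<n∨m≡n k≤j
    ... | inj₁ k<j    = coeff-≈0 p<1+k j k<j
    ... | inj₂ ≡.refl = x≈0
  ... | inj₁ p≋[] = inj₁ p≋[]
  ... | inj₂ (d , x , y , d<k , t , xy≈1) = inj₂ (d , x , y , ℕ.m≤n⇒m≤1+n d<k , t , xy≈1)

  IsMonicFactor : Poly → ℕ → Poly → Set (c ⊔ ℓ)
  IsMonicFactor h m g = Top g m K.1# × g ∥ h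

  module _ {h g m} (0<m : 0 ℕ.< m) (factor : IsMonicFactor h m g)
    (minimal : ∀ {g′ m′} → 0 ℕ.< m′ → IsMonicFactor h m′ g′ → m ℕ.≤ m′) where
    private
      t = proj₁ factor
      module L = Quotient commutativeRing g
      open L using (congruent)

    residueField : CommutativeRing c (c ⊔ ℓ)
    residueField = L.commutativeRing

    private
      -- Euclid's algorithm with g as dividend: g = s p̂ + r for the monic p̂ = y p, where r has
      -- smaller degree than p. An inverse u of r gives the inverse - u s y of p, since r ≡ - s y p
      -- modulo g. If r = 0, then p̂ is a monic factor of h of degree less than m, so by minimality
      -- p is constant.
      invert : ∀ k → Acc ℕ._<_ k → k ℕ.≤ m → ∀ {p} → p deg< k → p ≋ [] ⊎ ∃[ u ] (p * u L.≈ const K.1#)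
      invert k (acc rec) k≤m {p} p<k with degree k p<k
      ... | inj₁ p≋[] = inj₁ p≋[]
      ... | inj₂ (d , x , y , d<k , tp , xy≈1) with division t̂ g
        where
        t̂ : Top (scale y p) d K.1#
        t̂ = Top-cong ≋-refl (K.trans (K.*-comm y x) xy≈1) (Top-scale y tp)
      ... | s , r , g≋ , r<d with invert d (rec d<k) (ℕ.≤-trans (ℕ.<⇒≤ d<k) k≤m) r<d
      ... | inj₂ (u , ru≈1) = inj₂ (- (u * s * const y) , L.≈-trans (congruent (- u) (begin
          - u * g
            ≈⟨ *-congˡ (- u) g≋ ⟩
          - u * (s * scale y p + r)
            ≈⟨ *-congˡ (- u) (+-cong (*-congˡ s (≋-sym (const-* y p))) ≋-refl) ⟩
          - u * (s * (const y * p) + r)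
            ≈⟨ solve 5 (λ u s y p r → :- u :* (s :* (y :* p) :+ r) := p :* :- (u :* s :* y) :- r :* u) ≋-refl u s (const y) p r ⟩
          p * - (u * s * const y) + - (r * u)  ∎)) ru≈1)
        where open Relation.Binary.Reasoning.Setoid Poly.setoid
      ... | inj₁ r≋[] with d
      ...   | zero  = inj₂ (const y , L.≈⇒≈ (≋-trans (*-comm p (const y)) (≋-trans (const-* y p)
                (coeffs λ { zero → K.trans (K.trans (coeff-scale y p 0) (K.*-congˡ (coeff-top tp))) (K.trans (K.*-comm y x) xy≈1)
                          ; (suc j) → K.trans (coeff-scale y p (suc j)) (K.trans (K.*-congˡ (coeff-≈0 (above tp) (suc j) (s≤s z≤n))) (K.zeroʳ y)) }))))
      ...   | suc d′ = contradiction (minimal (s≤s z≤n) (t̂ , ∥-trans p̂∥g (proj₂ factor))) (ℕ.<⇒≱ (ℕ.<-≤-trans d<k k≤m))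
        where
        t̂ : Top (scale y p) (suc d′) K.1#
        t̂ = Top-cong ≋-refl (K.trans (K.*-comm y x) xy≈1) (Top-scale y tp)
        p̂∥g : scale y p ∥ g
        p̂∥g = s , ≋-sym (≋-trans g≋ (≋-trans (+-cong ≋-refl r≋[]) (Poly.+-identityʳ (s * scale y p))))

    residueField-isField : IsField residueField
    residueField-isField p with division t p
    ... | s , r , p≋ , r<m with invert m (ℕ.<-wellFounded m) ℕ.≤-refl r<m
    ... | inj₁ r≋[] = inj₁ (congruent s (≋-sym (begin
        p + []            ≈⟨ Poly.+-identityʳ p ⟩
        p                 ≈⟨ p≋ ⟩
        s * g + r         ≈⟨ +-cong ≋-refl r≋[] ⟩
        s * g + []        ≈⟨ Poly.+-identityʳ _ ⟩
        s * g             ∎)))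
      where open Relation.Binary.Reasoning.Setoid Poly.setoid
    ... | inj₂ (u , ru≈1) = inj₂ (u , L.≈-trans (congruent (s * u) (begin
        s * u * g                      ≈⟨ solve 4 (λ s u g r → s :* u :* g := (s :* g :+ r) :* u :- r :* u) ≋-refl s u g r ⟩
        (s * g + r) * u + - (r * u)    ≈⟨ +-cong (*-congʳ u (≋-sym p≋)) ≋-refl ⟩
        p * u + - (r * u)              ∎)) ru≈1)
      where open Relation.Binary.Reasoning.Setoid Poly.setoid

    residueField-1≉0 : ¬ (const K.1# L.≈ [])
    residueField-1≉0 (congruent s eq) = 1≉0 (∷≋[]⇒head (begin
        const K.1#  ≈⟨ sg≋1 ⟨
        s * g       ≈⟨ *-zeroˡ g (multiple-deg< t s (deg<-cong (≋-sym sg≋1) (deg<-mono 0<m (above (Top-const K.1#))))) ⟩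
        []          ∎))
      where
      open Relation.Binary.Reasoning.Setoid Poly.setoid
      sg≋1 : s * g ≋ const K.1#
      sg≋1 = ≋-trans eq (Poly.+-identityʳ (const K.1#))

  module _ (search : ∀ {p} {P : K.Carrier → Set p} → (∀ {x y} → x K.≈ y → P x → P y) → (∀ x → Dec (P x)) → Dec (∃ P)) where

    -- The search runs through the coefficients one by one. It meets each monic polynomial only up
    -- to trailing zeros, which is why P must respect `_≋_`.
    searchMonic : ∀ {p} {P : Poly → Set p} m → (∀ {g g′} → g ≋ g′ → P g → P g′) →
      (∀ {g} → Top g m K.1# → Dec (P g)) → Dec (∃[ g ] (Top g m K.1# × P g))
    searchMonic {P = P} zero resp P? = map′ (λ P1 → const K.1# , Top-const K.1# , P1)
      (λ (g , t , Pg) → resp (coeffs λ { zero → coeff-top t ; (suc k) → coeff-≈0 (above t) (suc k) (s≤s z≤n) }) Pg)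
      (P? (Top-const K.1#))
    searchMonic {P = P} (suc m) resp P? = map′ (λ (x , g , t , Pg) → x ∷ g , Top-∷ x t , Pg) back
      (search (λ x≈y (g , t , Pg) → g , t , resp (∷-cong x≈y ≋-refl) Pg)
        λ x → searchMonic m (λ g≋g′ → resp (∷-cong K.refl g≋g′)) (λ t → P? (Top-∷ x t)))
      where
      back : ∃[ g ] (Top g (suc m) K.1# × P g) → ∃[ x ] ∃[ g ] (Top g m K.1# × P (x ∷ g))
      back ([]    , t , Pg) = contradiction (K.sym (coeff-top t)) 1≉0
      back (x ∷ g , t , Pg) = x , g , top (coeff-top t) (bounded λ k m<k → coeff-≈0 (above t) (suc k) (s≤s m<k)) , Pg

    -- `scale y h` is itself a monic factor of h, of degree N, so a least positive degree exists.
    minimalMonicFactor : ∀ {h N x y} → 0 ℕ.< N → Top h N x → x K.* y K.≈ K.1# →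
      ∃[ m ] ∃[ g ] (0 ℕ.< m × IsMonicFactor h m g × (∀ {g′ m′} → 0 ℕ.< m′ → IsMonicFactor h m′ g′ → m ℕ.≤ m′))
    minimalMonicFactor {h} {N} {x} {y} 0<N t xy≈1
      with Arithmetic.least-positive {P = λ m → ∃ (IsMonicFactor h m)}
        (λ m → searchMonic m (λ g≋g′ (s , sg≋h) → s , ≋-trans (*-congˡ s (≋-sym g≋g′)) sg≋h) (λ t → ∥? t h))
        0<N (scale y h , Top-cong ≋-refl (K.trans (K.*-comm y x) xy≈1) (Top-scale y t)
            , const x , ≋-trans (const-* x (scale y h)) (≋-trans (scale-scale x y h) (≋-trans (scale-cong xy≈1 ≋-refl) (scale-1 h))))
    ... | m , 0<m , (g , factor) , least = m , g , 0<m , factor , λ 0<m′ factor′ → least _ 0<m′ (_ , factor′)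

-- Sums and products over a finite field

module SingleSum {c ℓ} (M : CommutativeMonoid c ℓ) where
  open CommutativeMonoid M
  open Algebra.Properties.CommutativeMonoid.Sum M
  open Relation.Binary.Reasoning.Setoid setoid

  sum-ε : ∀ {n} (f : Fin n → Carrier) → (∀ i → f i ≈ ε) → sum f ≈ ε
  sum-ε {n} f f≈ε = trans (sum-cong-≋ f≈ε) (sum-replicate-zero n)

  sum-single : ∀ {n} (f : Fin n → Carrier) i → (∀ j → j ≢ i → f j ≈ ε) → sum f ≈ f i
  sum-single {suc n} f i f≈ε = begin
    sum f                        ≈⟨ sum-remove f ⟩
    f i ∙ sum (f ∘ punchIn i)    ≈⟨ ∙-congˡ (sum-ε (f ∘ punchIn i) λ j → f≈ε (punchIn i j) (Fin.punchInᵢ≢i i j)) ⟩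
    f i ∙ ε                      ≈⟨ identityʳ (f i) ⟩
    f i                          ∎

module Enumerated {c ℓ q} (𝔽 : FiniteField c ℓ q) where
  open FiniteField 𝔽 using (commutativeRing; enumeration; _⁻¹; *-inverseʳ; 1≉0)
  open CommutativeRingTheory commutativeRing
  open Inverse enumeration using (to; from; to-cong; strictlyInverseˡ; strictlyInverseʳ)
  open RingSolver commutativeRing
  open Relation.Binary.Reasoning.Setoid setoid

  to-injective : ∀ {x y} → to x ≡ to y → x ≈ y
  to-injective {x} {y} eq = trans (sym (strictlyInverseʳ x)) (trans (reflexive (≡.cong from eq)) (strictlyInverseʳ y))

  from-injective : ∀ {i j} → from i ≈ from j → i ≡ j
  from-injective {i} {j} eq = ≡.trans (≡.sym (strictlyInverseˡ i)) (≡.trans (to-cong eq) (strictlyInverseˡ j))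

  infix 4 _≈?_
  _≈?_ : ∀ x y → Dec (x ≈ y)
  x ≈? y = map′ to-injective to-cong (to x Fin.≟ to y)

  isField : IsField commutativeRing
  isField x with x ≈? 0#
  ... | yes x≈0 = inj₁ x≈0
  ... | no x≉0  = inj₂ (x ⁻¹ , *-inverseʳ x≉0)

  search : ∀ {p} {P : Carrier → Set p} → (∀ {x y} → x ≈ y → P x → P y) → (∀ x → Dec (P x)) → Dec (∃ P)
  search resp P? = map′ (λ (i , Pi) → from i , Pi) (λ (x , Px) → to x , resp (sym (strictlyInverseʳ x)) Px)
    (Fin.any? λ i → P? (from i))

  permutation : (f g : Carrier → Carrier) → (∀ {x y} → x ≈ y → f x ≈ f y) → (∀ {x y} → x ≈ y → g x ≈ g y) →
    (∀ x → f (g x) ≈ x) → (∀ x → g (f x) ≈ x) → Perm.Permutation′ q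
  permutation f g f-cong g-cong fg≈ gf≈ = Perm.permutation (to ∘ f ∘ from) (to ∘ g ∘ from)
    (λ i → ≡.trans (to-cong (trans (f-cong (strictlyInverseʳ _)) (fg≈ (from i)))) (strictlyInverseˡ i))
    (λ i → ≡.trans (to-cong (trans (g-cong (strictlyInverseʳ _)) (gf≈ (from i)))) (strictlyInverseˡ i))

  -- Translation by 1 permutes the elements, so their sum S satisfies S + q · 1 = S.
  q·1≈0 : q · 1# ≈ 0#
  q·1≈0 = +-identityʳ-unique (sum from) (q · 1#) (begin
    sum from + q · 1#                ≈⟨ +-congˡ (sum-replicate q) ⟨
    sum from + sum (λ (_ : Fin q) → 1#)  ≈⟨ ∑-distrib-+ from (λ _ → 1#) ⟨
    sum (λ i → from i + 1#)          ≈⟨ sum-cong-≋ (λ i → sym (strictlyInverseʳ (from i + 1#))) ⟩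
    sum (λ i → from (to (from i + 1#))) ≈⟨ sum-permute from π ⟨
    sum from                         ∎)
    where
    open Algebra.Properties.CommutativeMonoid.Sum +-commutativeMonoid
    π : Perm.Permutation′ q
    π = permutation (_+ 1#) (_- 1#) +-congʳ +-congʳ
      (λ x → solve 2 (λ x u → x :- u :+ u := x) refl x 1#) (λ x → solve 2 (λ x u → x :+ u :- u := x) refl x 1#)

  private
    module ∏ where
      open Algebra.Properties.CommutativeMonoid.Sum *-commutativeMonoid public
      open SingleSum *-commutativeMonoid public

    open Domain commutativeRing (Field.isDomain commutativeRing isField 1≉0)

    -- The factor belonging to e = 0 is replaced by 1, so that the product of the nonzero elements
    -- can run over all of `Fin q`. Dually, `onZero` supplies the factor that belongs to e = 0
    -- alone.
    onNonzero : Carrier → Carrier → Carrier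
    onNonzero e x with e ≈? 0#
    ... | yes _ = 1#
    ... | no _  = x

    onZero : Carrier → Carrier → Carrier
    onZero e x with e ≈? 0#
    ... | yes _ = x
    ... | no _  = 1#

    ∏-nonzero : ∀ {n} (f : Fin n → Carrier) → (∀ i → ¬ (f i ≈ 0#)) → ¬ (∏.sum f ≈ 0#)
    ∏-nonzero {zero}  f f≉0 eq = 1≉0 eq
    ∏-nonzero {suc n} f f≉0 eq with Field.isDomain commutativeRing isField 1≉0 _ _ eq
    ... | inj₁ f0≈0 = f≉0 zero f0≈0
    ... | inj₂ fs≈0 = ∏-nonzero (f ∘ suc) (f≉0 ∘ suc) fs≈0

  -- Multiplication by x ≠ 0 permutes the nonzero elements, whose product is P.
  -- Counting 0 as well, xᑫ P = x P.
  fermat : ∀ x → x ^ q ≈ x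
  fermat x with isField x
  ... | inj₁ x≈0 = x^q≈x q (λ { ≡.refl → Fin.¬Fin0 (to 0#) }) x≈0
    where
    x^q≈x : ∀ n → n ≢ 0 → x ≈ 0# → x ^ n ≈ x
    x^q≈x zero    n≢0 _   = contradiction ≡.refl n≢0
    x^q≈x (suc n) _   x≈0 = trans (*-congʳ x≈0) (trans (zeroˡ _) (sym x≈0))
  ... | inj₂ (y , xy≈1) = *-cancelˡ {P} (∏-nonzero w w≉0) (begin
    P * x ^ q                                  ≈⟨ *-comm P _ ⟩
    x ^ q * P                                  ≈⟨ *-congʳ (∏.sum-replicate q) ⟨
    ∏.sum (λ (_ : Fin q) → x) * P              ≈⟨ ∏.∑-distrib-+ (λ _ → x) w ⟨
    ∏.sum (λ i → x * w i)                      ≈⟨ ∏.sum-cong-≋ (λ i → step (from i)) ⟩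
    ∏.sum (λ i → w′ (x * from i) * z i)        ≈⟨ ∏.∑-distrib-+ (λ i → w′ (x * from i)) z ⟩
    ∏.sum (λ i → w′ (x * from i)) * ∏.sum z    ≈⟨ *-cong permuted (trans (∏.sum-single z (to 0#) z≈1) z≈x) ⟩
    P * x                                      ∎)
    where
    w′ : Carrier → Carrier
    w′ e = onNonzero e e
    w z : Fin q → Carrier
    w i = w′ (from i)
    z i = onZero (from i) x
    P = ∏.sum w
    x≉0 : ¬ (x ≈ 0#)
    x≉0 = Field.unit≉0 commutativeRing isField 1≉0 xy≈1
    w≉0 : ∀ i → ¬ (w i ≈ 0#)
    w≉0 i with from i ≈? 0#
    ... | yes _  = 1≉0
    ... | no e≉0 = e≉0
    w′-cong : ∀ {e e′} → e ≈ e′ → w′ e ≈ w′ e′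
    w′-cong {e} {e′} eq with e ≈? 0# | e′ ≈? 0#
    ... | yes _   | yes _    = refl
    ... | no _    | no _     = eq
    ... | yes e≈0 | no e′≉0  = contradiction (trans (sym eq) e≈0) e′≉0
    ... | no e≉0  | yes e′≈0 = contradiction (trans eq e′≈0) e≉0
    step : ∀ e → x * w′ e ≈ w′ (x * e) * onZero e x
    step e with e ≈? 0# | (x * e) ≈? 0#
    ... | yes _   | yes _    = *-comm x 1#
    ... | no _    | no _     = sym (*-identityʳ _)
    ... | yes e≈0 | no xe≉0  = contradiction (trans (*-congˡ e≈0) (zeroʳ x)) xe≉0
    ... | no e≉0  | yes xe≈0 = [ (λ x≈0 → contradiction x≈0 x≉0) , (λ e≈0 → contradiction e≈0 e≉0) ]′
                                 (Field.isDomain commutativeRing isField 1≉0 x e xe≈0)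
    z≈1 : ∀ i → i ≢ to 0# → z i ≈ 1#
    z≈1 i i≢ with from i ≈? 0#
    ... | yes e≈0 = contradiction (≡.trans (≡.sym (strictlyInverseˡ i)) (to-cong e≈0)) i≢
    ... | no _    = refl
    z≈x : z (to 0#) ≈ x
    z≈x with from (to 0#) ≈? 0#
    ... | yes _  = refl
    ... | no e≉0 = contradiction (strictlyInverseʳ 0#) e≉0
    π : Perm.Permutation′ q
    π = permutation (x *_) (y *_) *-congˡ *-congˡ
      (λ e → trans (sym (*-assoc x y e)) (trans (*-congʳ xy≈1) (*-identityˡ e)))
      (λ e → trans (sym (*-assoc y x e)) (trans (*-congʳ (trans (*-comm y x) xy≈1)) (*-identityˡ e)))
    permuted : ∏.sum (λ i → w′ (x * from i)) ≈ P
    permuted = begin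
      ∏.sum (λ i → w′ (x * from i))              ≈⟨ ∏.sum-cong-≋ (λ i → w′-cong (sym (strictlyInverseʳ (x * from i)))) ⟩
      ∏.sum (λ i → w′ (from (to (x * from i))))  ≈⟨ ∏.sum-permute w π ⟨
      P                                          ∎

-- Frobenius powers

module Frobenius {c ℓ} (R : CommutativeRing c ℓ) where
  open CommutativeRingTheory R
  open Algebra.Properties.CommutativeMonoid.Sum +-commutativeMonoid
  open SingleSum +-commutativeMonoid
  open Relation.Binary.Reasoning.Setoid setoid

  IsAdditivePower : ℕ → Set (c ⊔ ℓ)
  IsAdditivePower q = ∀ x y → (x + y) ^ q ≈ x ^ q + y ^ q

  ∣⇒·≈0 : ∀ {p m} → p · 1# ≈ 0# → p ∣.∣ m → ∀ x → m · x ≈ 0#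
  ∣⇒·≈0 {p} p≈0 (divides k ≡.refl) x = begin
    (k ℕ.* p) · x       ≈⟨ ×-assocˡ x k p ⟨
    k · (p · x)         ≈⟨ ×-congʳ k (begin
      p · x               ≈⟨ ×-congʳ p (*-identityˡ x) ⟨
      p · (1# * x)        ≈⟨ ×-assoc-* p 1# x ⟨
      (p · 1#) * x        ≈⟨ *-congʳ p≈0 ⟩
      0# * x              ≈⟨ zeroˡ x ⟩
      0#                  ∎) ⟩
    k · 0#              ≈⟨ k·0≈0 k ⟩
    0#                  ∎
    where
    k·0≈0 : ∀ k → k · 0# ≈ 0#
    k·0≈0 zero    = refl
    k·0≈0 (suc k) = trans (+-identityˡ _) (k·0≈0 k)

  -- In the binomial expansion p divides every coefficient but the first and the last.
  prime⇒isAdditivePower : ∀ {p} → Prime p → p · 1# ≈ 0# → IsAdditivePower p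
  prime⇒isAdditivePower {zero}      pp _   x y = contradiction pp ¬prime[0]
  prime⇒isAdditivePower {p@(suc p′)} pp p≈0 x y = begin
    (x + y) ^ p
      ≈⟨ Binomial.theorem p x y ⟩
    term zero + sum (term ∘ suc)
      ≈⟨ +-congˡ (sum-init-last (term ∘ suc)) ⟩
    term zero + (sum (term ∘ suc ∘ inject₁) + term (suc (fromℕ p′)))
      ≈⟨ +-cong first (+-cong (sum-ε (term ∘ suc ∘ inject₁) middle) last) ⟩
    y ^ p + (0# + x ^ p)
      ≈⟨ trans (+-congˡ (+-identityˡ _)) (+-comm _ _) ⟩
    x ^ p + y ^ p  ∎
    where
    module Binomial = Algebra.Properties.CommutativeSemiring.Binomial commutativeSemiring
    term : Fin (suc p) → Carrier
    term k = (p C toℕ k) · (x ^ toℕ k * y ^ (p ℕ.∸ toℕ k))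
    first : term zero ≈ y ^ p
    first = trans (reflexive (≡.cong (_· (1# * y ^ p)) (Arithmetic.nC0≡1 p))) (trans (+-identityʳ _) (*-identityˡ _))
    last : term (suc (fromℕ p′)) ≈ x ^ p
    last = begin
      (p C suc (toℕ (fromℕ p′))) · (x ^ suc (toℕ (fromℕ p′)) * y ^ (p′ ℕ.∸ toℕ (fromℕ p′)))
        ≡⟨ ≡.cong (λ k → (p C suc k) · (x ^ suc k * y ^ (p′ ℕ.∸ k))) (Fin.toℕ-fromℕ p′) ⟩
      (p C p) · (x ^ p * y ^ (p′ ℕ.∸ p′))
        ≡⟨ ≡.cong₂ (λ m k → m · (x ^ p * y ^ k)) (nCn≡1 p) (ℕ.n∸n≡0 p′) ⟩
      x ^ p * 1# + 0#
        ≈⟨ trans (+-identityʳ _) (*-identityʳ _) ⟩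
      x ^ p  ∎
    middle : ∀ i → term (suc (inject₁ i)) ≈ 0#
    middle i = ∣⇒·≈0 p≈0 (Arithmetic.prime∣binomial pp (s≤s z≤n)
      (s≤s (≡.subst (ℕ._< p′) (≡.sym (Fin.toℕ-inject₁ i)) (Fin.toℕ<n i)))) _

  isAdditivePower-^ : ∀ {p} → IsAdditivePower p → ∀ k → IsAdditivePower (p ℕ.^ k)
  isAdditivePower-^ {p} add zero    x y = trans (*-identityʳ _) (sym (+-cong (*-identityʳ x) (*-identityʳ y)))
  isAdditivePower-^ {p} add (suc k) x y = begin
    (x + y) ^ (p ℕ.* p ℕ.^ k)                    ≈⟨ ^-assocʳ (x + y) p (p ℕ.^ k) ⟨
    ((x + y) ^ p) ^ (p ℕ.^ k)                    ≈⟨ ^-congˡ (p ℕ.^ k) (add x y) ⟩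
    (x ^ p + y ^ p) ^ (p ℕ.^ k)                  ≈⟨ isAdditivePower-^ add k (x ^ p) (y ^ p) ⟩
    (x ^ p) ^ (p ℕ.^ k) + (y ^ p) ^ (p ℕ.^ k)    ≈⟨ +-cong (^-assocʳ x p _) (^-assocʳ y p _) ⟩
    x ^ (p ℕ.* p ℕ.^ k) + y ^ (p ℕ.* p ℕ.^ k)    ∎

  module _ {q} (0<q : 0 ℕ.< q) (add : IsAdditivePower q) where

    power-homomorphism : RingHomomorphism.IsRingHomomorphism R R (_^ q)
    power-homomorphism = RingHomomorphism.ringHomomorphism R R (_^ q)
      (^-congˡ q) add (λ x y → ^-distrib-* x y q) (1^ q)
      where
      1^ : ∀ n → 1# ^ n ≈ 1#
      1^ zero    = refl
      1^ (suc n) = trans (*-identityˡ _) (1^ n)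

    -- By additivity the q-th power of x - y vanishes, and a domain has no nonzero nilpotent
    -- elements.
    power-injective : IsDomain R → ∀ {x y} → x ^ q ≈ y ^ q → x ≈ y
    power-injective dom {x} {y} eq = x∙y⁻¹≈ε⇒x≈y x y (reduced q 0<q (begin
      (x - y) ^ q          ≈⟨ add x (- y) ⟩
      x ^ q + (- y) ^ q    ≈⟨ +-cong eq (-‿homo y) ⟩
      y ^ q - y ^ q        ≈⟨ -‿inverseʳ _ ⟩
      0#                   ∎))
      where
      open RingHomomorphism.Properties R R power-homomorphism using (-‿homo)
      reduced : ∀ n → 0 ℕ.< n → ∀ {x} → x ^ n ≈ 0# → x ≈ 0#
      reduced (suc n) _ = Domain.^-≈0 R dom n

-- Dickson polynomials

module DicksonSum {c ℓ} (S : CommutativeRing c ℓ) (x u : CommutativeRing.Carrier S) where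
  open CommutativeRingTheory S
  open Algebra.Properties.CommutativeMonoid.Sum +-commutativeMonoid
  open RingSolver S
  open Relation.Binary.Reasoning.Setoid setoid
  open Arithmetic using (coefficient; coefficient-zero; coefficient-vanishes)

  term : ℕ → ℕ → Carrier
  term n i = coefficient n i · (u ^ i * x ^ (n ℕ.∸ 2 ℕ.* i))

  partial : ℕ → ℕ → Carrier
  partial n m = sum {m} (term n ∘ toℕ)

  private
    sum-snoc : ∀ m (f : ℕ → Carrier) → sum {suc m} (f ∘ toℕ) ≈ sum {m} (f ∘ toℕ) + f m
    sum-snoc zero    f = +-comm _ _
    sum-snoc (suc m) f = trans (+-congˡ (sum-snoc m (f ∘ suc))) (sym (+-assoc _ _ _))

    partial-suc : ∀ {n m} → n ℕ.< 2 ℕ.* m → partial n m ≈ partial n (suc m)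
    partial-suc {n} {m} n<2m = sym (begin
      partial n (suc m)      ≈⟨ sum-snoc m (term n) ⟩
      partial n m + term n m ≡⟨ ≡.cong (λ k → partial n m + k · (u ^ m * x ^ (n ℕ.∸ 2 ℕ.* m))) (coefficient-vanishes n m n<2m) ⟩
      partial n m + 0#       ≈⟨ +-identityʳ _ ⟩
      partial n m            ∎)

  partial-stable : ∀ {n m m′} → n ℕ.< 2 ℕ.* m → m ℕ.≤ m′ → partial n m ≈ partial n m′
  partial-stable {n} {m} n<2m m≤m′ with ℕ.m≤n⇒∃[o]m+o≡n m≤m′
  ... | o , ≡.refl = go o
    where
    go : ∀ o → partial n m ≈ partial n (m ℕ.+ o)
    go zero    = reflexive (≡.cong (partial n) (≡.sym (ℕ.+-identityʳ m)))
    go (suc o) = begin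
      partial n m                  ≈⟨ go o ⟩
      partial n (m ℕ.+ o)          ≈⟨ partial-suc {n} {m ℕ.+ o} (ℕ.<-≤-trans n<2m (ℕ.*-monoʳ-≤ 2 (ℕ.m≤m+n m o))) ⟩
      partial n (suc (m ℕ.+ o))    ≡⟨ ≡.cong (partial n) (ℕ.+-suc m o) ⟨
      partial n (m ℕ.+ suc o)      ∎

  private
    term-zero : ∀ n → term (2 ℕ.+ n) 0 ≈ x * term (suc n) 0
    term-zero n rewrite coefficient-zero n =
      solve 2 (λ x p → con (ℤ.+ 1) :* (x :* p) :+ con (ℤ.+ 0) := x :* (con (ℤ.+ 1) :* p :+ con (ℤ.+ 0))) refl x (x ^ suc n)

    -- Truncated subtraction yields the extra factor x only if 2 (j + 1) ≤ n + 1; in the other case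
    -- the coefficient is 0.
    shifted : ∀ n j → coefficient (suc n) (suc j) · (u ^ suc j * x ^ (n ℕ.∸ 2 ℕ.* j)) ≈ x * term (suc n) (suc j)
    shifted n j with 2 ℕ.* suc j ℕ.≤? suc n
    ... | no 2j≰n rewrite coefficient-vanishes (suc n) (suc j) (ℕ.≰⇒> 2j≰n) = sym (zeroʳ x)
    ... | yes 2j≤n = begin
      k · (u ^ suc j * x ^ (n ℕ.∸ 2 ℕ.* j))                    ≡⟨ ≡.cong (λ e → k · (u ^ suc j * x ^ e)) exponent ⟩
      k · (u ^ suc j * (x * x ^ (suc n ℕ.∸ 2 ℕ.* suc j)))      ≈⟨ ×-congʳ k (solve 3 (λ u x p → u :* (x :* p) := x :* (u :* p)) refl
                                                                  (u ^ suc j) x (x ^ (suc n ℕ.∸ 2 ℕ.* suc j))) ⟩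
      k · (x * (u ^ suc j * x ^ (suc n ℕ.∸ 2 ℕ.* suc j)))      ≈⟨ ×-comm-* k x _ ⟨
      x * (k · (u ^ suc j * x ^ (suc n ℕ.∸ 2 ℕ.* suc j)))      ∎
      where
      k = coefficient (suc n) (suc j)
      exponent : n ℕ.∸ 2 ℕ.* j ≡ suc (suc n ℕ.∸ 2 ℕ.* suc j)
      exponent = ≡.trans (≡.cong ((2 ℕ.+ n) ℕ.∸_) (≡.sym (ℕ.*-suc 2 j))) (ℕ.+-∸-assoc 1 2j≤n)

    term-suc : ∀ n j → term (2 ℕ.+ n) (suc j) ≈ x * term (suc n) (suc j) + u * term n j
    term-suc n j = begin
      (k ℕ.+ k′) · (u ^ suc j * x ^ ((2 ℕ.+ n) ℕ.∸ 2 ℕ.* suc j))   ≡⟨ ≡.cong (λ e → (k ℕ.+ k′) · (u ^ suc j * x ^ ((2 ℕ.+ n) ℕ.∸ e))) (ℕ.*-suc 2 j) ⟩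
      (k ℕ.+ k′) · (u ^ suc j * x ^ (n ℕ.∸ 2 ℕ.* j))               ≈⟨ ×-homo-+ _ k k′ ⟩
      k · (u ^ suc j * x ^ (n ℕ.∸ 2 ℕ.* j)) + k′ · (u ^ suc j * x ^ (n ℕ.∸ 2 ℕ.* j))
        ≈⟨ +-cong (shifted n j) (trans (×-congʳ k′ (*-assoc u (u ^ j) _)) (sym (×-comm-* k′ u _))) ⟩
      x * term (suc n) (suc j) + u * term n j                      ∎
      where
      k  = coefficient (suc n) (suc j)
      k′ = coefficient n j

    partial-recurrence : ∀ n m → partial (2 ℕ.+ n) (suc m) ≈ x * partial (suc n) (suc m) + u * partial n m
    partial-recurrence n m = begin
      term (2 ℕ.+ n) 0 + sum (λ (i : Fin m) → term (2 ℕ.+ n) (suc (toℕ i)))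
        ≈⟨ +-cong (term-zero n) (sum-cong-≋ {m} (λ i → term-suc n (toℕ i))) ⟩
      x * term (suc n) 0 + sum (λ (i : Fin m) → x * term (suc n) (suc (toℕ i)) + u * term n (toℕ i))
        ≈⟨ +-congˡ (∑-distrib-+ (λ (i : Fin m) → x * term (suc n) (suc (toℕ i))) (λ i → u * term n (toℕ i))) ⟩
      x * term (suc n) 0 + (sum (λ (i : Fin m) → x * term (suc n) (suc (toℕ i))) + sum (λ (i : Fin m) → u * term n (toℕ i)))
        ≈⟨ +-congˡ (+-cong (sum-* x (λ (i : Fin m) → term (suc n) (suc (toℕ i)))) (sum-* u (λ (i : Fin m) → term n (toℕ i)))) ⟩
      x * term (suc n) 0 + (x * sum (λ (i : Fin m) → term (suc n) (suc (toℕ i))) + u * partial n m)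
        ≈⟨ solve 4 (λ x a b c → x :* a :+ (x :* b :+ c) := x :* (a :+ b) :+ c) refl x (term (suc n) 0)
             (sum (λ (i : Fin m) → term (suc n) (suc (toℕ i)))) (u * partial n m) ⟩
      x * partial (suc n) (suc m) + u * partial n m  ∎
      where
      sum-* : ∀ {m} y (f : Fin m → Carrier) → sum (λ i → y * f i) ≈ y * sum f
      sum-* {zero}  y f = sym (zeroʳ y)
      sum-* {suc m} y f = trans (+-congˡ (sum-* y (f ∘ suc))) (sym (distribˡ y _ _))

  -- The sum extends to i = n instead of ⌊n/2⌋. The additional coefficients vanish, and the
  -- recurrence needs no distinction by the parity of n.
  total : ℕ → Carrier
  total n = partial n (suc n)

  private
    n<2*[1+n] : ∀ n → n ℕ.< 2 ℕ.* suc n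
    n<2*[1+n] n = ℕ.m≤m+n (suc n) (suc n ℕ.+ 0)

  total-recurrence : ∀ n → total (2 ℕ.+ n) ≈ x * total (suc n) + u * total n
  total-recurrence n = trans (partial-recurrence n (2 ℕ.+ n))
    (+-cong (*-congˡ (sym (partial-stable {suc n} {2 ℕ.+ n} (n<2*[1+n] (suc n)) (ℕ.n≤1+n _))))
            (*-congˡ (sym (partial-stable {n} {suc n} (n<2*[1+n] n) (ℕ.n≤1+n _)))))

  total-0 : total 0 ≈ 1# + 1#
  total-0 = solve 0 (con (ℤ.+ 1) :* con (ℤ.+ 1) :+ (con (ℤ.+ 1) :* con (ℤ.+ 1) :+ con (ℤ.+ 0)) :+ con (ℤ.+ 0) := con (ℤ.+ 1) :+ con (ℤ.+ 1)) refl

  total-1 : total 1 ≈ x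
  total-1 = solve 1 (λ x → con (ℤ.+ 1) :* (x :* con (ℤ.+ 1)) :+ con (ℤ.+ 0) :+ (con (ℤ.+ 0) :+ con (ℤ.+ 0)) := x) refl x

  n<2*[1+⌊n/2⌋] : ∀ n → n ℕ.< 2 ℕ.* suc ⌊ n /2⌋
  n<2*[1+⌊n/2⌋] zero          = s≤s z≤n
  n<2*[1+⌊n/2⌋] (suc zero)    = s≤s (s≤s z≤n)
  n<2*[1+⌊n/2⌋] (suc (suc n)) =
    ≡.subst (2 ℕ.+ n ℕ.<_) (≡.sym (ℕ.*-suc 2 (suc ⌊ n /2⌋))) (s≤s (s≤s (n<2*[1+⌊n/2⌋] n)))

  2*⌊n/2⌋≤n : ∀ n → 2 ℕ.* ⌊ n /2⌋ ℕ.≤ n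
  2*⌊n/2⌋≤n zero          = z≤n
  2*⌊n/2⌋≤n (suc zero)    = z≤n
  2*⌊n/2⌋≤n (suc (suc n)) = ≡.subst (ℕ._≤ 2 ℕ.+ n) (≡.sym (ℕ.*-suc 2 ⌊ n /2⌋)) (s≤s (s≤s (2*⌊n/2⌋≤n n)))

module Dickson {c ℓ} (R : CommutativeRing c ℓ) (a : CommutativeRing.Carrier R) where
  private module R = CommutativeRingTheory R
  open PolynomialRing R
  open Degree R
  private module Poly = CommutativeRingTheory commutativeRing
  open RingSolver commutativeRing
  open DicksonSum commutativeRing X (const (R.- a))
  open Relation.Binary.Reasoning.Setoid Poly.setoid
  open Algebra.Properties.CommutativeMonoid.Sum Poly.+-commutativeMonoid using (sum; sum-cong-≋)

  D : ℕ → Poly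
  D = total

  private
    const-· : ∀ n x → const (n R.· x) ≋ n Poly.· const x
    const-· zero    x = []≋0∷ ≋-refl
    const-· (suc n) x = +-cong {p = const x} ≋-refl (const-· n x)

    const-*-const : ∀ x y → const (x R.* y) ≋ const x * const y
    const-*-const x y = ≋-sym (const-* x (const y))

    const-^ : ∀ x n → const (x R.^ n) ≋ const x Poly.^ n
    const-^ x zero    = ≋-refl
    const-^ x (suc n) = ≋-trans (const-*-const x (x R.^ n)) (*-congˡ (const x) (const-^ x n))

    ^≡^ : ∀ p n → p P.^ n ≡ p Poly.^ n
    ^≡^ p zero    = ≡.refl
    ^≡^ p (suc n) = ≡.cong (p *_) (^≡^ p n)

  dickson≋D : ∀ n → 0 ℕ.< n → P.dickson n a ≋ D n
  dickson≋D n 0<n = begin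
    P.dickson n a                ≈⟨ sum-cong-≋ summand ⟩
    partial n (suc ⌊ n /2⌋)      ≈⟨ partial-stable {n} {suc ⌊ n /2⌋} (n<2*[1+⌊n/2⌋] n) (s≤s (ℕ.⌊n/2⌋≤n n)) ⟩
    D n                          ∎
    where
    summand : ∀ (i : Fin (suc ⌊ n /2⌋)) →
      const (dicksonCoeff n (toℕ i) R.· (R.- a) R.^ toℕ i) * X P.^ (n ℕ.∸ 2 ℕ.* toℕ i) ≋ term n (toℕ i)
    summand i = begin
      const (dicksonCoeff n j R.· (R.- a) R.^ j) * X P.^ e
        ≡⟨ ≡.cong (const (dicksonCoeff n j R.· (R.- a) R.^ j) *_) (^≡^ X e) ⟩
      const (dicksonCoeff n j R.· (R.- a) R.^ j) * X Poly.^ e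
        ≡⟨ ≡.cong (λ k → const (k R.· (R.- a) R.^ j) * X Poly.^ e)
             (Arithmetic.dicksonCoeff≡coefficient n j 0<n
               (ℕ.≤-trans (ℕ.*-monoʳ-≤ 2 (ℕ.s≤s⁻¹ (Fin.toℕ<n i))) (2*⌊n/2⌋≤n n))) ⟩
      const (k R.· (R.- a) R.^ j) * X Poly.^ e
        ≈⟨ *-congʳ (X Poly.^ e) (≋-trans (const-· k _) (Poly.×-congʳ k (const-^ (R.- a) j))) ⟩
      (k Poly.· const (R.- a) Poly.^ j) * X Poly.^ e
        ≈⟨ Poly.×-assoc-* k (const (R.- a) Poly.^ j) (X Poly.^ e) ⟩
      term n j  ∎
      where
      j = toℕ i
      e = n ℕ.∸ 2 ℕ.* j
      k = Arithmetic.coefficient n j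

  -- The constant 2 at index 0 is not monic in general. So monicity starts at index 1, and the
  -- induction carries a degree bound for the preceding polynomial.
  D-Top : ∀ n → Top (D (suc n)) (suc n) R.1# × D n deg< suc n
  D-Top zero    = Top-cong (≋-sym total-1) R.refl (Top-∷ R.0# (Top-const R.1#))
                , deg<-cong (≋-sym total-0) (above (Top-const (R.1# R.+ R.1#)))
  D-Top (suc n) with D-Top n
  ... | t , d = Top-cong (≋-sym (≋-trans (total-recurrence n)
                  (+-cong (X-* (D (suc n))) (const-* (R.- a) (D n))))) R.refl
                  (Top-+ (Top-∷ R.0# t) (deg<-scale (R.- a) (deg<-mono (ℕ.n≤1+n (suc n)) d)))
              , above t

  module _ {b ℓ₂} (B : CommutativeRing b ℓ₂) {φ : R.Carrier → CommutativeRing.Carrier B}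
    (hom : RingHomomorphism.IsRingHomomorphism R B φ) where
    private
      module B = CommutativeRingTheory B
      module S = RingSolver B
      module φ = RingHomomorphism.Properties R B hom
    open Evaluation R B hom

    -- The sequence u^n + v^n satisfies the recurrence with coefficients u + v and - u v, which is
    -- that of the Dickson polynomials at u + v with parameter u v.
    eval-D : ∀ {u v} → u B.* v B.≈ φ a → ∀ n → eval (u B.+ v) (D n) B.≈ u B.^ n B.+ v B.^ n
    eval-D {u} {v} uv≈a = λ n → proj₁ (both n)
      where
      s = u B.+ v
      step : ∀ n → eval s (D (2 ℕ.+ n)) B.≈ s B.* eval s (D (suc n)) B.+ B.- (u B.* v) B.* eval s (D n)
      step n = B.trans (eval-cong B.refl (total-recurrence n)) (B.trans (eval-+ s (X * D (suc n)) (const (R.- a) * D n))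
        (B.+-cong (B.trans (eval-* s X (D (suc n))) (B.*-congʳ (eval-X s)))
                  (B.trans (eval-* s (const (R.- a)) (D n)) (B.*-congʳ (B.trans (eval-const s (R.- a))
                    (B.trans (φ.-‿homo a) (B.-‿cong (B.sym uv≈a))))))))
      both : ∀ n → eval s (D n) B.≈ u B.^ n B.+ v B.^ n × eval s (D (suc n)) B.≈ u B.^ suc n B.+ v B.^ suc n
      both zero    = B.trans (eval-cong B.refl total-0) (B.trans (eval-+ s (const R.1#) (const R.1#))
                       (B.+-cong (B.trans (eval-const s R.1#) φ.1#-homo) (B.trans (eval-const s R.1#) φ.1#-homo)))
                   , B.trans (eval-cong B.refl total-1) (B.trans (eval-X s)
                       (B.sym (B.+-cong (B.*-identityʳ u) (B.*-identityʳ v))))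
      both (suc n) with both n
      ... | eq , eq′ = eq′ , B.trans (step n) (B.trans (B.+-cong (B.*-congˡ eq′) (B.*-congˡ eq))
        (S.solve 4 (λ u v p q → (u S.:+ v) S.:* (u S.:* p S.:+ v S.:* q) S.:+ S.:- (u S.:* v) S.:* (p S.:+ q)
                             S.:= u S.:* (u S.:* p) S.:+ v S.:* (v S.:* q)) B.refl u v (u B.^ n) (v B.^ n)))

-- Orders of elements

module Order {c ℓ} (R : CommutativeRing c ℓ) where
  open CommutativeRingTheory R
  open RingSolver R
  open Arithmetic using (IsLeastPositive; least-positive)
  open Relation.Binary.Reasoning.Setoid setoid

  1^n≈1 : ∀ n → 1# ^ n ≈ 1#
  1^n≈1 zero    = refl
  1^n≈1 (suc n) = trans (*-identityˡ _) (1^n≈1 n)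

  ^≈1-∣ : ∀ {x m n} → m ∣.∣ n → x ^ m ≈ 1# → x ^ n ≈ 1#
  ^≈1-∣ {x} {m} (divides k ≡.refl) eq = begin
    x ^ (k ℕ.* m)   ≡⟨ ≡.cong (x ^_) (ℕ.*-comm k m) ⟩
    x ^ (m ℕ.* k)   ≈⟨ ^-assocʳ x m k ⟨
    (x ^ m) ^ k     ≈⟨ ^-congˡ k eq ⟩
    1# ^ k          ≈⟨ 1^n≈1 k ⟩
    1#              ∎

  order∣ : ∀ {x o k} → IsLeastPositive (λ k → x ^ k ≈ 1#) o → x ^ k ≈ 1# → o ∣.∣ k
  order∣ {x} {o@(suc _)} {k} (_ , x^o≈1 , least) x^k≈1 with k ℕ.% o in eq
  ... | zero  = ∣.m%n≡0⇒n∣m k o eq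
  ... | suc r = contradiction (least (suc r) (s≤s z≤n) (begin
        x ^ suc r                                  ≈⟨ *-identityʳ _ ⟨
        x ^ suc r * 1#                             ≈⟨ *-congˡ (^≈1-∣ (∣.n∣m*n (k ℕ./ o)) x^o≈1) ⟨
        x ^ suc r * x ^ (k ℕ./ o ℕ.* o)            ≈⟨ ^-homo-* x (suc r) _ ⟨
        x ^ (suc r ℕ.+ k ℕ./ o ℕ.* o)              ≡⟨ ≡.cong (λ r → x ^ (r ℕ.+ k ℕ./ o ℕ.* o)) eq ⟨
        x ^ (k ℕ.% o ℕ.+ k ℕ./ o ℕ.* o)            ≡⟨ ≡.cong (x ^_) (ℕ.m≡m%n+[m/n]*n k o) ⟨
        x ^ k                                      ≈⟨ x^k≈1 ⟩
        1#                                         ∎))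
      (ℕ.<⇒≱ (≡.subst (ℕ._< o) eq (ℕ.m%n<n k o)))

  -- The order of x divides both exponents.
  coprime-^≈1 : (∀ x y → Dec (x ≈ y)) → ∀ {x m n} → 0 ℕ.< m → Coprime m n → x ^ m ≈ 1# → x ^ n ≈ 1# → x ≈ 1#
  coprime-^≈1 _≟_ {x} 0<m coprime x^m≈1 x^n≈1 with least-positive (λ k → (x ^ k) ≟ 1#) 0<m x^m≈1
  ... | o , isOrder with coprime (order∣ isOrder x^m≈1 , order∣ isOrder x^n≈1)
  ... | ≡.refl = trans (sym (*-identityʳ x)) (proj₁ (proj₂ isOrder))

  -1^odd : ∀ j → (- 1#) ^ suc (j ℕ.* 2) ≈ - 1#
  -1^odd zero    = *-identityʳ (- 1#)
  -1^odd (suc j) = trans (solve 1 (λ p → :- con (ℤ.+ 1) :* (:- con (ℤ.+ 1) :* p) := p) refl _) (-1^odd j)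

module _ {c ℓ} (R : CommutativeRing c ℓ) (isDomain : IsDomain R) where
  open CommutativeRingTheory R

  -- `(p ℕ.^ k) · 1#` is the k-th power of `p · 1#`, so in a domain it vanishes only with `p · 1#`.
  prime-characteristic : ¬ (1# ≈ 0#) → ∀ p k → (p ℕ.^ k) · 1# ≈ 0# → p · 1# ≈ 0#
  prime-characteristic 1≉0 p zero    eq = contradiction (trans (sym (×-homo-1 1#)) eq) 1≉0
  prime-characteristic 1≉0 p (suc k) eq =
    [ id , prime-characteristic 1≉0 p k ]′ (isDomain _ _ (trans (sym (×1-homo-* p (p ℕ.^ k))) eq))

-- Fixed fields and minimal polynomials

module FixedField {a ℓ₁ d ℓ₂ s} (E : FiniteField a ℓ₁ s) (1<s : 1 ℕ.< s)
  (D : CommutativeRing d ℓ₂) (isDomain : IsDomain D)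
  (1≉0 : ¬ (CommutativeRing._≈_ D (CommutativeRing.1# D) (CommutativeRing.0# D)))
  (_≟_ : ∀ x y → Dec (CommutativeRing._≈_ D x y))
  {j : FiniteField.Carrier E → CommutativeRing.Carrier D}
  (hom : RingHomomorphism.IsRingHomomorphism (FiniteField.commutativeRing E) D j) where
  private
    module E where
      open CommutativeRingTheory (FiniteField.commutativeRing E) public
      open FiniteField E using (commutativeRing; 1≉0; enumeration) public
      open Enumerated E public
    module j = RingHomomorphism.Properties E.commutativeRing D hom
    open CommutativeRingTheory D
    open Inverse E.enumeration using (to; from)
    module D[X] where
      open PolynomialRing D public
      open CommutativeRingTheory commutativeRing using (_^_) public
    open D[X] using (X; const; coeffs; coeff-≈)
    open Degree D
    open Roots D isDomain
    open Relation.Binary.Reasoning.Setoid setoid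

  injective : ∀ {x y} → j x ≈ j y → x E.≈ y
  injective {x} {y} eq with E.isField (x E.- y)
  ... | inj₁ x-y≈0      = E.x∙y⁻¹≈ε⇒x≈y x y x-y≈0
  ... | inj₂ (z , [x-y]z≈1) = contradiction (begin
      1#                         ≈⟨ j.1#-homo ⟨
      j E.1#                     ≈⟨ j.⟦⟧-cong [x-y]z≈1 ⟨
      j ((x E.- y) E.* z)        ≈⟨ j.*-homo _ z ⟩
      j (x E.- y) * j z          ≈⟨ *-congʳ (trans (j.+-homo x (E.- y)) (trans (+-congˡ (j.-‿homo y)) (x≈y⇒x∙y⁻¹≈ε eq))) ⟩
      0# * j z                   ≈⟨ zeroˡ _ ⟩
      0#                         ∎) 1≉0

  fixed : ∀ x → j x ^ s ≈ j x
  fixed x = trans (sym (j.^-homo x s)) (j.⟦⟧-cong (E.fermat x))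

  private
    X-Top : Top X 1 1#
    X-Top = Top-∷ 0# (Top-const 1#)

    Xˢ-X : D[X].Poly
    Xˢ-X = X D[X].^ s D[X].+ D[X].- X

    Xˢ-X-Top : Top Xˢ-X s 1#
    Xˢ-X-Top = Top-+ (Top-X^ s) (deg<-neg (deg<-mono 1<s (above X-Top)))

    eval-Xˢ-X : ∀ z → eval z Xˢ-X ≈ z ^ s - z
    eval-Xˢ-X z = trans (H.+-homo (X D[X].^ s) (D[X].- X))
      (+-cong (trans (H.^-homo X s) (^-congˡ s (eval-X z))) (trans (H.-‿homo X) (-‿cong (eval-X z))))
      where module H = RingHomomorphism.Properties D[X].commutativeRing D (eval-homomorphism z)

  -- The s images and z would be s + 1 roots of Xˢ - X.
  fixed⇒∈image : ∀ {z} → z ^ s ≈ z → ∃[ x ] (j x ≈ z)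
  fixed⇒∈image {z} z^s≈z with Fin.any? (λ i → j (from i) ≟ z)
  ... | yes (i , eq) = from i , eq
  ... | no ∉image    = contradiction (trans (sym (coeff-top Xˢ-X-Top)) (coeff-≈ vanishes s)) 1≉0
    where
    ρ : Fin (suc s) → Carrier
    ρ zero    = z
    ρ (suc i) = j (from i)
    ρ-injective : ∀ {i k} → ρ i ≈ ρ k → i ≡ k
    ρ-injective {zero}  {zero}  _  = ≡.refl
    ρ-injective {zero}  {suc k} eq = contradiction (k , sym eq) ∉image
    ρ-injective {suc i} {zero}  eq = contradiction (i , eq) ∉image
    ρ-injective {suc i} {suc k} eq = ≡.cong suc (E.from-injective (injective eq))
    root : ∀ i → eval (ρ i) Xˢ-X ≈ 0#
    root zero    = trans (eval-Xˢ-X z) (x≈y⇒x∙y⁻¹≈ε z^s≈z)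
    root (suc i) = trans (eval-Xˢ-X _) (x≈y⇒x∙y⁻¹≈ε (fixed (from i)))
    vanishes : Xˢ-X D[X].≋ []
    vanishes = deg<roots⇒≋[] (above Xˢ-X-Top) ρ ρ-injective root

module MinimalPolynomial {a ℓ₁ d ℓ₂ q} (F : FiniteField a ℓ₁ q)
  (D : CommutativeRing d ℓ₂) (isDomain : IsDomain D) (0<q : 0 ℕ.< q) (additive : Frobenius.IsAdditivePower D q)
  {φ : FiniteField.Carrier F → CommutativeRing.Carrier D}
  (hom : RingHomomorphism.IsRingHomomorphism (FiniteField.commutativeRing F) D φ)
  (φ-injective : ∀ {x y} → CommutativeRing._≈_ D (φ x) (φ y) → FiniteField._≈_ F x y)
  where
  private
    module F where
      open CommutativeRingTheory (FiniteField.commutativeRing F) public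
      open FiniteField F using (commutativeRing; 1≉0) public
      open Enumerated F public
    open CommutativeRingTheory D
    module φ = RingHomomorphism.Properties F.commutativeRing D hom
    module F[X] where
      open PolynomialRing F.commutativeRing public
      open CommutativeRingTheory commutativeRing using (+-identityʳ) public
    open F[X] using (Poly; const; coeff; _≋_; coeffs; coeff-≈; ≋-sym; ≋-trans; ≋-refl)
    open Degree F.commutativeRing
    open FieldExtension F.commutativeRing F.isField F.1≉0 using (degree)
    module E = Evaluation F.commutativeRing D hom
    module Root = Roots D isDomain
    module D[X] = PolynomialRing D
    module DegD = Degree D
    module Map = ChangeOfCoefficients F.commutativeRing D hom
    open Relation.Binary.Reasoning.Setoid setoid

  0<q^ : ∀ i → 0 ℕ.< q ℕ.^ i
  0<q^ i = ℕ.m^n>0 q {{ℕ.>-nonZero 0<q}} i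

  module Power (i : ℕ) where
    additive^ = Frobenius.isAdditivePower-^ D {q} additive i
    open RingHomomorphism.Properties D D (Frobenius.power-homomorphism D (0<q^ i) additive^) public
    injective = Frobenius.power-injective D (0<q^ i) additive^ isDomain

  fixed : ∀ i x → φ x ^ (q ℕ.^ i) ≈ φ x
  fixed zero    x = *-identityʳ _
  fixed (suc i) x = begin
    φ x ^ (q ℕ.* q ℕ.^ i)      ≈⟨ ^-assocʳ (φ x) q (q ℕ.^ i) ⟨
    (φ x ^ q) ^ (q ℕ.^ i)      ≈⟨ ^-congˡ (q ℕ.^ i) (trans (sym (φ.^-homo x q)) (φ.⟦⟧-cong (F.fermat x))) ⟩
    φ x ^ (q ℕ.^ i)            ≈⟨ fixed i x ⟩
    φ x                        ∎

  -- Taking q^i-th powers is a ring homomorphism that fixes the coefficients, as they come from 𝔽q.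
  conjugate : ∀ i x p → E.eval (x ^ (q ℕ.^ i)) p ≈ E.eval x p ^ (q ℕ.^ i)
  conjugate i x []      = sym (Power.0#-homo i)
  conjugate i x (c ∷ p) = sym (begin
    (φ c + x * E.eval x p) ^ (q ℕ.^ i)                          ≈⟨ Power.+-homo i _ _ ⟩
    φ c ^ (q ℕ.^ i) + (x * E.eval x p) ^ (q ℕ.^ i)              ≈⟨ +-cong (fixed i c) (Power.*-homo i _ _) ⟩
    φ c + x ^ (q ℕ.^ i) * E.eval x p ^ (q ℕ.^ i)                ≈⟨ +-congˡ (*-congˡ (conjugate i x p)) ⟨
    φ c + x ^ (q ℕ.^ i) * E.eval (x ^ (q ℕ.^ i)) p              ∎)

  eval-map : ∀ x p → Root.eval x (map φ p) ≈ E.eval x p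
  eval-map x []      = refl
  eval-map x (c ∷ p) = +-congˡ (*-congˡ (eval-map x p))

  module _ {x m} (distinct : ∀ k → 0 ℕ.< k → k ℕ.< m → ¬ (x ^ (q ℕ.^ k) ≈ x)) where
    private
      -- x^(q^(i + o)) is the q^i-th power of x^(q^o), and q^i-th powers are injective; so any
      -- coincidence reduces to one with x itself.
      ordered : ∀ {i k} → i ℕ.< k → k ℕ.< m → ¬ (x ^ (q ℕ.^ i) ≈ x ^ (q ℕ.^ k))
      ordered {i} i<k k<m eq with ℕ.m≤n⇒∃[o]m+o≡n (ℕ.<⇒≤ i<k)
      ... | o , ≡.refl = distinct o (ℕ.+-cancelˡ-< i 0 o (≡.subst (ℕ._< i ℕ.+ o) (≡.sym (ℕ.+-identityʳ i)) i<k))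
              (ℕ.≤-<-trans (ℕ.m≤n+m o i) k<m)
              (Power.injective i (begin
                (x ^ (q ℕ.^ o)) ^ (q ℕ.^ i)    ≈⟨ ^-assocʳ x (q ℕ.^ o) (q ℕ.^ i) ⟩
                x ^ (q ℕ.^ o ℕ.* q ℕ.^ i)      ≡⟨ ≡.cong (x ^_) (≡.trans (≡.sym (ℕ.^-distribˡ-+-* q o i)) (≡.cong (q ℕ.^_) (ℕ.+-comm o i))) ⟩
                x ^ (q ℕ.^ (i ℕ.+ o))          ≈⟨ eq ⟨
                x ^ (q ℕ.^ i)                  ∎))

    deg<root⇒≋[] : ∀ {p} → p deg< m → E.eval x p ≈ 0# → p ≋ []
    deg<root⇒≋[] {p} p<m px≈0 = coeffs λ k → φ-injective (trans (sym (Map.coeff-map p k))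
      (trans (D[X].coeff-≈ vanishes k) (sym φ.0#-homo)))
      where
      ρ : Fin m → Carrier
      ρ i = x ^ (q ℕ.^ toℕ i)
      ρ-injective : ∀ {i k} → ρ i ≈ ρ k → i ≡ k
      ρ-injective {i} {k} eq with ℕ.<-cmp (toℕ i) (toℕ k)
      ... | tri< i<k _ _ = contradiction eq (ordered i<k (Fin.toℕ<n k))
      ... | tri≈ _ i≡k _ = Fin.toℕ-injective i≡k
      ... | tri> _ _ k<i = contradiction (sym eq) (ordered k<i (Fin.toℕ<n i))
      vanishes : map φ p D[X].≋ []
      vanishes = Root.deg<roots⇒≋[]
        (DegD.bounded λ k m≤k → trans (Map.coeff-map p k) (trans (φ.⟦⟧-cong (coeff-≈0 p<m k m≤k)) φ.0#-homo))
        ρ ρ-injective λ i → trans (eval-map (ρ i) p) (trans (conjugate (toℕ i) x p)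
          (trans (^-congˡ (q ℕ.^ toℕ i) px≈0) (Power.0#-homo (toℕ i))))

  Top-unique : ∀ {p m n x y} → ¬ (x F.≈ F.0#) → ¬ (y F.≈ F.0#) → Top p m x → Top p n y → m ≡ n × x F.≈ y
  Top-unique {m = m} {n} x≉0 y≉0 t t′ with ℕ.<-cmp m n
  ... | tri< m<n _ _    = contradiction (F.trans (F.sym (coeff-top t′)) (coeff-≈0 (above t) n m<n)) y≉0
  ... | tri> _ _ n<m    = contradiction (F.trans (F.sym (coeff-top t)) (coeff-≈0 (above t′) m n<m)) x≉0
  ... | tri≈ _ ≡.refl _ = ≡.refl , F.trans (F.sym (coeff-top t)) (coeff-top t′)

  -- Translates the divisors of 1 that occur in `Irreducible` into degrees: degrees add over a
  -- field, so both factors of 1 have degree 0.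
  unit⇒Top0 : ∀ {p s} → s F[X].* p ≋ const F.1# → ∃[ x ] (¬ (x F.≈ F.0#) × Top p 0 x)
  unit⇒Top0 {p} {s} sp≋1 with degree (length p) (length-deg< p) | degree (length s) (length-deg< s)
    where
    length-deg< : ∀ p → p deg< length p
    length-deg< []      = bounded λ _ _ → F.refl
    length-deg< (c ∷ p) = bounded λ { (suc k) (s≤s len≤k) → coeff-≈0 (length-deg< p) k len≤k }
  ... | inj₁ p≋[] | _ = contradiction (coeff-≈ {const F.1#} {[]} (≋-trans (≋-sym sp≋1)
          (≋-trans (F[X].*-congˡ s p≋[]) (F[X].*-zeroʳ s))) 0) F.1≉0
  ... | _ | inj₁ s≋[] = contradiction (coeff-≈ {const F.1#} {[]} (≋-trans (≋-sym sp≋1) (F[X].*-zeroˡ p s≋[])) 0) F.1≉0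
  ... | inj₂ (d , x , x′ , _ , t , xx′≈1) | inj₂ (e , z , z′ , _ , t′ , zz′≈1)
    with Top-unique zx≉0 F.1≉0 (Top-* t′ t) (Top-cong (≋-sym sp≋1) F.refl (Top-const F.1#))
    where
    open Field F.commutativeRing F.isField F.1≉0 using () renaming (unit≉0 to unit; isDomain to F-isDomain)
    zx≉0 : ¬ (z F.* x F.≈ F.0#)
    zx≉0 zx≈0 = [ unit zz′≈1 , unit xx′≈1 ]′ (F-isDomain z x zx≈0)
  ... | e+d≡0 , _ with ℕ.m+n≡0⇒n≡0 e e+d≡0
  ... | ≡.refl = x , Field.unit≉0 F.commutativeRing F.isField F.1≉0 xx′≈1 , t

  -- The remainder of f by g has the m conjugates of x as roots, so g divides f.
  minimal-unique : ∀ {f g x d m} → F[X].P.Irreducible f → Top f d F.1# → E.eval x f ≈ 0# →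
    0 ℕ.< m → Top g m F.1# → E.eval x g ≈ 0# →
    (∀ k → 0 ℕ.< k → k ℕ.< m → ¬ (x ^ (q ℕ.^ k) ≈ x)) → f ≋ g
  minimal-unique {f} {g} {x} {d} {m} irr f-Top fx≈0 0<m g-Top gx≈0 distinct with division g-Top f
  ... | s , r , f≋sg+r , r<m = result (split-∣1 (coeff-≈ f≋sg))
    where
    open F[X].P.Irreducible irr using (split-∣1)
    r≋[] : r ≋ []
    r≋[] = deg<root⇒≋[] distinct r<m (begin
      E.eval x r                                   ≈⟨ +-identityˡ _ ⟨
      0# + E.eval x r                              ≈⟨ +-congʳ (trans (E.eval-* x s g) (trans (*-congˡ gx≈0) (zeroʳ _))) ⟨
      E.eval x (s F[X].* g) + E.eval x r           ≈⟨ E.eval-+ x (s F[X].* g) r ⟨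
      E.eval x (s F[X].* g F[X].+ r)               ≈⟨ E.eval-cong refl f≋sg+r ⟨
      E.eval x f                                   ≈⟨ fx≈0 ⟩
      0#                                           ∎)
    f≋sg : f ≋ s F[X].* g
    f≋sg = ≋-trans f≋sg+r (≋-trans (F[X].+-cong ≋-refl r≋[]) (F[X].+-identityʳ (s F[X].* g)))
    result : F[X].P._∣_ s (const F.1#) ⊎ F[X].P._∣_ g (const F.1#) → f ≋ g
    result (inj₂ record { quotient = s′ ; equality = s′g≈1 }) with unit⇒Top0 {g} {s′} (coeffs s′g≈1)
    ... | y , y≉0 , t = contradiction (proj₁ (Top-unique F.1≉0 y≉0 g-Top t)) (ℕ.>⇒≢ 0<m)
    -- Here s is a nonzero constant y, and comparing the leading coefficients of the monic f and of
    -- s g gives y = 1.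
    result (inj₁ record { quotient = s′ ; equality = s′s≈1 }) with unit⇒Top0 {s} {s′} (coeffs s′s≈1)
    ... | y , y≉0 , t with Top-unique F.1≉0 y*1≉0 f-Top (Top-cong (≋-sym f≋sg) F.refl (Top-* t g-Top))
      where
      y*1≉0 : ¬ (y F.* F.1# F.≈ F.0#)
      y*1≉0 eq = y≉0 (F.trans (F.sym (F.*-identityʳ y)) eq)
    ... | _ , 1≈y*1 = ≋-trans f≋sg (≋-trans (F[X].*-congʳ g s≋1) (F[X].*-identityˡ g))
      where
      s≋1 : s ≋ const F.1#
      s≋1 = coeffs λ { zero → F.trans (coeff-top t) (F.trans (F.sym (F.*-identityʳ y)) (F.sym 1≈y*1))
                     ; (suc k) → coeff-≈0 (above t) (suc k) (s≤s z≤n) }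

-- Adjoining y with x = b (y + y⁻¹)

-- For a monic p = cs + X^d of degree d, homogenize cs is X^d p(b (X + X⁻¹)).
module Homogenization {c ℓ} (K : CommutativeRing c ℓ) (b : CommutativeRing.Carrier K) where
  private module K = CommutativeRingTheory K
  open PolynomialRing K
  open Degree K
  private module Poly = CommutativeRingTheory commutativeRing

  monic : List K.Carrier → Poly
  monic cs = cs ++ const K.1#

  homogenize : List K.Carrier → Poly
  homogenize []       = const K.1#
  homogenize (x ∷ cs) =
    const x * X Poly.^ suc (length cs) + const b * (X * X + const K.1#) * homogenize cs

  monic-representation : ∀ {p} d → Top p d K.1# → ∃[ cs ] (length cs ≡ d × p ≋ monic cs)
  monic-representation zero t =
    [] , ≡.refl , coeffs λ { zero → coeff-top t ; (suc k) → coeff-≈0 (above t) (suc k) (s≤s z≤n) }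
  monic-representation {[]} (suc d) t
    with monic-representation {[]} d (top (coeff-top t) (bounded λ _ _ → K.refl))
  ... | cs , len , eq = K.0# ∷ cs , ≡.cong suc len , ≋-sym ([]≋0∷ (≋-sym eq))
  monic-representation {x ∷ p} (suc d) t
    with monic-representation {p} d (top (coeff-top t) (bounded λ k d<k → coeff-≈0 (above t) (suc k) (s≤s d<k)))
  ... | cs , len , eq = x ∷ cs , ≡.cong suc len , ∷-cong K.refl eq

  -- Each coefficient contributes one factor b (X² + 1) to the top term; the other summand has
  -- degree at most d, below 2 d.
  homogenize-Top : ∀ cs → Top (homogenize cs) (length cs ℕ.* 2) (b K.^ length cs)
  homogenize-Top []       = Top-const K.1#
  homogenize-Top (x ∷ cs) = Top-cong
    (Poly.+-comm (const b * (X * X + const K.1#) * homogenize cs) (const x * X Poly.^ suc l))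
    (K.*-congʳ (K.trans (K.*-congˡ (K.*-identityʳ K.1#)) (K.*-identityʳ b)))
    (Top-+ (Top-* (Top-* (Top-const b) (Top-+ (Top-* X-Top X-Top) (deg<-mono (s≤s z≤n) (above (Top-const K.1#)))))
                  (homogenize-Top cs))
           (deg<-mono (s≤s (s≤s (ℕ.m≤m*n l 2))) (above (Top-* (Top-const x) (Top-X^ (suc l))))))
    where
    l = length cs
    X-Top : Top X 1 K.1#
    X-Top = Top-∷ K.0# (Top-const K.1#)

  module _ {d ℓ₂} (L : CommutativeRing d ℓ₂) {φ : K.Carrier → CommutativeRing.Carrier L}
    (hom : RingHomomorphism.IsRingHomomorphism K L φ) where
    private
      module φ = RingHomomorphism.Properties K L hom
    open CommutativeRingTheory L using (_≈_; 0#; 1#; refl; sym; trans; setoid)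
    private module L = CommutativeRingTheory L
    open Evaluation K L hom
    open RingSolver L

    eval-∷ : ∀ y x cs → eval y (homogenize (x ∷ cs)) ≈
      φ x L.* y L.^ suc (length cs) L.+ φ b L.* (y L.* y L.+ 1#) L.* eval y (homogenize cs)
    eval-∷ y x cs = begin
      eval y (const x * X Poly.^ l + const b * (X * X + const K.1#) * homogenize cs)
        ≈⟨ E.+-homo (const x * X Poly.^ l) (const b * (X * X + const K.1#) * homogenize cs) ⟩
      eval y (const x * X Poly.^ l) L.+ eval y (const b * (X * X + const K.1#) * homogenize cs)
        ≈⟨ L.+-cong (E.*-homo (const x) (X Poly.^ l)) (E.*-homo (const b * (X * X + const K.1#)) (homogenize cs)) ⟩
      eval y (const x) L.* eval y (X Poly.^ l) L.+ eval y (const b * (X * X + const K.1#)) L.* eval y (homogenize cs)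
        ≈⟨ L.+-cong (L.*-cong (eval-const y x) (trans (E.^-homo X l) (L.^-congˡ l (eval-X y))))
                    (L.*-congʳ (trans (E.*-homo (const b) (X * X + const K.1#)) (L.*-cong (eval-const y b)
                      (trans (E.+-homo (X * X) (const K.1#)) (L.+-cong
                        (trans (E.*-homo X X) (L.*-cong (eval-X y) (eval-X y))) (trans (eval-const y K.1#) φ.1#-homo)))))) ⟩
      φ x L.* y L.^ l L.+ φ b L.* (y L.* y L.+ 1#) L.* eval y (homogenize cs)  ∎
      where
      open Relation.Binary.Reasoning.Setoid setoid
      l = suc (length cs)
      module E = RingHomomorphism.Properties commutativeRing L (eval-homomorphism y)

    -- As y w = 1, b (y² + 1) = y · b (y + w), so every step of Horner's scheme for p at b (y + w)
    -- is multiplied by y.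
    eval-homogenize : ∀ {y w} → y L.* w ≈ 1# → ∀ cs →
      eval y (homogenize cs) ≈ y L.^ length cs L.* eval (φ b L.* (y L.+ w)) (monic cs)
    eval-homogenize {y} {w} yw≈1 []       = trans (eval-const y K.1#)
      (sym (trans (L.*-identityˡ _) (eval-const _ K.1#)))
    eval-homogenize {y} {w} yw≈1 (x ∷ cs) = begin
      eval y (homogenize (x ∷ cs))
        ≈⟨ eval-∷ y x cs ⟩
      φ x L.* (y L.* Y) L.+ φ b L.* (y L.* y L.+ 1#) L.* eval y (homogenize cs)
        ≈⟨ L.+-congˡ (L.*-cong (L.*-congˡ (L.+-congˡ (sym yw≈1))) (eval-homogenize yw≈1 cs)) ⟩
      φ x L.* (y L.* Y) L.+ φ b L.* (y L.* y L.+ y L.* w) L.* (Y L.* p)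
        ≈⟨ solve 6 (λ x y w Y b p → x :* (y :* Y) :+ b :* (y :* y :+ y :* w) :* (Y :* p)
                                 := (y :* Y) :* (x :+ (b :* (y :+ w)) :* p)) refl (φ x) y w Y (φ b) p ⟩
      (y L.* Y) L.* (φ x L.+ φ b L.* (y L.+ w) L.* p)  ∎
      where
      open Relation.Binary.Reasoning.Setoid setoid
      Y = y L.^ length cs
      p = eval (φ b L.* (y L.+ w)) (monic cs)

    -- For invertible b the value at 0 is nonzero, so that every root of the homogenized polynomial
    -- in a field has an inverse.
    eval-homogenize-0 : ∀ {y} → y ≈ 0# → ∀ cs → eval y (homogenize cs) ≈ φ b L.^ length cs
    eval-homogenize-0 {y} y≈0 []       = trans (eval-const y K.1#) φ.1#-homo
    eval-homogenize-0 {y} y≈0 (x ∷ cs) = begin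
      eval y (homogenize (x ∷ cs))
        ≈⟨ eval-∷ y x cs ⟩
      φ x L.* (y L.* Y) L.+ φ b L.* (y L.* y L.+ 1#) L.* eval y (homogenize cs)
        ≈⟨ L.+-cong (L.*-congˡ (L.*-congʳ y≈0)) (L.*-cong (L.*-congˡ (L.+-congʳ (L.*-congʳ y≈0))) (eval-homogenize-0 y≈0 cs)) ⟩
      φ x L.* (0# L.* Y) L.+ φ b L.* (0# L.* y L.+ 1#) L.* φ b L.^ length cs
        ≈⟨ solve 5 (λ x y Y b p → x :* (con (ℤ.+ 0) :* Y) :+ b :* (con (ℤ.+ 0) :* y :+ con (ℤ.+ 1)) :* p := b :* p)
             refl (φ x) y Y (φ b) (φ b L.^ length cs) ⟩
      φ b L.* φ b L.^ length cs  ∎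
      where
      open Relation.Binary.Reasoning.Setoid setoid
      Y = y L.^ length cs

record RootExtension {c ℓ} (K : CommutativeRing c ℓ) (b : CommutativeRing.Carrier K)
  (p : List (CommutativeRing.Carrier K)) : Set (lsuc (c ⊔ ℓ)) where
  field
    L : CommutativeRing c (c ⊔ ℓ)
  open CommutativeRing L using (Carrier; _≈_; _*_; _+_; 0#; 1#)
  field
    isField         : IsField L
    1≉0             : ¬ (1# ≈ 0#)
    embedding       : CommutativeRing.Carrier K → Carrier
    isHomomorphism  : RingHomomorphism.IsRingHomomorphism K L embedding
    y w             : Carrier
    y*w≈1           : y * w ≈ 1#
    root            : Evaluation.eval K L isHomomorphism (embedding b * (y + w)) p ≈ 0#

module _ {c ℓ q} (𝔽 : FiniteField c ℓ q) where
  private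
    module K where
      open CommutativeRingTheory (FiniteField.commutativeRing 𝔽) public
      open FiniteField 𝔽 using (commutativeRing; 1≉0) public
      open Enumerated 𝔽 public
    K-isDomain = Field.isDomain K.commutativeRing K.isField K.1≉0
    open PolynomialRing K.commutativeRing
    open Degree K.commutativeRing
    open FieldExtension K.commutativeRing K.isField K.1≉0

  rootExtension : ∀ {b b′ p d} → b K.* b′ K.≈ K.1# → 0 ℕ.< d → Top p d K.1# → RootExtension K.commutativeRing b p
  rootExtension {b} {b′} {p} {d} bb′≈1 0<d p-Top
    with Homogenization.monic-representation K.commutativeRing b d p-Top
  ... | cs , ≡.refl , p≋cs
    with minimalMonicFactor K.search (ℕ.*-monoˡ-< 2 0<d) (Homogenization.homogenize-Top K.commutativeRing b cs) b^d-unit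
    where
    b^d-unit : b K.^ length cs K.* b′ K.^ length cs K.≈ K.1#
    b^d-unit = K.trans (K.sym (K.^-distrib-* b b′ (length cs))) (K.trans (K.^-congˡ (length cs) bb′≈1)
      (Order.1^n≈1 K.commutativeRing (length cs)))
  ... | m , g , 0<m , factor@(_ , s , sg≋h) , minimal = extension (L-isField X)
    where
    module Poly = CommutativeRing commutativeRing
    module H = Homogenization K.commutativeRing b
    L = residueField 0<m factor minimal
    L-isField = residueField-isField 0<m factor minimal
    L-1≉0 = residueField-1≉0 0<m factor minimal
    module L where
      open CommutativeRingTheory L public
      open Quotient commutativeRing g using (≈⇒≈; congruent) public
      open Domain L (Field.isDomain L L-isField L-1≉0) public
    j-hom : RingHomomorphism.IsRingHomomorphism K.commutativeRing L const
    j-hom = RingHomomorphism.ringHomomorphism K.commutativeRing L const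
      (λ x≈y → L.≈⇒≈ (∷-cong x≈y ≋-refl)) (λ _ _ → L.refl)
      (λ x y → L.≈⇒≈ (≋-sym (const-* x (const y)))) L.refl
    open Evaluation K.commutativeRing L j-hom
    open Relation.Binary.Reasoning.Setoid L.setoid

    -- In K[X]/(g) every polynomial is its own value at the class of X; thus g ∣ h makes X a root of
    -- h.
    eval-X≈ : ∀ p → eval X p L.≈ p
    eval-X≈ []      = L.refl
    eval-X≈ (x ∷ p) = L.trans (L.+-congˡ {const x} (L.*-congˡ {X} (eval-X≈ p)))
      (L.≈⇒≈ (≋-trans (+-cong {p = const x} ≋-refl (X-* p)) (∷-cong (K.+-identityʳ x) ≋-refl)))

    h≈0 : eval X (H.homogenize cs) L.≈ []
    h≈0 = L.trans (eval-X≈ (H.homogenize cs))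
      (L.congruent s (≋-trans sg≋h (≋-sym (Poly.+-identityʳ (H.homogenize cs)))))

    b≉0 : ¬ (const b L.≈ [])
    b≉0 b≈0 = L-1≉0 (begin
      const K.1#               ≈⟨ L.≈⇒≈ (∷-cong (K.sym bb′≈1) ≋-refl) ⟩
      const (b K.* b′)         ≈⟨ L.≈⇒≈ (≋-sym (const-* b (const b′))) ⟩
      const b * const b′       ≈⟨ L.*-congʳ {const b′} b≈0 ⟩
      []                       ∎)

    nonzero^ : ∀ {x} → ¬ (x L.≈ []) → ∀ n → ¬ (x L.^ n L.≈ [])
    nonzero^ x≉0 zero    = L-1≉0
    nonzero^ x≉0 (suc n) = x≉0 ∘ L.^-≈0 n

    extension : X L.≈ [] ⊎ ∃[ w ] (X L.* w L.≈ L.1#) → RootExtension K.commutativeRing b p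
    extension (inj₁ X≈0) = contradiction
      (L.trans (L.sym (H.eval-homogenize-0 L j-hom X≈0 cs)) h≈0) (nonzero^ b≉0 (length cs))
    extension (inj₂ (w , Xw≈1)) = record
      { L = L ; isField = L-isField ; 1≉0 = L-1≉0 ; embedding = const ; isHomomorphism = j-hom
      ; y = X ; w = w ; y*w≈1 = Xw≈1 ; root = root≈0 }
      where
      x = const b L.* (X L.+ w)
      X≉0 : ¬ (X L.≈ [])
      X≉0 = Field.unit≉0 L L-isField L-1≉0 Xw≈1
      root≈0 : eval x p L.≈ []
      root≈0 = [ (λ X^≈0 → contradiction X^≈0 (nonzero^ X≉0 (length cs))) , id ]′
        (Field.isDomain L L-isField L-1≉0 (X L.^ length cs) (eval x p) (begin
          X L.^ length cs L.* eval x p              ≈⟨ L.*-congˡ {X L.^ length cs} (eval-cong {x} {x} L.refl p≋cs) ⟩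
          X L.^ length cs L.* eval x (H.monic cs)   ≈⟨ H.eval-homogenize L j-hom Xw≈1 cs ⟨
          eval X (H.homogenize cs)                  ≈⟨ h≈0 ⟩
          []                                        ∎))

-- Arithmetic of q and evaluation at x

parity : ∀ k → (∃[ j ] (k ≡ j ℕ.* 2)) ⊎ (∃[ j ] (k ≡ suc (j ℕ.* 2)))
parity zero    = inj₁ (0 , ≡.refl)
parity (suc k) with parity k
... | inj₁ (j , eq) = inj₂ (j , ≡.cong suc eq)
... | inj₂ (j , eq) = inj₁ (suc j , ≡.cong suc eq)

-- Takes L, y and w as abstract data, so that the argument about y does not see the construction of
-- L as a residue field.
record Setting c ℓ c′ ℓ′ d ℓ″ : Set (lsuc (c ⊔ ℓ ⊔ c′ ⊔ ℓ′ ⊔ d ⊔ ℓ″)) where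
  field
    q            : ℕ
    𝔽q           : FiniteField c ℓ q
    𝔽q²          : FiniteField c′ ℓ′ (q ℕ.^ 2)
  module F = FiniteField 𝔽q
  module K = FiniteField 𝔽q²
  field
    ι            : F.Carrier → K.Carrier
    ι-hom        : RingMorphisms.IsRingHomomorphism F.rawRing K.rawRing ι
    isPrimePower : IsPrimePower q
    q%4≡3        : q ℕ.% 4 ≡ 3
    a b          : F.Carrier
    b≉0          : ¬ (b F.≈ F.0#)
    b²≈a         : b F.^ 2 F.≈ a
    n            : ℕ
    0<n          : 0 ℕ.< n
    rad-n∣q-1    : rad n ∣.∣ q ℕ.∸ 1
    L            : CommutativeRing d ℓ″
  module L = CommutativeRing L
  field
    L-isField    : IsField L
    L-1≉0        : ¬ (L.1# L.≈ L.0#)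
    j            : K.Carrier → L.Carrier
    j-hom        : RingHomomorphism.IsRingHomomorphism K.commutativeRing L j
    y w          : L.Carrier
    yw≈1         : y L.* w L.≈ L.1#

module DicksonFactor {c ℓ c′ ℓ′ d ℓ″} (S : Setting c ℓ c′ ℓ′ d ℓ″) where
  open Setting S hiding (module F; module K; module L)
  private
    module F where
      open CommutativeRingTheory (FiniteField.commutativeRing 𝔽q) public
      open FiniteField 𝔽q using (commutativeRing; 1≉0) public
      open Enumerated 𝔽q public
      isDomain = Field.isDomain commutativeRing isField 1≉0
    module K where
      open CommutativeRingTheory (FiniteField.commutativeRing 𝔽q²) public
      open FiniteField 𝔽q² using (commutativeRing; 1≉0; _⁻¹; *-inverseʳ) public
      open Enumerated 𝔽q² public
      isDomain = Field.isDomain commutativeRing isField 1≉0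
    module F[X] where
      open PolynomialRing F.commutativeRing public
    module K[X] where
      open PolynomialRing K.commutativeRing public
    open CommutativeRingTheory L
    open Field L L-isField L-1≉0 using (isDomain; _≈?_; unit≉0)
    open Domain L isDomain
    open Order L
    open RingSolver L
    open Relation.Binary.Reasoning.Setoid setoid
    open Arithmetic

    module ι = RingHomomorphism.Properties F.commutativeRing K.commutativeRing ι-hom
    module j = RingHomomorphism.Properties K.commutativeRing L j-hom

    φ : F.Carrier → Carrier
    φ x = j (ι x)

    φ-hom : RingHomomorphism.IsRingHomomorphism F.commutativeRing L φ
    φ-hom = Composition.isRingHomomorphism trans ι-hom j-hom

    module φ = RingHomomorphism.Properties F.commutativeRing L φ-hom
    module Eval = Evaluation F.commutativeRing L φ-hom
    open Eval using (eval)
    open Dickson F.commutativeRing a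
    open Degree F.commutativeRing

    d′ e : ℕ
    d′ = q ℕ.∸ 1
    e  = q ℕ.^ 2 ℕ.∸ 1

    s : ℕ
    s = proj₁ (%4≡3⇒ {q} q%4≡3)

    q≡ : q ≡ 3 ℕ.+ s ℕ.* 4
    q≡ = proj₂ (%4≡3⇒ {q} q%4≡3)

    1<q : 1 ℕ.< q
    1<q = ≡.subst (1 ℕ.<_) (≡.sym q≡) (s≤s (s≤s z≤n))

    0<q : 0 ℕ.< q
    0<q = ℕ.<⇒≤ 1<q

    d′≡ : d′ ≡ suc (s ℕ.* 2) ℕ.* 2
    d′≡ = ≡.trans (≡.cong (ℕ._∸ 1) q≡) (lemma s)
      where
      lemma : ∀ s → 2 ℕ.+ s ℕ.* 4 ≡ suc (s ℕ.* 2) ℕ.* 2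
      lemma = solve-∀

    q≡1+d′ : q ≡ suc d′
    q≡1+d′ = ≡.sym (ℕ.suc-pred q {{ℕ.>-nonZero 0<q}})

    q²≡ : q ℕ.^ 2 ≡ suc (d′ ℕ.* (q ℕ.+ 1))
    q²≡ = ≡.trans (≡.cong (ℕ._^ 2) q≡1+d′) (≡.trans (lemma d′) (≡.cong (λ q → suc (d′ ℕ.* (q ℕ.+ 1))) (≡.sym q≡1+d′)))
      where
      lemma : ∀ d → suc d ℕ.* (suc d ℕ.* 1) ≡ suc (d ℕ.* (suc d ℕ.+ 1))
      lemma = solve-∀

    e≡ : e ≡ d′ ℕ.* (q ℕ.+ 1)
    e≡ = ≡.cong (ℕ._∸ 1) q²≡

    q²≡1+e : q ℕ.^ 2 ≡ suc e
    q²≡1+e = ≡.trans q²≡ (≡.cong suc (≡.sym e≡))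

    d′∣e : d′ ∣.∣ e
    d′∣e = ≡.subst (d′ ∣.∣_) (≡.sym e≡) (∣.m∣m*n (q ℕ.+ 1))

    0<d′ : 0 ℕ.< d′
    0<d′ = ≡.subst (0 ℕ.<_) (≡.sym d′≡) (s≤s z≤n)

    0<e : 0 ℕ.< e
    0<e = ≡.subst (0 ℕ.<_) (≡.sym e≡) (ℕ.*-mono-< {0} {d′} {0} {q ℕ.+ 1} 0<d′ (ℕ.m≤n⇒m≤o+n q (s≤s z≤n)))

    4∣e : 4 ∣.∣ e
    4∣e = ≡.subst (4 ∣.∣_) (≡.sym e≡) (∣.∣n⇒∣m*n d′ (divides (suc s) (≡.trans (≡.cong (ℕ._+ 1) q≡) (lemma s))))
      where
      lemma : ∀ s → 3 ℕ.+ s ℕ.* 4 ℕ.+ 1 ≡ suc s ℕ.* 4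
      lemma = solve-∀

    1<q² : 1 ℕ.< q ℕ.^ 2
    1<q² = ≡.subst (1 ℕ.<_) (≡.sym q²≡1+e) (s≤s 0<e)

    module F⊂K = FixedField 𝔽q 1<q K.commutativeRing K.isDomain K.1≉0 K._≈?_ ι-hom
    module K⊂L = FixedField 𝔽q² 1<q² L isDomain L-1≉0 _≈?_ j-hom
    module F⊂L = FixedField 𝔽q 1<q L isDomain L-1≉0 _≈?_ φ-hom

    p k₀ : ℕ
    p  = proj₁ isPrimePower
    k₀ = proj₁ (proj₂ isPrimePower)

    p-prime : Prime p
    p-prime = proj₁ (proj₂ (proj₂ isPrimePower))

    q≡p^k₀ : q ≡ p ℕ.^ k₀
    q≡p^k₀ = proj₂ (proj₂ (proj₂ (proj₂ isPrimePower)))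

    p·1≈0 : p F.· F.1# F.≈ F.0#
    p·1≈0 = prime-characteristic F.commutativeRing F.isDomain F.1≉0 p k₀
      (≡.subst (λ m → m F.· F.1# F.≈ F.0#) q≡p^k₀ F.q·1≈0)

    -- Stated for every ring that receives a homomorphism from 𝔽q, because Frobenius is used in K as
    -- well as in L; the characteristic is transported along ψ.
    additive : ∀ {r ℓr} (R : CommutativeRing r ℓr) {ψ : F.Carrier → CommutativeRing.Carrier R} →
      RingHomomorphism.IsRingHomomorphism F.commutativeRing R ψ → Frobenius.IsAdditivePower R q
    additive R {ψ} ψ-hom = ≡.subst (Frobenius.IsAdditivePower R) (≡.sym q≡p^k₀)
      (Frobenius.isAdditivePower-^ R {p} (Frobenius.prime⇒isAdditivePower R p-prime p·1≈0′) k₀)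
      where
      module R = CommutativeRingTheory R
      module ψ = RingHomomorphism.Properties F.commutativeRing R ψ-hom
      p·1≈0′ : p R.· R.1# R.≈ R.0#
      p·1≈0′ = R.trans (R.×-congʳ p (R.sym ψ.1#-homo))
        (R.trans (R.sym (ψ.×-homo p F.1#)) (R.trans (ψ.⟦⟧-cong p·1≈0) ψ.0#-homo))

    L-additive = additive L φ-hom
    K-additive = additive K.commutativeRing ι-hom
    module Frob = RingHomomorphism.Properties K.commutativeRing K.commutativeRing
      (Frobenius.power-homomorphism K.commutativeRing 0<q K-additive)
    module Minimal = MinimalPolynomial 𝔽q L isDomain 0<q L-additive φ-hom F⊂L.injective

    -- q - 1 is even, so 1 = - 1 would give 1 = q · 1 = 0.
    1≉-1 : ¬ (1# ≈ - 1#)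
    1≉-1 1≈-1 = L-1≉0 (begin
      1#                    ≈⟨ +-identityʳ 1# ⟨
      1# + 0#               ≈⟨ +-congˡ (Frobenius.∣⇒·≈0 L {2} 2·1≈0 (divides (suc (s ℕ.* 2)) d′≡) 1#) ⟨
      suc d′ · 1#           ≡⟨ ≡.cong (_· 1#) q≡1+d′ ⟨
      q · 1#                ≈⟨ trans (×-congʳ q (sym φ.1#-homo)) (sym (φ.×-homo q F.1#)) ⟩
      φ (q F.· F.1#)        ≈⟨ trans (φ.⟦⟧-cong F.q·1≈0) φ.0#-homo ⟩
      0#                    ∎)
      where
      2·1≈0 : 2 · 1# ≈ 0#
      2·1≈0 = trans (+-congʳ 1≈-1) (trans (+-congˡ (+-identityʳ 1#)) (-‿inverseˡ 1#))

    β u v x : Carrier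
    β = φ b
    u = β * y
    v = β * w
    x = β * (y + w)

    β≉0 : ¬ (β ≈ 0#)
    β≉0 β≈0 = b≉0 (F⊂L.injective (trans β≈0 (sym φ.0#-homo)))

    nonzero^ : ∀ {z} → ¬ (z ≈ 0#) → ∀ k → ¬ (z ^ k ≈ 0#)
    nonzero^ z≉0 zero    = L-1≉0
    nonzero^ z≉0 (suc k) = z≉0 ∘ ^-≈0 k

    uv≈a : u * v ≈ φ a
    uv≈a = begin
      β * y * (β * w)       ≈⟨ solve 3 (λ b y w → b :* y :* (b :* w) := b :* (b :* con (ℤ.+ 1)) :* (y :* w)) refl β y w ⟩
      β * (β * 1#) * (y * w)  ≈⟨ *-cong (sym (φ.^-homo b 2)) yw≈1 ⟩
      φ (b F.^ 2) * 1#      ≈⟨ trans (*-identityʳ _) (φ.⟦⟧-cong b²≈a) ⟩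
      φ a                   ∎

    y^w^≈1 : ∀ k → y ^ k * w ^ k ≈ 1#
    y^w^≈1 k = trans (sym (^-distrib-* y w k)) (trans (^-congˡ k yw≈1) (1^n≈1 k))

    eval-D-x : ∀ k → eval x (D k) ≈ β ^ k * (y ^ k + w ^ k)
    eval-D-x k = begin
      eval x (D k)                       ≈⟨ Eval.eval-cong {p = D k} (distribˡ β y w) F[X].≋-refl ⟩
      eval (u + v) (D k)                 ≈⟨ eval-D L φ-hom uv≈a k ⟩
      u ^ k + v ^ k                      ≈⟨ +-cong (^-distrib-* β y k) (^-distrib-* β w k) ⟩
      β ^ k * y ^ k + β ^ k * w ^ k      ≈⟨ distribˡ _ _ _ ⟨
      β ^ k * (y ^ k + w ^ k)            ∎

  -- The integer t and the element α

  module _ (y^2n≈-1 : y ^ (2 ℕ.* n) ≈ - 1#) where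
    private
      y^4n≈1 : y ^ (4 ℕ.* n) ≈ 1#
      y^4n≈1 = begin
        y ^ (4 ℕ.* n)                   ≡⟨ ≡.cong (y ^_) (lemma n) ⟩
        y ^ (2 ℕ.* n ℕ.* 2)             ≈⟨ ^-assocʳ y (2 ℕ.* n) 2 ⟨
        (y ^ (2 ℕ.* n)) ^ 2             ≈⟨ ^-congˡ 2 y^2n≈-1 ⟩
        (- 1#) ^ 2                      ≈⟨ solve 0 (:- con (ℤ.+ 1) :* (:- con (ℤ.+ 1) :* con (ℤ.+ 1)) := con (ℤ.+ 1)) refl ⟩
        1#                              ∎
        where
        lemma : ∀ n → 4 ℕ.* n ≡ 2 ℕ.* n ℕ.* 2
        lemma = solve-∀

      -- An odd power of y^2n = -1 is again -1. All parity contradictions about exponents of y rest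
      -- on this.
      no-odd : ∀ i → ¬ (y ^ (n ℕ.* (suc (i ℕ.* 2) ℕ.* 2)) ≈ 1#)
      no-odd i eq = 1≉-1 (begin
        1#                                       ≈⟨ eq ⟨
        y ^ (n ℕ.* (suc (i ℕ.* 2) ℕ.* 2))        ≡⟨ ≡.cong (y ^_) (lemma n (suc (i ℕ.* 2))) ⟩
        y ^ (2 ℕ.* n ℕ.* suc (i ℕ.* 2))          ≈⟨ ^-assocʳ y (2 ℕ.* n) _ ⟨
        (y ^ (2 ℕ.* n)) ^ suc (i ℕ.* 2)          ≈⟨ ^-congˡ (suc (i ℕ.* 2)) y^2n≈-1 ⟩
        (- 1#) ^ suc (i ℕ.* 2)                   ≈⟨ -1^odd i ⟩
        - 1#                                     ∎)
        where
        lemma : ∀ n m → n ℕ.* (m ℕ.* 2) ≡ 2 ℕ.* n ℕ.* m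
        lemma = solve-∀

      no-odd′ : ∀ i → ¬ (y ^ (suc (i ℕ.* 2) ℕ.* 2) ≈ 1#)
      no-odd′ i eq = no-odd i (^≈1-∣ (∣.n∣m*n n) eq)

      y^en≈1 : y ^ (e ℕ.* n) ≈ 1#
      y^en≈1 = ^≈1-∣ (∣.*-monoˡ-∣ n 4∣e) y^4n≈1

      toζ : ∀ {k} → y ^ (e ℕ.* k) ≈ 1# → (y ^ e) ^ k ≈ 1#
      toζ {k} = trans (^-assocʳ y e k)

    -- A nonzero z in L lies in K exactly if z^(q² - 1) = 1, so the least t > 0 with y^t in K is the
    -- order of y^e. Being an order, it divides every k with y^(e k) = 1, in particular n.
    t-order : ∃ (IsLeastPositive (λ k → (y ^ e) ^ k ≈ 1#))
    t-order = least-positive (λ k → ((y ^ e) ^ k) ≈? 1#) 0<n (toζ {n} y^en≈1)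

    module _ {t} (t-isOrder : IsLeastPositive (λ k → (y ^ e) ^ k ≈ 1#) t) where
      private
        0<t : 0 ℕ.< t
        0<t = proj₁ t-isOrder

        t∣ : ∀ {k} → y ^ (e ℕ.* k) ≈ 1# → t ∣.∣ k
        t∣ {k} eq = order∣ t-isOrder (toζ {k} eq)

        y^et≈1 : y ^ (e ℕ.* t) ≈ 1#
        y^et≈1 = trans (sym (^-assocʳ y e t)) (proj₁ (proj₂ t-isOrder))

        t∣n : t ∣.∣ n
        t∣n = t∣ y^en≈1

        r∣t⇒r∣d′ : ∀ {r} → Prime r → r ∣.∣ t → r ∣.∣ d′
        r∣t⇒r∣d′ pr r∣t = ∣.∣-trans (prime∣⇒∣rad 0<n pr (∣.∣-trans r∣t t∣n)) rad-n∣q-1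

        no-smaller : ∀ {r} t′ → Prime r → t ≡ t′ ℕ.* r → ¬ (y ^ (e ℕ.* t′) ≈ 1#)
        no-smaller {r} t′ pr t≡t′r eq = ℕ.<⇒≱ t′<t (∣.∣⇒≤ {{ℕ.>-nonZero 0<t′}} (t∣ eq))
          where
          0<t′ : 0 ℕ.< t′
          0<t′ = ℕ.n≢0⇒n>0 λ t′≡0 → ℕ.<⇒≢ 0<t (≡.sym (≡.trans t≡t′r (≡.cong (ℕ._* r) t′≡0)))
          t′<t : t′ ℕ.< t
          t′<t = ≡.subst (t′ ℕ.<_) (≡.sym t≡t′r)
            (ℕ.m<m*n t′ r {{ℕ.>-nonZero 0<t′}} (ℕ.nonTrivial⇒n>1 r {{prime⇒nonTrivial pr}}))

        Y = y ^ t

        Y^q²≈Y : Y ^ (q ℕ.^ 2) ≈ Y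
        Y^q²≈Y = begin
          Y ^ (q ℕ.^ 2)      ≡⟨ ≡.cong (Y ^_) q²≡1+e ⟩
          Y * Y ^ e          ≈⟨ *-congˡ (^-assocʳ y t e) ⟩
          Y * y ^ (t ℕ.* e)  ≡⟨ ≡.cong (λ k → Y * y ^ k) (ℕ.*-comm t e) ⟩
          Y * y ^ (e ℕ.* t)  ≈⟨ trans (*-congˡ y^et≈1) (*-identityʳ Y) ⟩
          Y                  ∎

      -- For g = gcd(4 n, e) the exponent e · (4 n / g) = (e / g) · 4 n takes y to 1.
      t∣4n÷gcd : t ∣.∣ (4 ℕ.* n) ÷ gcd (4 ℕ.* n) e
      t∣4n÷gcd = go (gcd[m,n]∣m (4 ℕ.* n) e)
        where
        g = gcd (4 ℕ.* n) e
        0<g : 0 ℕ.< g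
        0<g = ℕ.n≢0⇒n>0 λ g≡0 → ℕ.<⇒≢ (ℕ.*-monoʳ-< 4 0<n) (≡.sym (gcd[m,n]≡0⇒m≡0 g≡0))
        go : g ∣.∣ 4 ℕ.* n → t ∣.∣ (4 ℕ.* n) ÷ g
        go (divides k 4n≡kg) = ≡.subst (t ∣.∣_) (≡.sym (≡.trans (≡.cong (_÷ g) 4n≡kg) (÷-* k 0<g)))
          (t∣ (^≈1-∣ (≡.subst₂ ∣._∣_ (≡.sym 4n≡kg) (ℕ.*-comm k e) (∣.*-monoʳ-∣ k (gcd[m,n]∣n (4 ℕ.* n) e))) y^4n≈1))

      α-exists : ∃[ α ] (j α ≈ y ^ t)
      α-exists = K⊂L.fixed⇒∈image Y^q²≈Y

      module _ {α} (jα≈ : j α ≈ y ^ t) where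
        private
          jα^ : ∀ k → j (α K.^ k) ≈ y ^ (t ℕ.* k)
          jα^ k = trans (j.^-homo α k) (trans (^-congˡ k jα≈) (^-assocʳ y t k))

          α^≈1⇒ : ∀ {k} → α K.^ k K.≈ K.1# → y ^ (t ℕ.* k) ≈ 1#
          α^≈1⇒ {k} eq = trans (sym (jα^ k)) (trans (j.⟦⟧-cong eq) j.1#-homo)

          ⇒α^≈1 : ∀ {k} → y ^ (t ℕ.* k) ≈ 1# → α K.^ k K.≈ K.1#
          ⇒α^≈1 {k} eq = K⊂L.injective (trans (jα^ k) (trans eq (sym j.1#-homo)))

        α≉0 : ¬ (α K.≈ K.0#)
        α≉0 α≈0 = unit≉0 (y^w^≈1 t) (trans (sym jα≈) (trans (j.⟦⟧-cong α≈0) j.0#-homo))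

        private
          α^e≈1 : α K.^ e K.≈ K.1#
          α^e≈1 = ⇒α^≈1 {e} (≡.subst (λ k → y ^ k ≈ 1#) (ℕ.*-comm e t) y^et≈1)

        α-order : ∃ (FiniteField.HasOrder 𝔽q² α)
        α-order = least-positive (λ k → (α K.^ k) K.≈? K.1#) 0<e α^e≈1

        module _ {o} (α-hasOrder : FiniteField.HasOrder 𝔽q² α o) where
          private
            o∣e : o ∣.∣ e
            o∣e = Order.order∣ K.commutativeRing α-hasOrder α^e≈1

            -- If r o ∣ e, then e · (t / r) is a multiple of t o, and y^(t o) = α^o = 1 contradicts
            -- the choice of t.
            r*o∤e : ∀ {r} → Prime r → r ∣.∣ t → ¬ (r ℕ.* o ∣.∣ e)
            r*o∤e {r} pr (divides t′ t≡t′r) (divides k e≡) = no-smaller t′ pr t≡t′r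
              (^≈1-∣ (divides k (≡.trans (≡.cong (ℕ._* t′) e≡) (≡.trans (lemma k r o t′) (≡.cong (λ t → k ℕ.* (t ℕ.* o)) (≡.sym t≡t′r)))))
                (α^≈1⇒ {o} (proj₁ (proj₂ α-hasOrder))))
              where
              lemma : ∀ k r o t′ → k ℕ.* (r ℕ.* o) ℕ.* t′ ≡ k ℕ.* (t′ ℕ.* r ℕ.* o)
              lemma = solve-∀

          -- If a prime r ∣ t did not divide o, then r and o would be coprime divisors of e, as r ∣
          -- q - 1; so r o ∣ e, which `r*o∤e` excludes.
          rad-t∣o : rad t ∣.∣ o
          rad-t∣o = rad∣ {t} {o} λ {r} pr r∣t → case-∣ pr r∣t (r ∣.∣? o)
            where
            case-∣ : ∀ {r} → Prime r → r ∣.∣ t → Dec (r ∣.∣ o) → r ∣.∣ o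
            case-∣ pr r∣t (yes r∣o) = r∣o
            case-∣ pr r∣t (no r∤o)  = contradiction
              (coprime-*∣ (prime∤⇒coprime pr r∤o) (∣.∣-trans (r∣t⇒r∣d′ pr r∣t) d′∣e) o∣e) (r*o∤e pr r∣t)

          -- A common prime r of t and e / o would give r o ∣ e.
          gcd-t : gcd t (e ÷ o) ≡ 1
          gcd-t = go o∣e
            where
            go : o ∣.∣ e → gcd t (e ÷ o) ≡ 1
            go (divides k e≡ko) = Coprime.coprime⇒gcd≡1 (primes⇒coprime λ {r} pr r∣t r∣e÷o → r*o∤e pr r∣t
              (≡.subst (r ℕ.* o ∣.∣_) (≡.sym e≡ko)
                (∣.*-monoˡ-∣ o (≡.subst (r ∣.∣_) (≡.trans (≡.cong (_÷ o) e≡ko) (÷-* k (proj₁ α-hasOrder))) r∣e÷o))))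

        α^[2n÷t]≈-1 : α K.^ ((2 ℕ.* n) ÷ t) K.≈ K.- K.1#
        α^[2n÷t]≈-1 with t∣n
        ... | divides k n≡kt = K⊂L.injective (begin
          j (α K.^ ((2 ℕ.* n) ÷ t))      ≈⟨ jα^ ((2 ℕ.* n) ÷ t) ⟩
          y ^ (t ℕ.* ((2 ℕ.* n) ÷ t))    ≡⟨ ≡.cong (λ m → y ^ (t ℕ.* m)) (≡.trans (≡.cong (_÷ t) 2n≡) (÷-* (2 ℕ.* k) 0<t)) ⟩
          y ^ (t ℕ.* (2 ℕ.* k))          ≡⟨ ≡.cong (y ^_) (≡.trans (ℕ.*-comm t (2 ℕ.* k)) (≡.sym 2n≡)) ⟩
          y ^ (2 ℕ.* n)                  ≈⟨ y^2n≈-1 ⟩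
          - 1#                           ≈⟨ trans (j.-‿homo K.1#) (-‿cong j.1#-homo) ⟨
          j (K.- K.1#)                   ∎)
          where
          2n≡ : 2 ℕ.* n ≡ 2 ℕ.* k ℕ.* t
          2n≡ = ≡.trans (≡.cong (2 ℕ.*_) n≡kt) (≡.sym (ℕ.*-assoc 2 k t))

        private
          y≉0 : ¬ (y ≈ 0#)
          y≉0 = unit≉0 yw≈1

          -- Otherwise α^(q - 1) = 1, and t ∣ n gives y^(n (q - 1)) = 1 with q - 1 = 2 (2 s + 1),
          -- against `no-odd`.
          α∉F : ¬ (∃[ z ] (ι z K.≈ α))
          α∉F (z , ιz≈α) = no-odd s (^≈1-∣ td′∣ (α^≈1⇒ {d′} α^d′≈1))
            where
            α^d′≈1 : α K.^ d′ K.≈ K.1#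
            α^d′≈1 = Domain.*-cancelˡ K.commutativeRing K.isDomain α≉0 (K.trans (K.reflexive (≡.cong (α K.^_) (≡.sym q≡1+d′)))
              (K.trans (K.^-congˡ q (K.sym ιz≈α)) (K.trans (F⊂K.fixed z) (K.trans ιz≈α (K.sym (K.*-identityʳ α))))))
            td′∣ : t ℕ.* d′ ∣.∣ n ℕ.* (suc (s ℕ.* 2) ℕ.* 2)
            td′∣ = ≡.subst (λ k → t ℕ.* d′ ∣.∣ n ℕ.* k) d′≡ (∣.*-monoˡ-∣ d′ t∣n)

          -- A prime r ∣ t divides q - 1, so e · (t / r) = ((q - 1) / r) · t (q + 1) would be a
          -- smaller exponent of the kind that defines t.
          t≡1 : α K.^ (q ℕ.+ 1) K.≈ K.1# → t ≡ 1
          t≡1 eq with t ℕ.≟ 1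
          ... | yes t≡1 = t≡1
          ... | no t≢1 with prime-divisor t t≢1
          ... | r , pr , r∣t@(divides t′ t≡t′r) with r∣t⇒r∣d′ pr r∣t
          ... | divides k d′≡kr = contradiction (^≈1-∣ (divides k et′≡) (α^≈1⇒ {q ℕ.+ 1} eq)) (no-smaller t′ pr t≡t′r)
            where
            lemma : ∀ k r q t′ → k ℕ.* r ℕ.* q ℕ.* t′ ≡ k ℕ.* (t′ ℕ.* r ℕ.* q)
            lemma = solve-∀
            et′≡ : e ℕ.* t′ ≡ k ℕ.* (t ℕ.* (q ℕ.+ 1))
            et′≡ = ≡.trans (≡.cong (ℕ._* t′) (≡.trans e≡ (≡.cong (ℕ._* (q ℕ.+ 1)) d′≡kr)))
              (≡.trans (lemma k r (q ℕ.+ 1) t′) (≡.cong (λ t → k ℕ.* (t ℕ.* (q ℕ.+ 1))) (≡.sym t≡t′r)))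

          -- Conjugates of y and of x

          power-fixed : ∀ {k m} → k ≡ suc m → y ^ k ≈ y → y ^ m ≈ 1#
          power-fixed {m = m} ≡.refl eq = *-cancelˡ y≉0 (trans eq (sym (*-identityʳ y)))

          q^odd : ∀ i → ∃[ k ] (q ℕ.^ suc (i ℕ.* 2) ≡ suc (suc (k ℕ.* 2) ℕ.* 2))
          q^odd i with ^-odd s i
          ... | k , eq = k , ≡.trans (≡.cong (ℕ._^ suc (i ℕ.* 2)) q≡) (≡.trans eq (lemma k))
            where
            lemma : ∀ k → 3 ℕ.+ k ℕ.* 4 ≡ suc (suc (k ℕ.* 2) ℕ.* 2)
            lemma = solve-∀

          q^even+1 : ∀ i → ∃[ k ] (suc (q ℕ.^ (i ℕ.* 2)) ≡ suc (k ℕ.* 2) ℕ.* 2)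
          q^even+1 i with ^-even s i
          ... | k , eq = k , ≡.trans (≡.cong (λ q → suc (q ℕ.^ (i ℕ.* 2))) q≡) (≡.trans (≡.cong suc eq) (lemma k))
            where
            lemma : ∀ k → suc (1 ℕ.+ k ℕ.* 4) ≡ suc (k ℕ.* 2) ℕ.* 2
            lemma = solve-∀

          q^even : ∀ i → q ℕ.^ (i ℕ.* 2) ≡ suc (e ℕ.* geometric e i)
          q^even i = ≡.trans (≡.cong (q ℕ.^_) (ℕ.*-comm i 2)) (≡.trans (≡.sym (ℕ.^-*-assoc q 2 i))
            (≡.trans (≡.cong (ℕ._^ i) q²≡1+e) (geometric-^ e i)))

          -- For odd k, q^k - 1 is twice an odd number. For k = 2 i, q^k - 1 = e · `geometric e i`,
          -- so t divides `geometric e i`, hence i, and 2 t ≤ k.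
          y-not-fixed : ∀ k → 0 ℕ.< k → k ℕ.< t ℕ.+ t → ¬ (y ^ (q ℕ.^ k) ≈ y)
          y-not-fixed k 0<k k<2t eq with parity k
          ... | inj₂ (i , ≡.refl) = let m , q^k≡ = q^odd i in no-odd′ m (power-fixed q^k≡ eq)
          ... | inj₁ (i , ≡.refl) = ℕ.<⇒≱ k<2t (≡.subst (t ℕ.+ t ℕ.≤_) (lemma i) (ℕ.+-mono-≤ t≤i t≤i))
            where
            lemma : ∀ i → i ℕ.+ i ≡ i ℕ.* 2
            lemma = solve-∀
            0<i : 0 ℕ.< i
            0<i = ℕ.n≢0⇒n>0 λ { ≡.refl → ℕ.<-irrefl ≡.refl 0<k }
            t≤i : t ℕ.≤ i
            t≤i = ∣.∣⇒≤ {{ℕ.>-nonZero 0<i}} (∣geometric⇒∣ 4∣e 0<t (λ pr r∣t → ∣.∣-trans (r∣t⇒r∣d′ pr r∣t) d′∣e)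
              (t∣ (power-fixed (q^even i) eq)))

          -- The primes of 4 n are 2 and those of n, and all of them divide q - 1.
          coprime-4n : ∀ m → Coprime (4 ℕ.* n) (1 ℕ.+ d′ ℕ.* m)
          coprime-4n m = primes⇒coprime λ {r} pr r∣4n r∣1+d′m → ¬prime[1] (≡.subst Prime
            (∣.∣1⇒≡1 (∣.∣m+n∣m⇒∣n (≡.subst (r ∣.∣_) (ℕ.+-comm 1 (d′ ℕ.* m)) r∣1+d′m) (∣.∣m⇒∣m*n m (r∣d′ pr r∣4n)))) pr)
            where
            2∣d′ : 2 ∣.∣ d′
            2∣d′ = divides (suc (s ℕ.* 2)) d′≡
            r∣d′ : ∀ {r} → Prime r → r ∣.∣ 4 ℕ.* n → r ∣.∣ d′
            r∣d′ pr r∣4n with euclidsLemma 4 n pr r∣4n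
            ... | inj₂ r∣n = ∣.∣-trans (prime∣⇒∣rad 0<n pr r∣n) rad-n∣q-1
            ... | inj₁ r∣4 = ∣.∣-trans ([ id , id ]′ (euclidsLemma 2 2 pr r∣4)) 2∣d′

          -- For even k, q^k + 1 is twice an odd number. For odd k, q^k + 1 = (q + 1)(1 + d′ m), and
          -- the order of y^(q + 1) divides the coprime numbers 4 n and 1 + d′ m; so y^(q + 1) = 1,
          -- and its t-th power gives α^(q + 1) = 1.
          y-not-inverted : ¬ (α K.^ (q ℕ.+ 1) K.≈ K.1#) → ∀ k → ¬ (y ^ suc (q ℕ.^ k) ≈ 1#)
          y-not-inverted α^≉1 k eq with parity k
          ... | inj₁ (i , ≡.refl) = let m , q^k+1≡ = q^even+1 i in no-odd′ m (trans (reflexive (≡.cong (y ^_) (≡.sym q^k+1≡))) eq)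
          ... | inj₂ (i , ≡.refl) = α^≉1 (⇒α^≈1 {q ℕ.+ 1} (^≈1-∣ (∣.n∣m*n t) y^[q+1]≈1))
            where
            m = proj₁ (odd-power+1 d′ i)
            q^k+1≡ : suc (q ℕ.^ suc (i ℕ.* 2)) ≡ (q ℕ.+ 1) ℕ.* (1 ℕ.+ d′ ℕ.* m)
            q^k+1≡ = ≡.trans (ℕ.+-comm 1 (q ℕ.^ suc (i ℕ.* 2)))
              (≡.trans (≡.cong (λ q → q ℕ.^ suc (i ℕ.* 2) ℕ.+ 1) q≡1+d′) (≡.trans (proj₂ (odd-power+1 d′ i))
                (≡.cong (λ q → (q ℕ.+ 1) ℕ.* (1 ℕ.+ d′ ℕ.* m)) (≡.sym q≡1+d′))))
            y^[q+1]≈1 : y ^ (q ℕ.+ 1) ≈ 1#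
            y^[q+1]≈1 = coprime-^≈1 _≈?_ (ℕ.*-monoʳ-< 4 0<n) (coprime-4n m)
              (trans (^-assocʳ y (q ℕ.+ 1) (4 ℕ.* n)) (^≈1-∣ (∣.n∣m*n (q ℕ.+ 1)) y^4n≈1))
              (trans (^-assocʳ y (q ℕ.+ 1) _) (trans (reflexive (≡.cong (y ^_) (≡.sym q^k+1≡))) eq))

          -- Two pairs of inverse elements with the same sum agree up to order: y′ + w′ = y + w and
          -- y′ w′ = y w = 1 give (y′ - y)(y′ y - 1) = 0.
          distinct : ¬ (α K.^ (q ℕ.+ 1) K.≈ K.1#) → ∀ k → 0 ℕ.< k → k ℕ.< t ℕ.+ t → ¬ (x ^ (q ℕ.^ k) ≈ x)
          distinct α^≉1 k 0<k k<2t eq =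
            [ (λ y′-y≈0 → y-not-fixed k 0<k k<2t (x∙y⁻¹≈ε⇒x≈y _ _ y′-y≈0))
            , (λ y′y-1≈0 → y-not-inverted α^≉1 k (trans (*-comm y _) (x∙y⁻¹≈ε⇒x≈y _ _ y′y-1≈0)))
            ]′ (isDomain (y′ - y) (y′ * y - 1#) product≈0)
            where
            y′ = y ^ (q ℕ.^ k)
            w′ = w ^ (q ℕ.^ k)
            y′+w′≈y+w : y′ + w′ ≈ y + w
            y′+w′≈y+w = *-cancelˡ β≉0 (begin
              β * (y′ + w′)                            ≈⟨ *-cong (Minimal.fixed k b) (Minimal.Power.+-homo k y w) ⟨
              β ^ (q ℕ.^ k) * (y + w) ^ (q ℕ.^ k)      ≈⟨ Minimal.Power.*-homo k β (y + w) ⟨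
              x ^ (q ℕ.^ k)                            ≈⟨ eq ⟩
              β * (y + w)                              ∎)
            product≈0 : (y′ - y) * (y′ * y - 1#) ≈ 0#
            product≈0 = begin
              (y′ - y) * (y′ * y - 1#)
                ≈⟨ solve 4 (λ z y w′ w → (z :- y) :* (z :* y :- con (ℤ.+ 1)) := z :* y :* ((z :+ w′) :- (y :+ w))
                     :- y :* (z :* w′ :- con (ℤ.+ 1)) :+ z :* (y :* w :- con (ℤ.+ 1))) refl y′ y w′ w ⟩
              y′ * y * ((y′ + w′) - (y + w)) - y * (y′ * w′ - 1#) + y′ * (y * w - 1#)
                ≈⟨ +-cong (+-cong (*-congˡ (x≈y⇒x∙y⁻¹≈ε y′+w′≈y+w)) (-‿cong (*-congˡ (x≈y⇒x∙y⁻¹≈ε (y^w^≈1 (q ℕ.^ k))))))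
                          (*-congˡ (x≈y⇒x∙y⁻¹≈ε yw≈1)) ⟩
              y′ * y * 0# - y * 0# + y′ * 0#
                ≈⟨ solve 2 (λ z y → z :* y :* con (ℤ.+ 0) :- y :* con (ℤ.+ 0) :+ z :* con (ℤ.+ 0) := con (ℤ.+ 0)) refl y′ y ⟩
              0#  ∎

          -- Polynomials over 𝔽q that vanish at x

          α⁻¹ : K.Carrier
          α⁻¹ = α K.⁻¹

          αα⁻¹≈1 : α K.* α⁻¹ K.≈ K.1#
          αα⁻¹≈1 = K.*-inverseʳ α≉0

          jα⁻¹≈ : j α⁻¹ ≈ w ^ t
          jα⁻¹≈ = begin
            j α⁻¹                       ≈⟨ *-identityʳ _ ⟨
            j α⁻¹ * 1#                  ≈⟨ *-congˡ (y^w^≈1 t) ⟨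
            j α⁻¹ * (y ^ t * w ^ t)     ≈⟨ *-congˡ (*-congʳ jα≈) ⟨
            j α⁻¹ * (j α * w ^ t)       ≈⟨ *-assoc _ _ _ ⟨
            j α⁻¹ * j α * w ^ t         ≈⟨ *-congʳ (trans (sym (j.*-homo α⁻¹ α)) (trans (j.⟦⟧-cong (K.trans (K.*-comm _ _) αα⁻¹≈1)) j.1#-homo)) ⟩
            1# * w ^ t                  ≈⟨ *-identityˡ _ ⟩
            w ^ t                       ∎

          -- The inverse is a separate argument because the conjugate constant pairs α^q with
          -- (α⁻¹)^q. Frobenius then acts on both arguments, as b^t is fixed.
          γ : K.Carrier → K.Carrier → K.Carrier
          γ β β⁻¹ = (ι b K.^ t) K.* (β K.+ β⁻¹)

          γ₁ γ₂ : K.Carrier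
          γ₁ = γ α α⁻¹
          γ₂ = γ (α K.^ q) (α⁻¹ K.^ q)

          γ^q : ∀ {β β⁻¹} → γ β β⁻¹ K.^ q K.≈ γ (β K.^ q) (β⁻¹ K.^ q)
          γ^q {β} {β⁻¹} = K.trans (Frob.*-homo _ _) (K.*-cong
            (K.trans (K.^-congˡ q (K.sym (ι.^-homo b t))) (K.trans (F⊂K.fixed (b F.^ t)) (ι.^-homo b t)))
            (Frob.+-homo β β⁻¹))

          γ₂^q : γ₂ K.^ q K.≈ γ₁
          γ₂^q = K.trans γ^q (K.*-congˡ (K.+-cong (q² α) (q² α⁻¹)))
            where
            q² : ∀ z → (z K.^ q) K.^ q K.≈ z
            q² z = K.trans (K.^-assocʳ z q q) (K.trans (K.reflexive (≡.cong (λ k → z K.^ (q ℕ.* k)) (≡.sym (ℕ.*-identityʳ q)))) (K.fermat z))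

          jγ₁≈ : j γ₁ ≈ eval x (D t)
          jγ₁≈ = begin
            j γ₁                               ≈⟨ j.*-homo _ _ ⟩
            j (ι b K.^ t) * j (α K.+ α⁻¹)      ≈⟨ *-cong (j.^-homo (ι b) t) (trans (j.+-homo α α⁻¹) (+-cong jα≈ jα⁻¹≈)) ⟩
            β ^ t * (y ^ t + w ^ t)            ≈⟨ eval-D-x t ⟨
            eval x (D t)                       ∎

          module F-Poly = CommutativeRingTheory F[X].commutativeRing
          module K-Poly = CommutativeRingTheory K[X].commutativeRing
          module EvalHom = RingHomomorphism.Properties F[X].commutativeRing L (Eval.eval-homomorphism x)
          module Map = RingHomomorphism.Properties F[X].commutativeRing K[X].commutativeRing
            (ChangeOfCoefficients.map-homomorphism F.commutativeRing K.commutativeRing ι-hom)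
          open K[X] using (_≋_; ≋-refl; ≋-sym; ≋-trans)

          D-Top′ : ∀ {k} → 0 ℕ.< k → Top (D k) k F.1#
          D-Top′ {suc k} _ = proj₁ (D-Top k)

          map-D : map ι (D t) ≋ map ι (F[X].P.dickson t a)
          map-D = Map.⟦⟧-cong (F[X].≋-sym (dickson≋D t 0<t))

          factor : K.Carrier → K.Carrier → K[X].Poly
          factor β β⁻¹ = map ι (F[X].P.dickson t a) K[X].P.- K[X].const (γ β β⁻¹)

        module _ {f m} (irr : F[X].P.Irreducible f) (f-Top : Top f m F.1#) (fx≈0 : eval x f ≈ 0#) where

          caseA : (∃[ z ] (ι z K.≈ α)) ⊎ (α K.^ (q ℕ.+ 1) K.≈ K.1#) → map ι f ≋ factor α α⁻¹
          caseA (inj₁ α∈F)        = contradiction α∈F α∉F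
          caseA (inj₂ α^[q+1]≈1) = ≋-trans (Map.⟦⟧-cong f≋g) (≋-trans (Map.+-homo (D t) (F[X].- F[X].const c₀))
            (K-Poly.+-cong map-D (≋-trans (Map.-‿homo (F[X].const c₀)) (K-Poly.-‿cong (K[X].∷-cong ιc≈ ≋-refl)))))
            where
            α^q≈α⁻¹ : α K.^ q K.≈ α⁻¹
            α^q≈α⁻¹ = Domain.*-cancelˡ K.commutativeRing K.isDomain α≉0
              (K.trans (K.reflexive (≡.cong (α K.^_) (ℕ.+-comm 1 q))) (K.trans α^[q+1]≈1 (K.sym αα⁻¹≈1)))
            α⁻¹^q≈α : α⁻¹ K.^ q K.≈ α
            α⁻¹^q≈α = Domain.*-cancelˡ K.commutativeRing K.isDomain (λ eq → α≉0⁻¹ eq)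
              (K.trans (K.*-congʳ (K.sym α^q≈α⁻¹)) (K.trans (K.sym (K.^-distrib-* α α⁻¹ q))
                (K.trans (K.^-congˡ q αα⁻¹≈1) (K.trans (Order.1^n≈1 K.commutativeRing q) (K.trans (K.sym αα⁻¹≈1) (K.*-comm α α⁻¹))))))
              where
              α≉0⁻¹ : ¬ (α⁻¹ K.≈ K.0#)
              α≉0⁻¹ = Field.unit≉0 K.commutativeRing K.isField K.1≉0 (K.trans (K.*-comm α⁻¹ α) αα⁻¹≈1)
            -- The q-th power exchanges α and α⁻¹, so it fixes γ₁, which therefore comes from 𝔽q.
            fixed : ∃[ c ] (ι c K.≈ γ₁)
            fixed = F⊂K.fixed⇒∈image (K.trans γ^q (K.*-congˡ (K.trans (K.+-cong α^q≈α⁻¹ α⁻¹^q≈α) (K.+-comm _ _))))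
            c₀ = proj₁ fixed
            ιc≈ = proj₂ fixed
            g = D t F[X].+ F[X].- F[X].const c₀
            g-Top : Top g t F.1#
            g-Top = Top-+ (D-Top′ 0<t) (deg<-neg (deg<-mono 0<t (above (Top-const c₀))))
            gx≈0 : eval x g ≈ 0#
            gx≈0 = begin
              eval x g                                   ≈⟨ EvalHom.+-homo (D t) (F[X].- F[X].const c₀) ⟩
              eval x (D t) + eval x (F[X].- F[X].const c₀) ≈⟨ +-cong (sym jγ₁≈) (trans (EvalHom.-‿homo (F[X].const c₀))
                                                              (-‿cong (trans (Eval.eval-const x c₀) (j.⟦⟧-cong ιc≈)))) ⟩
              j γ₁ - j γ₁                                ≈⟨ -‿inverseʳ _ ⟩
              0#                                         ∎
            f≋g : f F[X].≋ g
            -- Here t = 1, so there is no k with 0 < k < t and the condition on conjugates is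
            -- vacuous.
            f≋g = Minimal.minimal-unique irr f-Top fx≈0 0<t g-Top gx≈0 λ k 0<k k<t →
              contradiction 0<k (ℕ.<⇒≱ (≡.subst (k ℕ.<_) (t≡1 α^[q+1]≈1) k<t))

          caseB : ¬ ((∃[ z ] (ι z K.≈ α)) ⊎ (α K.^ (q ℕ.+ 1) K.≈ K.1#)) →
            map ι f ≋ factor α α⁻¹ K[X].* factor (α K.^ q) (α⁻¹ K.^ q)
          caseB ¬A = ≋-trans (Map.⟦⟧-cong f≋g) map-g
            where
            -- The q-th power exchanges γ₁ and γ₂, so their sum and product come from 𝔽q. The
            -- polynomial `g` is the expansion of (D_t - γ₁)(D_t - γ₂) in terms of these two.
            γ-sum : ∃[ c ] (ι c K.≈ γ₁ K.+ γ₂)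
            γ-sum = F⊂K.fixed⇒∈image (K.trans (Frob.+-homo γ₁ γ₂) (K.trans (K.+-cong γ^q γ₂^q) (K.+-comm _ _)))
            γ-product : ∃[ c ] (ι c K.≈ γ₁ K.* γ₂)
            γ-product = F⊂K.fixed⇒∈image (K.trans (Frob.*-homo γ₁ γ₂) (K.trans (K.*-cong γ^q γ₂^q) (K.*-comm _ _)))
            c₁ = proj₁ γ-sum
            c₂ = proj₁ γ-product
            C₁ = F[X].const c₁
            C₂ = F[X].const c₂
            lower = F[X].- (C₁ F[X].* D t) F[X].+ C₂
            g = D t F[X].* D t F[X].+ lower
            g-Top : Top g (t ℕ.+ t) F.1#
            g-Top = Top-cong F[X].≋-refl (F.*-identityʳ F.1#) (Top-+ (Top-* (D-Top′ 0<t) (D-Top′ 0<t))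
              (deg<-+ (deg<-neg (deg<-mono (ℕ.+-monoˡ-≤ t 0<t) (above (Top-* (Top-const c₁) (D-Top′ 0<t)))))
                      (deg<-mono (ℕ.≤-trans 0<t (ℕ.m≤m+n t t)) (above (Top-const c₂)))))
            δ = eval x (D t)
            gx≈0 : eval x g ≈ 0#
            gx≈0 = begin
              eval x g
                ≈⟨ trans (EvalHom.+-homo (D t F[X].* D t) lower) (+-cong (EvalHom.*-homo (D t) (D t))
                     (trans (EvalHom.+-homo (F[X].- (C₁ F[X].* D t)) C₂) (+-congʳ (trans (EvalHom.-‿homo (C₁ F[X].* D t)) (-‿cong (EvalHom.*-homo C₁ (D t))))))) ⟩
              δ * δ + (- (eval x C₁ * δ) + eval x C₂)
                ≈⟨ +-cong (*-cong (sym jγ₁≈) (sym jγ₁≈)) (+-cong (-‿cong (*-cong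
                     (trans (Eval.eval-const x c₁) (trans (j.⟦⟧-cong (proj₂ γ-sum)) (j.+-homo γ₁ γ₂))) (sym jγ₁≈)))
                     (trans (Eval.eval-const x c₂) (trans (j.⟦⟧-cong (proj₂ γ-product)) (j.*-homo γ₁ γ₂)))) ⟩
              j γ₁ * j γ₁ + (- ((j γ₁ + j γ₂) * j γ₁) + j γ₁ * j γ₂)
                ≈⟨ solve 2 (λ a b → a :* a :+ (:- ((a :+ b) :* a) :+ a :* b) := con (ℤ.+ 0)) refl (j γ₁) (j γ₂) ⟩
              0#  ∎
            f≋g : f F[X].≋ g
            f≋g = Minimal.minimal-unique irr f-Top fx≈0 (ℕ.≤-trans 0<t (ℕ.m≤m+n t t)) g-Top gx≈0 (distinct (¬A ∘ inj₂))
            module S = RingSolver K[X].commutativeRing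
            Δ = map ι (F[X].P.dickson t a)
            G₁ = K[X].const γ₁
            G₂ = K[X].const γ₂
            factored : ∀ d p r → d K[X].* d K[X].+ (K[X].- ((p K[X].+ r) K[X].* d) K[X].+ p K[X].* r) ≋
              (d K[X].+ K[X].- p) K[X].* (d K[X].+ K[X].- r)
            factored = S.solve 3 (λ d p r → d S.:* d S.:+ (S.:- ((p S.:+ r) S.:* d) S.:+ p S.:* r)
              S.:= (d S.:+ S.:- p) S.:* (d S.:+ S.:- r)) ≋-refl
            map-square : map ι (D t F[X].* D t) ≋ Δ K[X].* Δ
            map-square = ≋-trans (Map.*-homo (D t) (D t)) (K-Poly.*-cong {map ι (D t)} {Δ} {map ι (D t)} {Δ} map-D map-D)
            map-linear : map ι (C₁ F[X].* D t) ≋ (G₁ K[X].+ G₂) K[X].* Δ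
            map-linear = ≋-trans (Map.*-homo C₁ (D t)) (K-Poly.*-cong {map ι C₁} {G₁ K[X].+ G₂} {map ι (D t)} {Δ}
              (K[X].∷-cong (proj₂ γ-sum) ≋-refl) map-D)
            map-constant : map ι C₂ ≋ G₁ K[X].* G₂
            map-constant = ≋-trans (K[X].∷-cong (proj₂ γ-product) ≋-refl) (≋-sym (K[X].const-* γ₁ G₂))
            map-lower : map ι lower ≋ K[X].- ((G₁ K[X].+ G₂) K[X].* Δ) K[X].+ G₁ K[X].* G₂
            map-lower = ≋-trans (Map.+-homo (F[X].- (C₁ F[X].* D t)) C₂)
              (K[X].+-cong (≋-trans (Map.-‿homo (C₁ F[X].* D t)) (K[X].neg-cong map-linear)) map-constant)
            map-g : map ι g ≋ factor α α⁻¹ K[X].* factor (α K.^ q) (α⁻¹ K.^ q)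
            map-g = ≋-trans (Map.+-homo (D t F[X].* D t) lower)
              (≋-trans (K[X].+-cong map-square map-lower) (factored Δ G₁ G₂))

  -- Cancelling b^n leaves y^n + w^n = 0, and multiplication by y^n turns this into y^2n + 1 = 0.
  root⇒y^2n≈-1 : eval x (D n) ≈ 0# → y ^ (2 ℕ.* n) ≈ - 1#
  root⇒y^2n≈-1 eq = begin
    y ^ (n ℕ.+ (n ℕ.+ 0))                    ≡⟨ ≡.cong (λ k → y ^ (n ℕ.+ k)) (ℕ.+-identityʳ n) ⟩
    y ^ (n ℕ.+ n)                            ≈⟨ ^-homo-* y n n ⟩
    y ^ n * y ^ n                            ≈⟨ solve 2 (λ a b → a :* a := a :* (a :+ b) :- a :* b) refl (y ^ n) (w ^ n) ⟩
    y ^ n * (y ^ n + w ^ n) - y ^ n * w ^ n  ≈⟨ +-cong (trans (*-congˡ y^n+w^n≈0) (zeroʳ _)) (-‿cong (y^w^≈1 n)) ⟩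
    0# - 1#                                  ≈⟨ +-identityˡ _ ⟩
    - 1#                                     ∎
    where
    y^n+w^n≈0 : y ^ n + w ^ n ≈ 0#
    y^n+w^n≈0 = [ (λ β^n≈0 → contradiction β^n≈0 (nonzero^ β≉0 n)) , id ]′
      (isDomain (β ^ n) (y ^ n + w ^ n) (trans (sym (eval-D-x n)) eq))

  eval-map : ∀ f → Evaluation.eval K.commutativeRing L j-hom x (map ι f) ≈ eval x f
  eval-map []      = refl
  eval-map (c ∷ f) = +-congˡ (*-congˡ (eval-map f))

  divisor⇒y^2n≈-1 : ∀ {f} → eval x f ≈ 0# → F[X].P._∣_ f (F[X].P.dickson n a) → y ^ (2 ℕ.* n) ≈ - 1#
  divisor⇒y^2n≈-1 {f} fx≈0 record { quotient = h ; equality = hf≈D } = root⇒y^2n≈-1 (begin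
    eval x (D n)                 ≈⟨ Eval.eval-cong {x} {x} {D n} {F[X].P.dickson n a} refl (F[X].≋-sym (dickson≋D n 0<n)) ⟩
    eval x (F[X].P.dickson n a)  ≈⟨ Eval.eval-cong {x} {x} {h F[X].* f} {F[X].P.dickson n a} refl (F[X].coeffs hf≈D) ⟨
    eval x (h F[X].* f)          ≈⟨ Eval.eval-* x h f ⟩
    eval x h * eval x f          ≈⟨ trans (*-congˡ fx≈0) (zeroʳ _) ⟩
    0#                           ∎)

  Conclusion : F[X].Poly → Set (c ⊔ c′ ⊔ ℓ′)
  Conclusion f = ∃[ α ] ∃[ t ] ∃[ o ]
    ( ¬ (α K.≈ K.0#)
    × FiniteField.HasOrder 𝔽q² α o
    × 0 ℕ.< t
    × t ∣.∣ (4 ℕ.* n) ÷ gcd (4 ℕ.* n) (q ℕ.^ 2 ℕ.∸ 1)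
    × α K.^ ((2 ℕ.* n) ÷ t) K.≈ K.- K.1#
    × rad t ∣.∣ o
    × gcd t ((q ℕ.^ 2 ℕ.∸ 1) ÷ o) ≡ 1
    × ( let CaseA = (∃[ x ] ι x K.≈ α) ⊎ (α K.^ (q ℕ.+ 1) K.≈ K.1#)
            g = λ β β⁻¹ → map ι (F[X].P.dickson t a) K[X].P.- K[X].const ((ι b K.^ t) K.* (β K.+ β⁻¹))
        in
        (CaseA → map ι f K[X].P.≈ g α (α K.⁻¹))
      × (¬ CaseA → map ι f K[X].P.≈ (g α (α K.⁻¹) K[X].* g (α K.^ q) ((α K.⁻¹) K.^ q)))))

  conclusion : ∀ {f m} → F[X].P.Irreducible f → Top f m F.1# → F[X].P._∣_ f (F[X].P.dickson n a) →
    Evaluation.eval K.commutativeRing L j-hom x (map ι f) ≈ 0# → Conclusion f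
  conclusion {f} {m} irr f-Top f∣D ιfx≈0 = withOrder (t-order y^2n≈-1)
    where
    fx≈0 : eval x f ≈ 0#
    fx≈0 = trans (sym (eval-map f)) ιfx≈0

    y^2n≈-1 : y ^ (2 ℕ.* n) ≈ - 1#
    y^2n≈-1 = divisor⇒y^2n≈-1 fx≈0 f∣D

    withOrder : ∃ (IsLeastPositive (λ k → (y ^ e) ^ k ≈ 1#)) → Conclusion f
    withOrder (t , t-isOrder) = withα (α-exists y^2n≈-1 t-isOrder)
      where
      withα : ∃[ α ] (j α ≈ y ^ t) → Conclusion f
      withα (α , jα≈) = withαOrder (α-order y^2n≈-1 t-isOrder jα≈)
        where
        withαOrder : ∃ (FiniteField.HasOrder 𝔽q² α) → Conclusion f
        withαOrder (o , α-hasOrder) = α , t , o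
          , α≉0 y^2n≈-1 t-isOrder jα≈
          , α-hasOrder
          , proj₁ t-isOrder
          , t∣4n÷gcd y^2n≈-1 t-isOrder
          , α^[2n÷t]≈-1 y^2n≈-1 t-isOrder jα≈
          , rad-t∣o y^2n≈-1 t-isOrder jα≈ α-hasOrder
          , gcd-t y^2n≈-1 t-isOrder jα≈ α-hasOrder
          , (λ A → K[X].coeff-≈ (caseA y^2n≈-1 t-isOrder jα≈ irr f-Top fx≈0 A))
          , (λ ¬A → K[X].coeff-≈ (caseB y^2n≈-1 t-isOrder jα≈ irr f-Top fx≈0 ¬A))

-- Irreducible factors of Dickson polynomials

open import Data.Nat.Base using (_+_; _*_; _∸_; _^_; _%_; _<_)
open import Data.Nat.Divisibility using (_∣_)

theorem3p2 :
    ∀ {c ℓ c′ ℓ′} (q : ℕ) (𝔽q : FiniteField c ℓ q) (𝔽q² : FiniteField c′ ℓ′ (q ^ 2)) →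
    let module F = FiniteField 𝔽q
        module K = FiniteField 𝔽q²
        module F[x] = Polynomial F.rawRing
        module K[x] = Polynomial K.rawRing
    in
    (ι : F.Carrier → K.Carrier) →
    RingMorphisms.IsRingHomomorphism F.rawRing K.rawRing ι →
    IsPrimePower q →
    q % 4 ≡ 3 →
    (a b : F.Carrier) →
    ¬ (a F.≈ F.0#) →
    b F.^ 2 F.≈ a →
    (n : ℕ) →
    0 < n →
    2 ∣ n →
    rad n ∣ q ∸ 1 →
    (f : F[x].Poly) →
    F[x].Irreducible f →
    F[x].Monic f →
    f F[x].∣ F[x].dickson n a →
    ∃[ α ] ∃[ t ] ∃[ o ]
      ( ¬ (α K.≈ K.0#)
      × K.HasOrder α o
      × 0 < t
      × t ∣ (4 * n) ÷ gcd (4 * n) (q ^ 2 ∸ 1)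
      × α K.^ ((2 * n) ÷ t) K.≈ K.- K.1#
      × rad t ∣ o
      × gcd t ((q ^ 2 ∸ 1) ÷ o) ≡ 1
      × ( let CaseA = (∃[ x ] ι x K.≈ α) ⊎ (α K.^ (q + 1) K.≈ K.1#)
              g = λ β β⁻¹ → map ι (F[x].dickson t a) K[x].- K[x].const ((ι b K.^ t) K.* (β K.+ β⁻¹))
          in
          (CaseA → map ι f K[x].≈ g α (α K.⁻¹))
        × (¬ CaseA →
           map ι f K[x].≈ (g α (α K.⁻¹) K[x].* g (α K.^ q) ((α K.⁻¹) K.^ q)))))
theorem3p2 q 𝔽q 𝔽q² ι ι-hom isPrimePower q%4≡3 a b a≉0 b²≈a n 0<n _ rad-n∣q-1 f irr (d , f-coeff , f-above) f∣D =
  DicksonFactor.conclusion setting irr f-Top f∣D E.root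
  where
  module F where
    open FiniteField 𝔽q public
    open Enumerated 𝔽q using (isField) public
  module K = FiniteField 𝔽q²
  module F[X] = PolynomialRing F.commutativeRing
  module K[X] = PolynomialRing K.commutativeRing
  module ι where
    open RingHomomorphism.Properties F.commutativeRing K.commutativeRing ι-hom public
    open ChangeOfCoefficients F.commutativeRing K.commutativeRing ι-hom public
  open Degree F.commutativeRing
  module DegreeK = Degree K.commutativeRing

  b≉0 : ¬ (b F.≈ F.0#)
  b≉0 b≈0 = a≉0 (F.trans (F.sym b²≈a) (F.trans (F.*-congʳ b≈0) (F.zeroˡ _)))

  bb⁻¹≈1 : ι b K.* ι (b F.⁻¹) K.≈ K.1#
  bb⁻¹≈1 = K.trans (K.sym (ι.*-homo b (b F.⁻¹))) (K.trans (ι.⟦⟧-cong (F.*-inverseʳ b≉0)) ι.1#-homo)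

  f-Top : Top f d F.1#
  f-Top = top f-coeff (bounded f-above)

  -- A monic polynomial of degree 0 is 1, and an irreducible one does not divide 1. Positive degree
  -- is what allows adjoining a root.
  degree-positive : ∀ {m} → Top f m F.1# → 0 < m
  degree-positive {suc _} _ = s≤s z≤n
  degree-positive {zero}  t = contradiction f∣1 (F[X].P.Irreducible.p∤1 irr)
    where
    f≋1 : f F[X].≋ F[X].const F.1#
    f≋1 = F[X].coeffs λ { zero → coeff-top t ; (suc k) → coeff-≈0 (above t) (suc k) (s≤s z≤n) }
    f∣1 : F[X].P._∣_ f (F[X].const F.1#)
    f∣1 = record { quotient = F[X].const F.1# ; equality = F[X].coeff-≈ (F[X].≋-trans (F[X].*-identityˡ f) f≋1) }

  ιf-Top : DegreeK.Top (map ι f) d K.1#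
  ιf-Top = DegreeK.top (K.trans (ι.coeff-map f d) (K.trans (ι.⟦⟧-cong f-coeff) ι.1#-homo))
    (DegreeK.bounded λ k d<k → K.trans (ι.coeff-map f k) (K.trans (ι.⟦⟧-cong (f-above k d<k)) ι.0#-homo))

  -- The extension is built over 𝔽q² and not over 𝔽q, so that y^t, once fixed by the q²-th power,
  -- can be found in the image of 𝔽q².
  module E = RootExtension (rootExtension 𝔽q² bb⁻¹≈1 (degree-positive f-Top) ιf-Top)

  setting : Setting _ _ _ _ _ _
  setting = record
    { q = q ; 𝔽q = 𝔽q ; 𝔽q² = 𝔽q² ; ι = ι ; ι-hom = ι-hom ; isPrimePower = isPrimePower ; q%4≡3 = q%4≡3
    ; a = a ; b = b ; b≉0 = b≉0 ; b²≈a = b²≈a ; n = n ; 0<n = 0<n ; rad-n∣q-1 = rad-n∣q-1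
    ; L = E.L ; L-isField = E.isField ; L-1≉0 = E.1≉0 ; j = E.embedding ; j-hom = E.isHomomorphism
    ; y = E.y ; w = E.w ; yw≈1 = E.y*w≈1 }
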